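{- Let $\alpha$ be a positive irrational number and let $c=h/k\in(0,1)$ with $h,k$ coprime positive integers. Let $(a_n)_{n\ge 0}$ be the partial quotients of $\alpha$ and $(p_n/q_n)_{n\ge -2}$ its convergents. Then the following three statements are equivalent: (1) $\sup_n D_n(\alpha,c)<+\infty$; (2) there exists an even integer $m\ge -1$ such that $k\mid q_{m+2n}$ for all $n\ge 0$; (3) there exists an even integer $m\ge -1$ such that the tuple $(a_0,a_1,\dots,a_m)$ is of type-$k$ and $k\mid a_{m+2n}$ for all $n\ge 1$. Likewise, the following three statements are equivalent: (1') $\inf_n D_n(\alpha,c)>-\infty$; (2') there exists an odd integer $m\ge -1$ such that $k\mid q_{m+2n}$ for all $n\ge 0$; (3') there exists an odd integer $m\ge -1$ such that the tuple $(a_0,a_1,\dots,a_m)$ is of type-$k$ and $k\mid a_{m+2n}$ for all $n\ge 1$.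
   Context: For $n\ge 0$, $D_n(\alpha,c)=\sum_{j=1}^n 1_{[0,c)}(\{j\alpha\})-cn$, where $\{\cdot\}$ is the fractional part. Continued fractions: $\alpha=[a_0;a_1a_2a_3\cdots]$ with $a_0\ge 0$ and $a_n\ge 1$ integers for $n\ge1$; $p_{ -2}=0,\ p_{ -1}=1,\ q_{ -2}=1,\ q_{ -1}=0$ and $p_n=a_np_{n-1}+p_{n-2}$, $q_n=a_nq_{n-1}+q_{n-2}$ for $n\ge 0$. Type-$k$: for an integer $N$, $\pi(N)\in\{0,1,\dots,k-1\}$ denotes its residue modulo $k$. For a tuple $M=(a_0,\dots,a_m)$ of non-negative integers, $m\ge -1$ (the case $m=-1$ is the empty tuple), define $q^M_{ -2}=1$, $q^M_{ -1}=0$, $q^M_n=a_nq^M_{n-1}+q^M_{n-2}$ for $0\le n\le m$. The character of $M$ is $\kappa(M)=(\pi(q^M_{m-1}),\pi(q^M_m))$. The tuple $M$ is of type-$k$ if $\kappa(M)=(j,0)$ for some $j\in\{1,\dots,k-1\}$. In particular the empty tuple has character $(1,0)$ and is of type-$k$. -}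

module Defs where

open import Axiom.ExcludedMiddle using (ExcludedMiddle)
open import Data.Empty using (⊥-elim)
open import Data.Integer as ℤ using (ℤ; +_; -[1+_]; ∣_∣)
import Data.Integer.Divisibility as ℤᵈ
import Data.Integer.Properties as ℤᵖ
open import Data.List using (List; foldl; applyUpTo)
open import Data.Nat as ℕ using (ℕ; zero; suc)
import Data.Nat.Properties as ℕᵖ
open import Data.Product using (_×_; _,_; ∃; ∃-syntax; proj₁; proj₂)
open import Data.Rational as ℚ using (ℚ; 0ℚ; Positive; 1/_)
open import Data.Rational.Literals using (fromℤ)
import Data.Rational.Properties as ℚᵖ
open import Data.Sum using (_⊎_; inj₁; inj₂)
open import Function using (_⇔_)
open import Level using (0ℓ)
open import Relation.Binary.Definitions using (tri<; tri≈; tri>)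
open import Relation.Binary.PropositionalEquality
  using (_≡_; refl; sym; trans; cong; subst)
open import Relation.Nullary using (¬_; yes; no)

-- Dedekind reals: Lower q means q < x and Upper q means x < q.

record ℝ : Set₁ where
  field
    Lower Upper     : ℚ → Set
    lower-inhabited : ∃ Lower
    upper-inhabited : ∃ Upper
    lower-closed    : ∀ {p q} → p ℚ.≤ q → Lower q → Lower p
    upper-closed    : ∀ {p q} → p ℚ.≤ q → Upper p → Upper q
    lower-open      : ∀ {p} → Lower p → ∃[ q ] (p ℚ.< q × Lower q)
    upper-open      : ∀ {q} → Upper q → ∃[ p ] (p ℚ.< q × Upper p)
    disjoint        : ∀ {q} → Lower q → ¬ Upper q
    located         : ∀ {p q} → p ℚ.< q → Lower p ⊎ Upper q

open ℝ public

infix 4 _≃_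

_≃_ : ℝ → ℝ → Set
x ≃ y = ∀ q → (Lower x q ⇔ Lower y q) × (Upper x q ⇔ Upper y q)

private
  p-1<p : ∀ p → p ℚ.- ℚ.1ℚ ℚ.< p
  p-1<p p = subst (p ℚ.- ℚ.1ℚ ℚ.<_) (ℚᵖ.+-identityʳ p)
              (ℚᵖ.+-monoʳ-< p (ℚᵖ.negative⁻¹ (ℚ.- ℚ.1ℚ)))

  p<p+1 : ∀ p → p ℚ.< p ℚ.+ ℚ.1ℚ
  p<p+1 p = subst (ℚ._< p ℚ.+ ℚ.1ℚ) (ℚᵖ.+-identityʳ p)
              (ℚᵖ.+-monoʳ-< p (ℚᵖ.positive⁻¹ ℚ.1ℚ))

  p-r+r : ∀ p r → (p ℚ.- r) ℚ.+ r ≡ p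
  p-r+r p r = trans (ℚᵖ.+-assoc p (ℚ.- r) r)
                (trans (cong (p ℚ.+_) (ℚᵖ.+-inverseˡ r)) (ℚᵖ.+-identityʳ p))

  p+r-r : ∀ p r → (p ℚ.+ r) ℚ.- r ≡ p
  p+r-r p r = trans (ℚᵖ.+-assoc p r (ℚ.- r))
                (trans (cong (p ℚ.+_) (ℚᵖ.+-inverseʳ r)) (ℚᵖ.+-identityʳ p))

fromℚ : ℚ → ℝ
fromℚ r = record
  { Lower           = ℚ._< r
  ; Upper           = r ℚ.<_
  ; lower-inhabited = r ℚ.- ℚ.1ℚ , p-1<p r
  ; upper-inhabited = r ℚ.+ ℚ.1ℚ , p<p+1 r
  ; lower-closed    = ℚᵖ.≤-<-trans
  ; upper-closed    = λ p≤q r<p → ℚᵖ.<-≤-trans r<p p≤q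
  ; lower-open      = λ p<r → let (q , p<q , q<r) = ℚᵖ.<-dense p<r in q , p<q , q<r
  ; upper-open      = λ r<q → let (p , r<p , p<q) = ℚᵖ.<-dense r<q in p , p<q , r<p
  ; disjoint        = ℚᵖ.<-asym
  ; located         = loc
  }
  where
  loc : ∀ {p q} → p ℚ.< q → p ℚ.< r ⊎ r ℚ.< q
  loc {p} p<q with ℚᵖ.<-cmp p r
  ... | tri< p<r _ _    = inj₁ p<r
  ... | tri≈ _ refl _   = inj₂ p<q
  ... | tri> _ _ r<p    = inj₂ (ℚᵖ.<-trans r<p p<q)

-- Real minus rational.

infixl 6 _⊖_

_⊖_ : ℝ → ℚ → ℝ
x ⊖ r = record
  { Lower           = λ q → Lower x (q ℚ.+ r)
  ; Upper           = λ q → Upper x (q ℚ.+ r)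
  ; lower-inhabited = let (l , l<x) = lower-inhabited x
                      in l ℚ.- r , subst (Lower x) (sym (p-r+r l r)) l<x
  ; upper-inhabited = let (u , x<u) = upper-inhabited x
                      in u ℚ.- r , subst (Upper x) (sym (p-r+r u r)) x<u
  ; lower-closed    = λ p≤q → lower-closed x (ℚᵖ.+-monoˡ-≤ r p≤q)
  ; upper-closed    = λ p≤q → upper-closed x (ℚᵖ.+-monoˡ-≤ r p≤q)
  ; lower-open      = λ {p} p<x → let (s , p<s , s<x) = lower-open x p<x in
      s ℚ.- r
      , subst (ℚ._< s ℚ.- r) (p+r-r p r) (ℚᵖ.+-monoˡ-< (ℚ.- r) p<s)
      , subst (Lower x) (sym (p-r+r s r)) s<x
  ; upper-open      = λ {q} x<q → let (s , s<q , x<s) = upper-open x x<q in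
      s ℚ.- r
      , subst (s ℚ.- r ℚ.<_) (p+r-r q r) (ℚᵖ.+-monoˡ-< (ℚ.- r) s<q)
      , subst (Upper x) (sym (p-r+r s r)) x<s
  ; disjoint        = disjoint x
  ; located         = λ p<q → located x (ℚᵖ.+-monoˡ-< r p<q)
  }

-- Positive rational times real: q < r · x iff q / r < x.

infixr 7 _·_

_·_ : (r : ℚ) .{{_ : Positive r}} → ℝ → ℝ
r · x = record
  { Lower           = λ q → Lower x (q ℚ.* r⁻¹)
  ; Upper           = λ q → Upper x (q ℚ.* r⁻¹)
  ; lower-inhabited = let (l , l<x) = lower-inhabited x
                      in l ℚ.* r , subst (Lower x) (sym (p*r*r⁻¹ l)) l<x
  ; upper-inhabited = let (u , x<u) = upper-inhabited x
                      in u ℚ.* r , subst (Upper x) (sym (p*r*r⁻¹ u)) x<u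
  ; lower-closed    = λ p≤q → lower-closed x (ℚᵖ.*-monoʳ-≤-nonNeg r⁻¹ p≤q)
  ; upper-closed    = λ p≤q → upper-closed x (ℚᵖ.*-monoʳ-≤-nonNeg r⁻¹ p≤q)
  ; lower-open      = λ {p} p<x → let (s , p<s , s<x) = lower-open x p<x in
      s ℚ.* r
      , subst (ℚ._< s ℚ.* r) (p*r⁻¹*r p) (ℚᵖ.*-monoˡ-<-pos r p<s)
      , subst (Lower x) (sym (p*r*r⁻¹ s)) s<x
  ; upper-open      = λ {q} x<q → let (s , s<q , x<s) = upper-open x x<q in
      s ℚ.* r
      , subst (s ℚ.* r ℚ.<_) (p*r⁻¹*r q) (ℚᵖ.*-monoˡ-<-pos r s<q)
      , subst (Upper x) (sym (p*r*r⁻¹ s)) x<s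
  ; disjoint        = disjoint x
  ; located         = λ p<q → located x (ℚᵖ.*-monoˡ-<-pos r⁻¹ p<q)
  }
  where
  instance
    r≢0 = ℚᵖ.pos⇒nonZero r
  r⁻¹ = 1/ r
  instance
    r⁻¹>0 : Positive r⁻¹
    r⁻¹>0 = ℚᵖ.1/pos⇒pos r
    r⁻¹≥0 : ℚ.NonNegative r⁻¹
    r⁻¹≥0 = ℚᵖ.pos⇒nonNeg r⁻¹
  p*r*r⁻¹ : ∀ p → p ℚ.* r ℚ.* r⁻¹ ≡ p
  p*r*r⁻¹ p = trans (ℚᵖ.*-assoc p r r⁻¹)
                (trans (cong (p ℚ.*_) (ℚᵖ.*-inverseʳ r)) (ℚᵖ.*-identityʳ p))
  p*r⁻¹*r : ∀ p → p ℚ.* r⁻¹ ℚ.* r ≡ p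
  p*r⁻¹*r p = trans (ℚᵖ.*-assoc p r⁻¹ r)
                (trans (cong (p ℚ.*_) (ℚᵖ.*-inverseˡ r)) (ℚᵖ.*-identityʳ p))

IsPositive : ℝ → Set
IsPositive x = Lower x 0ℚ

Irrational : ℝ → Set
Irrational x = ¬ (∃[ r ] x ≃ fromℚ r)

infix 4 _⟶_

_⟶_ : (ℕ → ℚ) → ℝ → Set
s ⟶ x = ∀ ε → 0ℚ ℚ.< ε →
  ∃[ N ] (∀ n → N ℕ.≤ n → Lower x (s n ℚ.- ε) × Upper x (s n ℚ.+ ε))

-- Existence of the integer part, and the indicator of an arbitrary
-- proposition, need classical logic; it enters as an explicit argument.

module _ (em : ExcludedMiddle 0ℓ) where

  private
    search : (x : ℝ) (d : ℕ) (z : ℤ) →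
             ¬ Upper x (fromℤ z) → Upper x (fromℤ (z ℤ.+ + d)) →
             ∃[ y ] (¬ Upper x (fromℤ y) × Upper x (fromℤ (y ℤ.+ ℤ.1ℤ)))
    search x zero z z≤x x<z =
      ⊥-elim (z≤x (subst (λ y → Upper x (fromℤ y)) (ℤᵖ.+-identityʳ z) x<z))
    search x (suc d) z z≤x x<z+d with em {Upper x (fromℤ (z ℤ.+ ℤ.1ℤ))}
    ... | yes x<z+1 = z , z≤x , x<z+1
    ... | no  z+1≤x = search x d (z ℤ.+ ℤ.1ℤ) z+1≤x
            (subst (λ y → Upper x (fromℤ y)) (sym (ℤᵖ.+-assoc z ℤ.1ℤ (+ d))) x<z+d)

    q≤∣q∣ : ∀ q → q ℚ.≤ fromℤ (+ ∣ ℚ.↥ q ∣)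
    q≤∣q∣ (ℚ.mkℚ (+ n) d _) = ℚ.*≤* (ℤᵖ.*-monoˡ-≤-nonNeg (+ n) {ℤ.1ℤ} {+ suc d} (ℤ.+≤+ (ℕ.s≤s ℕ.z≤n)))
    q≤∣q∣ (ℚ.mkℚ -[1+ n ] d _) = ℚ.*≤* ℤ.-≤+

    -∣q∣≤q : ∀ q → fromℤ (ℤ.- (+ ∣ ℚ.↥ q ∣)) ℚ.≤ q
    -∣q∣≤q (ℚ.mkℚ (+ zero) d _) = ℚ.*≤* (ℤ.+≤+ ℕ.z≤n)
    -∣q∣≤q (ℚ.mkℚ (+ suc n) d _) = ℚ.*≤* ℤ.-≤+
    -∣q∣≤q (ℚ.mkℚ -[1+ n ] d _) =
      ℚ.*≤* (ℤᵖ.*-monoˡ-≤-nonPos -[1+ n ] {ℤ.1ℤ} {+ suc d} (ℤ.+≤+ (ℕ.s≤s ℕ.z≤n)))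

  integerPart : (x : ℝ) →
    ∃[ z ] (¬ Upper x (fromℤ z) × Upper x (fromℤ (z ℤ.+ ℤ.1ℤ)))
  integerPart x = search x (a ℕ.+ b) (ℤ.- (+ a))
    (λ x<-a → disjoint x l<x (upper-closed x (-∣q∣≤q l) x<-a))
    (subst (λ y → Upper x (fromℤ y)) eq (upper-closed x (q≤∣q∣ u) x<u))
    where
    l = proj₁ (lower-inhabited x)
    l<x = proj₂ (lower-inhabited x)
    u = proj₁ (upper-inhabited x)
    x<u = proj₂ (upper-inhabited x)
    a = ∣ ℚ.↥ l ∣
    b = ∣ ℚ.↥ u ∣
    eq : + b ≡ ℤ.- (+ a) ℤ.+ (+ (a ℕ.+ b))
    eq = sym (trans (sym (ℤᵖ.+-assoc (ℤ.- (+ a)) (+ a) (+ b)))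
           (trans (cong (ℤ._+ + b) (ℤᵖ.+-inverseˡ (+ a))) (ℤᵖ.+-identityˡ (+ b))))

  ⌊_⌋ : ℝ → ℤ
  ⌊ x ⌋ = proj₁ (integerPart x)

  fractionalPart : ℝ → ℝ
  fractionalPart x = x ⊖ fromℤ ⌊ x ⌋

  indicator : Set → ℕ
  indicator P with em {P}
  ... | yes _ = 1
  ... | no  _ = 0

  -- visits α c n = Σ_{j=1}^{n} 1_{[0,c)}({jα})

  visits : ℝ → ℚ → ℕ → ℕ
  visits α c zero    = 0
  visits α c (suc n) = visits α c n ℕ.+ indicator (¬ Upper y 0ℚ × Upper y c)
    where y = fractionalPart (fromℤ (+ suc n) · α)

  D : ℝ → ℚ → ℕ → ℚ
  D α c n = fromℤ (+ visits α c n) ℚ.- c ℚ.* fromℤ (+ n)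

BoundedAbove : (ℕ → ℚ) → Set
BoundedAbove s = ∃[ B ] (∀ n → s n ℚ.≤ B)

BoundedBelow : (ℕ → ℚ) → Set
BoundedBelow s = ∃[ B ] (∀ n → B ℚ.≤ s n)

-- The sequence with u₋₂ = s, u₋₁ = t, uₙ = aₙuₙ₋₁ + uₙ₋₂, stored with
-- indices shifted by two: recurrence s t a i is u_{i-2}.

recurrence : ℕ → ℕ → (ℕ → ℕ) → ℕ → ℕ
recurrence s t a zero          = s
recurrence s t a (suc zero)    = t
recurrence s t a (suc (suc n)) = a n ℕ.* recurrence s t a (suc n) ℕ.+ recurrence s t a n

-- p a n and q a n are pₙ and qₙ for n ≥ -2; for n < -2 the value is junk.

p : (ℕ → ℕ) → ℤ → ℕ
p a n = recurrence 0 1 a ∣ + 2 ℤ.+ n ∣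

q : (ℕ → ℕ) → ℤ → ℕ
q a n = recurrence 1 0 a ∣ + 2 ℤ.+ n ∣

PositiveTail : (ℕ → ℕ) → Set
PositiveTail a = ∀ n → 1 ℕ.≤ n → 1 ℕ.≤ a n

1≤q : ∀ {a} → PositiveTail a → ∀ n → 1 ℕ.≤ q a (+ n)
1≤q {a} pos zero    = ℕᵖ.m≤n+m 1 (a 0 ℕ.* 0)
1≤q {a} pos (suc n) = ℕᵖ.≤-trans
  (ℕᵖ.*-mono-≤ (pos (suc n) (ℕ.s≤s ℕ.z≤n)) (1≤q pos n))
  (ℕᵖ.m≤m+n _ (recurrence 1 0 a (suc n)))

convergent : (a : ℕ → ℕ) → PositiveTail a → ℕ → ℚ
convergent a pos n = ((+ p a (+ n)) ℚ./ q a (+ n)) {{ℕ.>-nonZero (1≤q pos n)}}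

-- α = [a₀; a₁, a₂, …], the infinite continued fraction being the limit of
-- its convergents.

record IsContinuedFraction (α : ℝ) (a : ℕ → ℕ) : Set where
  field
    positiveTail : PositiveTail a
    limit        : convergent a positiveTail ⟶ α

-- For M = (a₀,…,aₘ), the pair (q^M_{m-1}, q^M_m): the fold starts from
-- (q₋₂, q₋₁) = (1, 0) and each entry advances the recurrence by one step.

lastDenominators : List ℕ → ℕ × ℕ
lastDenominators = foldl (λ (x , y) a → y , a ℕ.* y ℕ.+ x) (1 , 0)

κ : (k : ℕ) .{{_ : ℕ.NonZero k}} → List ℕ → ℕ × ℕ
κ k M = let (x , y) = lastDenominators M in x ℕ.% k , y ℕ.% k

OfType : (k : ℕ) .{{_ : ℕ.NonZero k}} → List ℕ → Set
OfType k M = ∃[ j ] (1 ℕ.≤ j × j ℕ.< k × κ k M ≡ (j , 0))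

-- The tuple (a₀,…,aₘ), of length m + 1, for an integer m ≥ -1.

prefix : (ℕ → ℕ) → ℤ → List ℕ
prefix a m = applyUpTo a ∣ ℤ.1ℤ ℤ.+ m ∣

Even Odd : ℤ → Set
Even m = + 2 ℤᵈ.∣ m
Odd m  = ¬ Even m

{-# OPTIONS --safe #-}
module Submission where

-- A pair x = (J, Z) has the heights J pₙ - Z qₙ, which satisfy the recurrence of the
-- convergents; J α > Z iff they are eventually positive, so all sign questions about α
-- become questions about two consecutive heights.  Let S = k D.
--
-- Let n be even, v = qₙ, w = qₙ₊₁ and qₙ₊₂ = v + a w, with k dividing v and qₙ₊₂.  Advancing by
-- w moves the points {jα}, 0 < j < qₙ₊₂, slightly to the left, and none of them crosses 0.
-- Hence b ↦ S (r + b w) is convex.  Since S v = S qₙ₊₂ = 0, it lies below S r when r ≤ v, and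
-- since the only point that crosses c is among the first v, also when v < r ≤ w.  Therefore
-- S is maximal on [0, qₙ₊₂] at a point of [0, v], and S is bounded above.
--
-- Conversely the same monotonicity gives S qₙ₊₂ ≥ a S qₙ₊₁ + S qₙ for every even n, while
-- S qₙ ≤ k.  If k ∤ qₙ₊₁, then S qₙ₊₁ ≠ 0; so if this happens infinitely often then
-- S qₛ < 0 for infinitely many s.  As qₛ α → 0 mod 1, S (N + qₛ) ≤ S N + S qₛ for large s,
-- and S is unbounded below.
--
-- The substitution α ↦ -α, c ↦ 1 - c, S ↦ -S exchanges the two parities.

open import Axiom.ExcludedMiddle using (ExcludedMiddle)
open import Data.Bool using (Bool; true; false; not)
open import Data.Empty using (⊥-elim)
open import Data.Fin as Fin using (Fin)
import Data.Fin.Properties as Finᵖ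
open import Data.Integer as ℤ
  using (ℤ; +_; -[1+_]; ∣_∣; 0ℤ; 1ℤ; -1ℤ; _≤_; _+_; _-_; -_; +≤+; -≤-; -≤+)
open import Data.Integer using () renaming (_+_ to _+ᶻ_)
import Data.Integer.Properties as ℤᵖ
open import Data.Integer.Tactic.RingSolver using (solve-∀)
open import Data.List using (foldl; applyUpTo)
open import Data.Nat as ℕ using (ℕ; zero; suc; z≤n; s≤s; NonZero; _*_) renaming (_≤_ to _≤ᴺ_)
open import Data.Nat.Coprimality as Coprimality using (Coprime; coprime-divisor)
import Data.Nat.DivMod as ℕᵈ
open import Data.Nat.Divisibility
  using (_∣_; divides; quotient; _∣?_; ∣-trans; ∣1⇒≡1; ∣m⇒∣m*n; ∣n⇒∣m*n; n∣m*n; ∣m∣n⇒∣m+n; ∣m+n∣m⇒∣n; m%n≡0⇒n∣m; n∣m⇒m%n≡0)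
import Data.Nat.Properties as ℕᵖ
open import Data.Product using (_×_; _,_; ∃-syntax; proj₁; proj₂)
open import Data.Rational as ℚ using (ℚ; 0ℚ; 1ℚ; 1/_; _/_; _<_)
open import Data.Rational.Literals using (fromℤ)
import Data.Rational.Properties as ℚᵖ
open import Data.Rational.Unnormalised using (mkℚᵘ; *≡*)
import Data.Rational.Unnormalised.Properties as ℚᵘᵖ
open import Data.Sum using (_⊎_; inj₁; inj₂)
open import Function using (_⇔_; mk⇔; Equivalence)
open import Function.Definitions using (Injective)
open import Level using (0ℓ)
open import Relation.Binary.PropositionalEquality
  using (_≡_; refl; sym; trans; cong; cong₂; subst; subst₂; module ≡-Reasoning)
open import Relation.Nullary using (¬_; yes; no; contradiction)

-- S vanishes at an even denominator v = qₙ divisible by k for the following reason. For 1 ≤ j ≤ v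
-- the height of (j, floor of jα) at n is the residue of j pₙ modulo v. These residues are distinct,
-- and when k divides v, jα lies in [0, c) modulo 1 exactly for the h v / k residues below h v / k.
-- Without divisibility, rounding costs at most k, which gives S v ≤ k.
--
-- The passage from (v, w] down to [0, v] is a shift by v itself: it moves the points slightly to
-- the right, and up to time w none passes an integer, so S N ≤ S (N - v) + S v.
--
-- The parities cross. Even denominators bound S above, whereas the converse, also run at even n,
-- concludes about odd denominators from a lower bound. Hence each equivalence takes one direction
-- from the rotation and the other from its reflection; `Rotation` is abstract so that both are
-- instances of it.
--
-- (2) ⇔ (3) is arithmetic: qᵢ and qᵢ₊₁ are coprime, so k dividing both qᵢ and qᵢ₊₂ = aᵢ₊₂ qᵢ₊₁ + qᵢ
-- must divide aᵢ₊₂.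

infixl 6 _⊕_
infixl 7 _⊗_

-- Integer inequalities by explicit certificates

gap : ∀ {i j} → i ≤ j → 0ℤ ≤ j - i
gap = ℤᵖ.i≤j⇒0≤j-i

_⊕_ : ∀ {i j} → 0ℤ ≤ i → 0ℤ ≤ j → 0ℤ ≤ i + j
_⊕_ = ℤᵖ.+-mono-≤

_⊗_ : ∀ {i j} → 0ℤ ≤ i → 0ℤ ≤ j → 0ℤ ≤ i ℤ.* j
_⊗_ {+ m} {+ n} _ _ = subst (0ℤ ≤_) (ℤᵖ.pos-* m n) (+≤+ z≤n)

-- Estimates below are certified by writing the difference as a sum of products of nonnegative
-- terms, built from the hypotheses with `⊕` and `⊗`; the ring solver checks the identity. In
-- `absurd-gap` the certificate sums to -1.
from-gap : ∀ {i j d} → 0ℤ ≤ d → d ≡ j - i → i ≤ j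
from-gap 0≤d eq = ℤᵖ.0≤i-j⇒j≤i (subst (0ℤ ≤_) eq 0≤d)

absurd-gap : ∀ {A : Set} {d} → 0ℤ ≤ d → d ≡ -1ℤ → A
absurd-gap 0≤d refl with () ← 0≤d

0≤+ : ∀ n → 0ℤ ≤ + n
0≤+ n = +≤+ z≤n

≤-1⊎0≤ : ∀ i → i ≤ -1ℤ ⊎ 0ℤ ≤ i
≤-1⊎0≤ (+ n)    = inj₂ (0≤+ n)
≤-1⊎0≤ -[1+ n ] = inj₁ (-≤- z≤n)

≤0⊎1≤ : ∀ i → i ≤ 0ℤ ⊎ 1ℤ ≤ i
≤0⊎1≤ (+ zero)  = inj₁ ℤᵖ.≤-refl
≤0⊎1≤ (+ suc n) = inj₂ (+≤+ (s≤s z≤n))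
≤0⊎1≤ -[1+ n ]  = inj₁ -≤+

1≤*⇒1≤ : ∀ {i j} → 1ℤ ≤ i → 1ℤ ≤ i ℤ.* j → 1ℤ ≤ j
1≤*⇒1≤ {i} {j} 1≤i 1≤ij with ≤0⊎1≤ j
... | inj₂ 1≤j = 1≤j
... | inj₁ j≤0 = absurd-gap ((gap 1≤i ⊕ 0≤+ 1) ⊗ gap j≤0 ⊕ gap 1≤ij) (eq i j)
  where
  eq : ∀ i j → (i - 1ℤ + 1ℤ) ℤ.* (0ℤ - j) + (i ℤ.* j - 1ℤ) ≡ -1ℤ
  eq = solve-∀

*≤0⇒≤0 : ∀ {i j} → 1ℤ ≤ i → i ℤ.* j ≤ 0ℤ → j ≤ 0ℤ
*≤0⇒≤0 {i} {j} 1≤i ij≤0 with ≤0⊎1≤ j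
... | inj₁ j≤0 = j≤0
... | inj₂ 1≤j = absurd-gap (gap 1≤i ⊗ gap 1≤j ⊕ gap 1≤i ⊕ gap 1≤j ⊕ gap ij≤0) (eq i j)
  where
  eq : ∀ i j → (i - 1ℤ) ℤ.* (j - 1ℤ) + (i - 1ℤ) + (j - 1ℤ) + (0ℤ - i ℤ.* j) ≡ -1ℤ
  eq = solve-∀

*≤-1⇒*≤- : ∀ k {x} → 1 ℕ.≤ k → + k ℤ.* x ≤ -1ℤ → + k ℤ.* x ≤ - + k
*≤-1⇒*≤- k {x} 1≤k kx≤-1 with ≤-1⊎0≤ x
... | inj₁ x≤-1 = from-gap (0≤+ k ⊗ gap x≤-1) (eq (+ k) x)
  where
  eq : ∀ k x → k ℤ.* (-1ℤ - x) ≡ - k - k ℤ.* x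
  eq = solve-∀
... | inj₂ 0≤x = absurd-gap (0≤+ k ⊗ 0≤x ⊕ gap kx≤-1) (eq (+ k ℤ.* x))
  where
  eq : ∀ y → y + (-1ℤ - y) ≡ -1ℤ
  eq = solve-∀

-- `x` and `y` will be two consecutive heights, and J = v x - w y is Cramer's rule for them.
coord≥1 : ∀ {J v w x y} → 1ℤ ≤ v → 0ℤ ≤ w → J ≡ v ℤ.* x - w ℤ.* y → 1ℤ ≤ J → 0ℤ ≤ y → 1ℤ ≤ x
coord≥1 {J} {v} {w} {x} {y} 1≤v 0≤w J≡ 1≤J 0≤y =
  1≤*⇒1≤ 1≤v (from-gap (gap (subst (1ℤ ≤_) J≡ 1≤J) ⊕ 0≤w ⊗ 0≤y) (eq v w x y))
  where
  eq : ∀ v w x y → (v ℤ.* x - w ℤ.* y - 1ℤ) + w ℤ.* y ≡ v ℤ.* x - 1ℤ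
  eq = solve-∀

coord-large : ∀ {J v w x y} → 0ℤ ≤ v → 0ℤ ≤ w → J ≡ v ℤ.* x - w ℤ.* y → J + 1ℤ ≤ v → y ≤ 0ℤ → ¬ 1ℤ ≤ x
coord-large {J} {v} {w} {x} {y} 0≤v 0≤w J≡ J<v y≤0 1≤x =
  absurd-gap (gap (subst (λ i → i + 1ℤ ≤ v) J≡ J<v) ⊕ 0≤w ⊗ gap y≤0 ⊕ 0≤v ⊗ gap 1≤x) (eq v w x y)
  where
  eq : ∀ v w x y → (v - (v ℤ.* x - w ℤ.* y + 1ℤ)) + w ℤ.* (0ℤ - y) + v ℤ.* (x - 1ℤ) ≡ -1ℤ
  eq = solve-∀

-- Linear recurrences with positive coefficients

Eventually≥1 : (ℕ → ℤ) → Set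
Eventually≥1 y = ∃[ n₀ ] (∀ n → n₀ ℕ.≤ n → 1ℤ ≤ y n)

Recurrent : (ℕ → ℕ) → (ℕ → ℤ) → Set
Recurrent a y = ∀ n → y (2 ℕ.+ n) ≡ + a n ℤ.* y (1 ℕ.+ n) + y n

module _ {a : ℕ → ℕ} (1≤a : ∀ n → 1 ℕ.≤ a n) where

  private
    step : ∀ {c y₀ y₁} → 1 ℕ.≤ c → 0ℤ ≤ y₀ → 1ℤ ≤ y₁ → 1ℤ ≤ + c ℤ.* y₁ + y₀
    step {c} {y₀} {y₁} 1≤c 0≤y₀ 1≤y₁ =
      from-gap (gap (+≤+ 1≤c) ⊗ (gap 1≤y₁ ⊕ 0≤+ 1) ⊕ gap 1≤y₁ ⊕ 0≤y₀) (eq (+ c) y₀ y₁)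
      where
      eq : ∀ c y₀ y₁ → (c - 1ℤ) ℤ.* (y₁ - 1ℤ + 1ℤ) + (y₁ - 1ℤ) + y₀ ≡ c ℤ.* y₁ + y₀ - 1ℤ
      eq = solve-∀

  recurrent-neg : ∀ {y} → Recurrent a y → Recurrent a (λ n → - y n)
  recurrent-neg {y} rec n = trans (cong -_ (rec n)) (eq (+ a n) (y (1 ℕ.+ n)) (y n))
    where
    eq : ∀ c y₁ y₀ → - (c ℤ.* y₁ + y₀) ≡ c ℤ.* - y₁ + - y₀
    eq = solve-∀

  module _ {y : ℕ → ℤ} (rec : Recurrent a y) where

    positive-persists : ∀ {n} → 0ℤ ≤ y n → 1ℤ ≤ y (1 ℕ.+ n) →
                        ∀ d → 0ℤ ≤ y (d ℕ.+ n) × 1ℤ ≤ y (1 ℕ.+ d ℕ.+ n)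
    positive-persists 0≤y₀ 1≤y₁ zero = 0≤y₀ , 1≤y₁
    positive-persists {n} 0≤y₀ 1≤y₁ (suc d) =
      let 0≤ , 1≤ = positive-persists 0≤y₀ 1≤y₁ d in
      ℤᵖ.≤-trans (0≤+ 1) 1≤ , subst (1ℤ ≤_) (sym (rec (d ℕ.+ n))) (step (1≤a (d ℕ.+ n)) 0≤ 1≤)

    eventually≥1ʳ : ∀ {n} → 0ℤ ≤ y n → 1ℤ ≤ y (1 ℕ.+ n) → Eventually≥1 y
    eventually≥1ʳ {n} 0≤y₀ 1≤y₁ = 1 ℕ.+ n , λ m n<m →
      subst (λ i → 1ℤ ≤ y i)
        (trans (sym (ℕᵖ.+-suc (m ℕ.∸ suc n) n)) (ℕᵖ.m∸n+n≡m n<m))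
        (proj₂ (positive-persists 0≤y₀ 1≤y₁ (m ℕ.∸ suc n)))

    eventually≥1ˡ : ∀ {n} → 1ℤ ≤ y n → 0ℤ ≤ y (1 ℕ.+ n) → Eventually≥1 y
    eventually≥1ˡ {n} 1≤y₀ 0≤y₁ = eventually≥1ʳ {suc n} 0≤y₁
      (subst (1ℤ ≤_) (sym (rec n))
        (from-gap (0≤+ (a n) ⊗ 0≤y₁ ⊕ gap 1≤y₀) (eq (+ a n) (y n) (y (1 ℕ.+ n)))))
      where
      eq : ∀ c y₀ y₁ → c ℤ.* y₁ + (y₀ - 1ℤ) ≡ c ℤ.* y₁ + y₀ - 1ℤ
      eq = solve-∀

    nonpositive-persists : ∀ {n} → y n ≤ 0ℤ → y (1 ℕ.+ n) ≤ 0ℤ →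
                           ∀ d → y (d ℕ.+ n) ≤ 0ℤ × y (1 ℕ.+ d ℕ.+ n) ≤ 0ℤ
    nonpositive-persists y₀≤0 y₁≤0 zero = y₀≤0 , y₁≤0
    nonpositive-persists {n} y₀≤0 y₁≤0 (suc d) =
      let ≤0₀ , ≤0₁ = nonpositive-persists y₀≤0 y₁≤0 d
          i = d ℕ.+ n
      in ≤0₁ , subst (_≤ 0ℤ) (sym (rec i))
           (from-gap (0≤+ (a i) ⊗ gap ≤0₁ ⊕ gap ≤0₀) (eq (+ a i) (y i) (y (1 ℕ.+ i))))
      where
      eq : ∀ c y₀ y₁ → c ℤ.* (0ℤ - y₁) + (0ℤ - y₀) ≡ 0ℤ - (c ℤ.* y₁ + y₀)
      eq = solve-∀

    nonpositive⇒¬eventually≥1 : ∀ {n} → y n ≤ 0ℤ → y (1 ℕ.+ n) ≤ 0ℤ → ¬ Eventually≥1 y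
    nonpositive⇒¬eventually≥1 {n} y₀≤0 y₁≤0 (n₀ , pos) =
      absurd-gap (gap (ℤᵖ.≤-trans (pos _ (ℕᵖ.m≤m+n n₀ n)) (proj₁ (nonpositive-persists y₀≤0 y₁≤0 n₀)))) refl

    -- Once the terms are positive, y (2 + n) ≥ y (1 + n) + y n ≥ 1 + y n. The growth lets heights
    -- absorb any fixed perturbation in `pos-stable`.
    unbounded-growth : Eventually≥1 y → ∀ b → ∃[ n₀ ] (∀ n → n₀ ℕ.≤ n → + b ≤ y n)
    unbounded-growth (n₀ , pos) zero = n₀ , λ n n₀≤n → ℤᵖ.≤-trans (0≤+ 1) (pos n n₀≤n)
    unbounded-growth ev@(n₀ , pos) (suc b) =
      let n₁ , big = unbounded-growth ev b in
      2 ℕ.+ (n₀ ℕ.+ n₁) , λ { (suc (suc n)) (s≤s (s≤s n₀+n₁≤n)) →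
        let n₀≤n = ℕᵖ.m+n≤o⇒m≤o n₀ n₀+n₁≤n
            n₁≤n = ℕᵖ.m+n≤o⇒n≤o n₀ n₀+n₁≤n
        in subst (+ suc b ≤_) (sym (rec n))
             (from-gap (gap (+≤+ (1≤a n)) ⊗ (gap (pos (suc n) (ℕᵖ.m≤n⇒m≤1+n n₀≤n)) ⊕ 0≤+ 1)
                        ⊕ gap (pos (suc n) (ℕᵖ.m≤n⇒m≤1+n n₀≤n)) ⊕ gap (big n n₁≤n))
               (eq (+ b) (+ a n) (y n) (y (suc n)))) }
      where
      eq : ∀ b c y₀ y₁ → (c - 1ℤ) ℤ.* (y₁ - 1ℤ + 1ℤ) + (y₁ - 1ℤ) + (y₀ - b) ≡ c ℤ.* y₁ + y₀ - (1ℤ + b)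
      eq = solve-∀

  private
    -- While the signs alternate, the absolute values decrease.
    descent : ∀ {y} → Recurrent a y → ∀ b n → 1ℤ ≤ y n → y (1 ℕ.+ n) ≤ -1ℤ → y n ≤ + b →
              Eventually≥1 y ⊎ Eventually≥1 (λ n → - y n)
    descent rec zero n 1≤y₀ y₁≤-1 y₀≤b = absurd-gap (gap (ℤᵖ.≤-trans 1≤y₀ y₀≤b)) refl
    descent {y} rec (suc b) n 1≤y₀ y₁≤-1 y₀≤b with ≤0⊎1≤ (y (2 ℕ.+ n))
    ... | inj₁ y₂≤0 = inj₂ (eventually≥1ˡ (recurrent-neg {y} rec) {suc n} (ℤᵖ.neg-mono-≤ y₁≤-1) (ℤᵖ.neg-mono-≤ y₂≤0))
    ... | inj₂ 1≤y₂ with ≤-1⊎0≤ (y (3 ℕ.+ n))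
    ...   | inj₂ 0≤y₃ = inj₁ (eventually≥1ˡ rec {2 ℕ.+ n} 1≤y₂ 0≤y₃)
    ...   | inj₁ y₃≤-1 = descent rec b (2 ℕ.+ n) 1≤y₂ y₃≤-1
              (subst (_≤ + b) (sym (rec n))
                (from-gap (gap (+≤+ (1≤a n)) ⊗ (gap y₁≤-1 ⊕ 0≤+ 1) ⊕ gap y₁≤-1 ⊕ gap y₀≤b)
                  (eq (+ b) (+ a n) (y n) (y (suc n)))))
      where
      eq : ∀ b c y₀ y₁ → (c - 1ℤ) ℤ.* (-1ℤ - y₁ + 1ℤ) + (-1ℤ - y₁) + (1ℤ + b - y₀) ≡ b - (c ℤ.* y₁ + y₀)
      eq = solve-∀

    descent₀ : ∀ {y} → Recurrent a y → 1ℤ ≤ y 0 → Eventually≥1 y ⊎ Eventually≥1 (λ n → - y n)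
    descent₀ {y} rec 1≤y₀ with ≤-1⊎0≤ (y 1)
    ... | inj₂ 0≤y₁ = inj₁ (eventually≥1ˡ rec 1≤y₀ 0≤y₁)
    ... | inj₁ y₁≤-1 = descent rec ℤ.∣ y 0 ∣ 0 1≤y₀ y₁≤-1
                        (ℤᵖ.≤-reflexive (sym (ℤᵖ.0≤i⇒+∣i∣≡i (ℤᵖ.≤-trans (0≤+ 1) 1≤y₀))))

    eventually≥1-neg-neg : ∀ {y : ℕ → ℤ} → Eventually≥1 (λ n → - (- y n)) → Eventually≥1 y
    eventually≥1-neg-neg {y} (n₀ , pos) = n₀ , λ n n₀≤n → subst (1ℤ ≤_) (ℤᵖ.neg-involutive (y n)) (pos n n₀≤n)

  -- Two adjacent terms of weakly equal sign, not both zero, settle the sign for good, and `descent`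
  -- excludes endless alternation. For heights, the remaining case of two zeros forces J = 0.
  eventual-sign : ∀ {y} → Recurrent a y →
    Eventually≥1 y ⊎ Eventually≥1 (λ n → - y n) ⊎ (y 0 ≡ 0ℤ × y 1 ≡ 0ℤ)
  eventual-sign {y} rec with ≤-1⊎0≤ (y 0)
  ... | inj₁ y₀≤-1 with descent₀ (recurrent-neg {y} rec) (ℤᵖ.neg-mono-≤ y₀≤-1)
  ...   | inj₁ neg = inj₂ (inj₁ neg)
  ...   | inj₂ pos = inj₁ (eventually≥1-neg-neg {y} pos)
  eventual-sign {y} rec | inj₂ 0≤y₀ with ≤0⊎1≤ (y 0)
  ... | inj₂ 1≤y₀ with descent₀ rec 1≤y₀
  ...   | inj₁ pos = inj₁ pos
  ...   | inj₂ neg = inj₂ (inj₁ neg)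
  eventual-sign {y} rec | inj₂ 0≤y₀ | inj₁ y₀≤0 with ≤-1⊎0≤ (y 1) | ≤0⊎1≤ (y 1)
  ... | inj₁ y₁≤-1 | _ = inj₂ (inj₁ (eventually≥1ʳ (recurrent-neg {y} rec) (ℤᵖ.neg-mono-≤ y₀≤0) (ℤᵖ.neg-mono-≤ y₁≤-1)))
  ... | inj₂ 0≤y₁ | inj₁ y₁≤0 = inj₂ (inj₂ (ℤᵖ.≤-antisym y₀≤0 0≤y₀ , ℤᵖ.≤-antisym y₁≤0 0≤y₁))
  ... | inj₂ 0≤y₁ | inj₂ 1≤y₁ = inj₁ (eventually≥1ʳ rec 0≤y₀ 1≤y₁)

-- Counting by the pigeonhole principle

count : (ℕ → Bool) → ℕ → ℕ
count b zero = 0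
count b (suc n) with b (suc n)
... | true  = suc (count b n)
... | false = count b n

count-not : ∀ b n → count b n ℕ.+ count (λ j → not (b j)) n ≡ n
count-not b zero = refl
count-not b (suc n) with b (suc n)
... | true  = cong suc (count-not b n)
... | false = trans (ℕᵖ.+-suc _ _) (cong suc (count-not b n))

private
  Enumerates : (ℕ → Bool) → ∀ n {c} → (Fin c → ℕ) → Set
  Enumerates b n e = Injective _≡_ _≡_ e × (∀ i → 1 ℕ.≤ e i × e i ℕ.≤ n × b (e i) ≡ true)

  enumerate : ∀ b n → ∃[ e ] Enumerates b n {count b n} e
  enumerate b zero = (λ ()) , (λ {}) , λ ()
  enumerate b (suc n) with b (suc n) in bn | enumerate b n
  ... | false | e , inj , range = e , inj , λ i →
        let 1≤ , ≤n , on = range i in 1≤ , ℕᵖ.m≤n⇒m≤1+n ≤n , on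
  ... | true  | e , inj , range = e′ , inj′ , range′
    where
    e′ : Fin (suc (count b n)) → ℕ
    e′ Fin.zero    = suc n
    e′ (Fin.suc i) = e i
    inj′ : Injective _≡_ _≡_ e′
    inj′ {Fin.zero}  {Fin.zero}  _  = refl
    inj′ {Fin.zero}  {Fin.suc j} eq = ⊥-elim (ℕᵖ.1+n≰n (subst (ℕ._≤ n) (sym eq) (proj₁ (proj₂ (range j)))))
    inj′ {Fin.suc i} {Fin.zero}  eq = ⊥-elim (ℕᵖ.1+n≰n (subst (ℕ._≤ n) eq (proj₁ (proj₂ (range i)))))
    inj′ {Fin.suc i} {Fin.suc j} eq = cong Fin.suc (inj eq)
    range′ : ∀ i → 1 ℕ.≤ e′ i × e′ i ℕ.≤ suc n × b (e′ i) ≡ true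
    range′ Fin.zero    = s≤s z≤n , ℕᵖ.≤-refl , bn
    range′ (Fin.suc i) = let 1≤ , ≤n , on = range i in 1≤ , ℕᵖ.m≤n⇒m≤1+n ≤n , on

-- This yields upper bounds; a lower bound for one count comes from the upper bound for its
-- complement through `count-not`.
count-pigeonhole : ∀ b n C (r : ℕ → ℕ) →
  (∀ j → 1 ℕ.≤ j → j ℕ.≤ n → b j ≡ true → r j ℕ.< C) →
  (∀ i j → 1 ℕ.≤ i → i ℕ.≤ n → 1 ℕ.≤ j → j ℕ.≤ n → r i ≡ r j → i ≡ j) →
  count b n ℕ.≤ C
count-pigeonhole b n C r r<C r-inj with enumerate b n
... | e , e-inj , range = Finᵖ.injective⇒≤ {f = f} f-inj
  where
  bound : ∀ i → r (e i) ℕ.< C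
  bound i = let 1≤ , ≤n , on = range i in r<C (e i) 1≤ ≤n on
  f : Fin (count b n) → Fin C
  f i = Fin.fromℕ< (bound i)
  f-inj : Injective _≡_ _≡_ f
  f-inj {i} {j} eq =
    let 1≤i , i≤n , _ = range i
        1≤j , j≤n , _ = range j
    in e-inj (r-inj (e i) (e j) 1≤i i≤n 1≤j j≤n
         (Finᵖ.fromℕ<-injective (r (e i)) (r (e j)) (bound i) (bound j) eq))

-- Rotations and the sign of j α - z

-- The numerators are integers because the passage from α to -α negates them.
height : (ℕ → ℤ) → (ℕ → ℕ) → ℤ → ℤ → ℕ → ℤ
height p q J Z n = J ℤ.* p n - Z ℤ.* + q n

height-recurrent : ∀ {a p q} → Recurrent a p → Recurrent a (λ n → + q n) → ∀ J Z → Recurrent a (height p q J Z)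
height-recurrent {a} {p} {q} p-rec q-rec J Z n = trans (cong₂ (λ x y → J ℤ.* x - Z ℤ.* y) (p-rec n) (q-rec n))
  (eq J Z (+ a n) (p (suc n)) (p n) (+ q (suc n)) (+ q n))
  where
  eq : ∀ J Z c p₁ p₀ q₁ q₀ → J ℤ.* (c ℤ.* p₁ + p₀) - Z ℤ.* (c ℤ.* q₁ + q₀) ≡ c ℤ.* (J ℤ.* p₁ - Z ℤ.* q₁) + (J ℤ.* p₀ - Z ℤ.* q₀)
  eq = solve-∀

-- Cramer's rule: with determinant ±1, consecutive convergents form a basis of the integer plane, so
-- two consecutive heights determine (J, Z).
height-determinant : ∀ p q J Z n → J ℤ.* (p (suc n) ℤ.* + q n - p n ℤ.* + q (suc n)) ≡
  + q n ℤ.* height p q J Z (suc n) - + q (suc n) ℤ.* height p q J Z n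
height-determinant p q J Z n = eq J Z (p n) (+ q n) (p (suc n)) (+ q (suc n))
  where
  eq : ∀ J Z p₀ q₀ p₁ q₁ → J ℤ.* (p₁ ℤ.* q₀ - p₀ ℤ.* q₁) ≡ q₀ ℤ.* (J ℤ.* p₁ - Z ℤ.* q₁) - q₁ ℤ.* (J ℤ.* p₀ - Z ℤ.* q₀)
  eq = solve-∀

record Pos (p : ℕ → ℤ) (q : ℕ → ℕ) (J Z : ℤ) : Set where
  constructor positive
  field
    eventually : Eventually≥1 (height p q J Z)

-- With c = h / (h + h′): Inside says z < j α < z + c, and Outside says z + c < j α < z + 1.
Inside Outside : (ℕ → ℤ) → (ℕ → ℕ) → ℕ → ℕ → ℕ → ℤ → Set
Inside p q h h′ j z =
  Pos p q (+ j) z ×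
  Pos p q (- (+ (h ℕ.+ h′) ℤ.* + j)) (- (+ (h ℕ.+ h′) ℤ.* z + + h))
Outside p q h h′ j z =
  Pos p q (+ (h ℕ.+ h′) ℤ.* + j) (+ (h ℕ.+ h′) ℤ.* z + + h) ×
  Pos p q (- + j) (- (z + 1ℤ))

-- The p n / q n lie below α for even n and above α for odd n, and a n is the partial
-- quotient aₙ₊₂; g j = k (1_{[0,c)}({jα}) - c) with k = h + h′.
record Rotation (h h′ : ℕ) : Set where
  field
    a     : ℕ → ℕ
    p     : ℕ → ℤ
    q     : ℕ → ℕ
    1≤a   : ∀ n → 1 ℕ.≤ a n
    p-rec : Recurrent a p
    q-rec : ∀ n → q (2 ℕ.+ n) ≡ a n ℕ.* q (1 ℕ.+ n) ℕ.+ q n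
    1≤q₀  : 1 ℕ.≤ q 0
    q₀≤q₁ : q 0 ℕ.≤ q 1
    det₀  : p 1 ℤ.* + q 0 - p 0 ℤ.* + q 1 ≡ 1ℤ
    1≤h   : 1 ℕ.≤ h
    1≤h′  : 1 ℕ.≤ h′
    g     : ℕ → ℤ
    place : ∀ j → 1 ℕ.≤ j →
            (∃[ z ] (Inside p q h h′ j z × g j ≡ + h′)) ⊎
            (∃[ z ] (Outside p q h h′ j z × g j ≡ - + h))

-- If the sequence ever rises, convexity keeps it rising up to `c`, so the value after the rise is
-- at most G c ≤ G 0; until then it only falls from G 0.
convex-below-endpoints : ∀ (G : ℕ → ℤ) c →
  (∀ b → 2 ℕ.+ b ℕ.≤ c → G (1 ℕ.+ b) - G b ≤ G (2 ℕ.+ b) - G (1 ℕ.+ b)) →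
  G c ≤ G 0 → ∀ b → b ℕ.≤ c → G b ≤ G 0
convex-below-endpoints G c convex Gc≤G0 = go
  where
  eq : ∀ x y z → (z - y - (y - x)) + (y - x) ≡ z - y
  eq = solve-∀
  rise : ∀ d b → d ℕ.+ (1 ℕ.+ b) ℕ.≤ c → G b ≤ G (1 ℕ.+ b) → G (1 ℕ.+ b) ≤ G (d ℕ.+ (1 ℕ.+ b))
  rise zero    b _    _  = ℤᵖ.≤-refl
  rise (suc d) b d+b≤c up = ℤᵖ.≤-trans up′
    (subst (λ i → G (2 ℕ.+ b) ≤ G i) (ℕᵖ.+-suc d (suc b)) (rise d (suc b) (subst (ℕ._≤ c) (sym (ℕᵖ.+-suc d (suc b))) d+b≤c) up′))
    where
    up′ : G (1 ℕ.+ b) ≤ G (2 ℕ.+ b)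
    up′ = from-gap (gap (convex b (ℕᵖ.≤-trans (s≤s (ℕᵖ.m≤n+m (suc b) d)) d+b≤c)) ⊕ gap up)
                   (eq (G b) (G (1 ℕ.+ b)) (G (2 ℕ.+ b)))
  go : ∀ b → b ℕ.≤ c → G b ≤ G 0
  go zero    _   = ℤᵖ.≤-refl
  go (suc b) b<c with ℤᵖ.≤-total (G (suc b)) (G b)
  ... | inj₁ down = ℤᵖ.≤-trans down (go b (ℕᵖ.≤-trans (ℕᵖ.n≤1+n b) b<c))
  ... | inj₂ up   = ℤᵖ.≤-trans
    (subst (λ i → G (suc b) ≤ G i) (ℕᵖ.m∸n+n≡m b<c)
      (rise (c ℕ.∸ suc b) b (ℕᵖ.≤-reflexive (ℕᵖ.m∸n+n≡m b<c)) up)) Gc≤G0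

-- Signs read from heights, and the effect of shifting by a denominator

module Core {h h′ : ℕ} (R : Rotation h h′) where
  open Rotation R

  k : ℕ
  k = h ℕ.+ h′

  1≤k : 1 ℕ.≤ k
  1≤k = ℕᵖ.≤-trans 1≤h (ℕᵖ.m≤m+n h h′)

  ht : ℤ → ℤ → ℕ → ℤ
  ht = height p q

  1≤q : ∀ n → 1 ℕ.≤ q n
  q-step : ∀ n → q n ℕ.≤ q (1 ℕ.+ n)
  1≤q zero    = 1≤q₀
  1≤q (suc n) = ℕᵖ.≤-trans (1≤q n) (q-step n)
  q-step zero    = q₀≤q₁
  q-step (suc n) = ℕᵖ.≤-trans (ℕᵖ.m≤n*m (q (suc n)) (a n) {{ℕ.>-nonZero (1≤a n)}})
    (subst (a n ℕ.* q (suc n) ℕ.≤_) (sym (q-rec n)) (ℕᵖ.m≤m+n _ (q n)))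

  q-recℤ : Recurrent a (λ n → + q n)
  q-recℤ n = trans (cong +_ (q-rec n)) (cong (_+ + q n) (ℤᵖ.pos-* (a n) (q (suc n))))

  ht-rec : ∀ J Z → Recurrent a (ht J Z)
  ht-rec = height-recurrent {a} {p} {q} p-rec q-recℤ

  det : ℕ → ℤ
  det n = p (1 ℕ.+ n) ℤ.* + q n - p n ℤ.* + q (1 ℕ.+ n)

  det-suc : ∀ n → det (suc n) ≡ - det n
  det-suc n = trans (cong₂ (λ x y → x ℤ.* + q (suc n) - p (suc n) ℤ.* y) (p-rec n) (q-recℤ n))
    (eq (+ a n) (p (suc n)) (p n) (+ q (suc n)) (+ q n))
    where
    eq : ∀ c p₁ p₀ q₁ q₀ → (c ℤ.* p₁ + p₀) ℤ.* q₁ - p₁ ℤ.* (c ℤ.* q₁ + q₀) ≡ - (p₁ ℤ.* q₀ - p₀ ℤ.* q₁)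
    eq = solve-∀

  det-even : ∀ i → det (i ℕ.* 2) ≡ 1ℤ
  det-even zero    = det₀
  det-even (suc i) = trans (det-suc (1 ℕ.+ i ℕ.* 2))
    (trans (cong -_ (det-suc (i ℕ.* 2))) (trans (ℤᵖ.neg-involutive (det (i ℕ.* 2))) (det-even i)))

  det-odd : ∀ i → det (1 ℕ.+ i ℕ.* 2) ≡ -1ℤ
  det-odd i = trans (det-suc (i ℕ.* 2)) (cong -_ (det-even i))

  pos-cast : ∀ {J J′ Z Z′} → J ≡ J′ → Z ≡ Z′ → Pos p q J Z → Pos p q J′ Z′
  pos-cast refl refl pos = pos

  ht-neg : ∀ J Z n → ht (- J) (- Z) n ≡ - ht J Z n
  ht-neg J Z n = eq J Z (p n) (+ q n)
    where
    eq : ∀ J Z x y → - J ℤ.* x - - Z ℤ.* y ≡ - (J ℤ.* x - Z ℤ.* y)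
    eq = solve-∀

  module _ {J Z : ℤ} where

    posˡ : ∀ {n} → 1ℤ ≤ ht J Z n → 0ℤ ≤ ht J Z (1 ℕ.+ n) → Pos p q J Z
    posˡ {n} y₀ y₁ = positive (eventually≥1ˡ 1≤a (ht-rec J Z) {n} y₀ y₁)

    posʳ : ∀ {n} → 0ℤ ≤ ht J Z n → 1ℤ ≤ ht J Z (1 ℕ.+ n) → Pos p q J Z
    posʳ {n} y₀ y₁ = positive (eventually≥1ʳ 1≤a (ht-rec J Z) {n} y₀ y₁)

    negˡ : ∀ {n} → ht J Z n ≤ -1ℤ → ht J Z (1 ℕ.+ n) ≤ 0ℤ → Pos p q (- J) (- Z)
    negˡ {n} y₀≤-1 y₁≤0 = positive (eventually≥1ˡ 1≤a (ht-rec (- J) (- Z)) {n}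
      (subst (1ℤ ≤_) (sym (ht-neg J Z n)) (ℤᵖ.neg-mono-≤ y₀≤-1))
      (subst (0ℤ ≤_) (sym (ht-neg J Z (1 ℕ.+ n))) (ℤᵖ.neg-mono-≤ y₁≤0)))

    negʳ : ∀ {n} → ht J Z n ≤ 0ℤ → ht J Z (1 ℕ.+ n) ≤ -1ℤ → Pos p q (- J) (- Z)
    negʳ {n} y₀≤0 y₁≤-1 = positive (eventually≥1ʳ 1≤a (ht-rec (- J) (- Z)) {n}
      (subst (0ℤ ≤_) (sym (ht-neg J Z n)) (ℤᵖ.neg-mono-≤ y₀≤0))
      (subst (1ℤ ≤_) (sym (ht-neg J Z (1 ℕ.+ n))) (ℤᵖ.neg-mono-≤ y₁≤-1)))

    ¬pos : ∀ {n} → ht J Z n ≤ 0ℤ → ht J Z (1 ℕ.+ n) ≤ 0ℤ → ¬ Pos p q J Z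
    ¬pos {n} y₀ y₁ (positive ev) = nonpositive⇒¬eventually≥1 1≤a (ht-rec J Z) {n} y₀ y₁ ev

    ¬neg : ∀ {n} → 0ℤ ≤ ht J Z n → 0ℤ ≤ ht J Z (1 ℕ.+ n) → ¬ Pos p q (- J) (- Z)
    ¬neg {n} 0≤y₀ 0≤y₁ (positive ev) = nonpositive⇒¬eventually≥1 1≤a (ht-rec (- J) (- Z)) {n}
      (subst (_≤ 0ℤ) (sym (ht-neg J Z n)) (ℤᵖ.neg-mono-≤ 0≤y₀))
      (subst (_≤ 0ℤ) (sym (ht-neg J Z (1 ℕ.+ n))) (ℤᵖ.neg-mono-≤ 0≤y₁)) ev

  pos-+* : ∀ {J Z J′ Z′} K → Pos p q J Z → Pos p q J′ Z′ → Pos p q (J + + K ℤ.* J′) (Z + + K ℤ.* Z′)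
  pos-+* {J} {Z} {J′} {Z′} K (positive (n₀ , pos)) (positive (n₁ , pos′)) = positive (n₀ ℕ.+ n₁ , λ n le →
    from-gap (gap (pos n (ℕᵖ.m+n≤o⇒m≤o n₀ le)) ⊕ 0≤+ K ⊗ (gap (pos′ n (ℕᵖ.m+n≤o⇒n≤o n₀ le)) ⊕ 0≤+ 1))
      (eq J Z J′ Z′ (+ K) (p n) (+ q n)))
    where
    eq : ∀ J Z J′ Z′ K x y →
      (J ℤ.* x - Z ℤ.* y - 1ℤ) + K ℤ.* (J′ ℤ.* x - Z′ ℤ.* y - 1ℤ + 1ℤ) ≡ (J + K ℤ.* J′) ℤ.* x - (Z + K ℤ.* Z′) ℤ.* y - 1ℤ
    eq = solve-∀

  -- A convergent has height 0 at its own index and the determinant as height at the next, so the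
  -- alternating determinant decides its side of α.
  pos-convergent : ∀ i → Pos p q (+ q (i ℕ.* 2)) (p (i ℕ.* 2))
  pos-convergent i = posʳ {+ q n} {p n} {n}
    (ℤᵖ.≤-reflexive (sym (eq₀ (+ q n) (p n))))
    (ℤᵖ.≤-reflexive (sym (trans (eq₁ (+ q n) (p n) (p (suc n)) (+ q (suc n))) (det-even i))))
    where
    n = i ℕ.* 2
    eq₀ : ∀ x y → x ℤ.* y - y ℤ.* x ≡ 0ℤ
    eq₀ = solve-∀
    eq₁ : ∀ x y z t → x ℤ.* z - y ℤ.* t ≡ z ℤ.* x - y ℤ.* t
    eq₁ = solve-∀

  neg-convergent : ∀ i → Pos p q (- + q (1 ℕ.+ i ℕ.* 2)) (- p (1 ℕ.+ i ℕ.* 2))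
  neg-convergent i = negʳ {+ q n} {p n} {n}
    (ℤᵖ.≤-reflexive (eq₀ (+ q n) (p n)))
    (ℤᵖ.≤-reflexive (trans (eq₁ (+ q n) (p n) (p (suc n)) (+ q (suc n))) (det-odd i)))
    where
    n = 1 ℕ.+ i ℕ.* 2
    eq₀ : ∀ x y → x ℤ.* y - y ℤ.* x ≡ 0ℤ
    eq₀ = solve-∀
    eq₁ : ∀ x y z t → x ℤ.* z - y ℤ.* t ≡ z ℤ.* x - y ℤ.* t
    eq₁ = solve-∀

  -- Adding a multiple of a convergent leaves the height at its own index alone and changes the next
  -- one by a multiple of the determinant. The shift arguments read the new sign from this pair of
  -- heights.
  ht-shift-same : ∀ n J Z X → ht (J + X ℤ.* + q n) (Z + X ℤ.* p n) n ≡ ht J Z n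
  ht-shift-same n J Z X = eq J Z X (p n) (+ q n)
    where
    eq : ∀ J Z X x y → (J + X ℤ.* y) ℤ.* x - (Z + X ℤ.* x) ℤ.* y ≡ J ℤ.* x - Z ℤ.* y
    eq = solve-∀

  ht-shift-next : ∀ n J Z X → ht (J + X ℤ.* + q n) (Z + X ℤ.* p n) (1 ℕ.+ n) ≡ ht J Z (1 ℕ.+ n) + X ℤ.* det n
  ht-shift-next n J Z X = eq J Z X (p n) (+ q n) (p (1 ℕ.+ n)) (+ q (1 ℕ.+ n))
    where
    eq : ∀ J Z X p₀ q₀ p₁ q₁ →
      (J + X ℤ.* q₀) ℤ.* p₁ - (Z + X ℤ.* p₀) ℤ.* q₁ ≡ J ℤ.* p₁ - Z ℤ.* q₁ + X ℤ.* (p₁ ℤ.* q₀ - p₀ ℤ.* q₁)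
    eq = solve-∀

  J≡even : ∀ i J Z → J ≡ + q (i ℕ.* 2) ℤ.* ht J Z (1 ℕ.+ i ℕ.* 2) - + q (1 ℕ.+ i ℕ.* 2) ℤ.* ht J Z (i ℕ.* 2)
  J≡even i J Z = trans (sym (ℤᵖ.*-identityʳ J))
    (trans (cong (J ℤ.*_) (sym (det-even i))) (height-determinant p q J Z (i ℕ.* 2)))

  J≡odd : ∀ i J Z → J ≡ + q (2 ℕ.+ i ℕ.* 2) ℤ.* ht J Z (1 ℕ.+ i ℕ.* 2) - + q (1 ℕ.+ i ℕ.* 2) ℤ.* ht J Z (2 ℕ.+ i ℕ.* 2)
  J≡odd i J Z = trans (sym (ℤᵖ.neg-involutive J)) (trans (cong -_
    (trans (trans (trans (sym (ℤᵖ.-1*i≡-i J)) (ℤᵖ.*-comm -1ℤ J)) (cong (J ℤ.*_) (sym (det-odd i)))) (height-determinant p q J Z (1 ℕ.+ i ℕ.* 2))))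
    (eq (+ q (1 ℕ.+ i ℕ.* 2) ℤ.* ht J Z (2 ℕ.+ i ℕ.* 2)) (+ q (2 ℕ.+ i ℕ.* 2) ℤ.* ht J Z (1 ℕ.+ i ℕ.* 2))))
    where
    eq : ∀ x y → - (x - y) ≡ y - x
    eq = solve-∀

  1≤qℤ : ∀ n → 1ℤ ≤ + q n
  1≤qℤ n = +≤+ (1≤q n)

  -- For 0 < J ≤ K qₙ₊₁, the sign of (J, Z) is already visible at the even index n.
  pos⇒0≤ht : ∀ i J Z K → Pos p q J Z → J ≤ K ℤ.* + q (1 ℕ.+ i ℕ.* 2) →
    (ht J Z (i ℕ.* 2) ≤ -1ℤ → ht J Z (i ℕ.* 2) ≤ - K) → 0ℤ ≤ ht J Z (i ℕ.* 2)
  pos⇒0≤ht i J Z K pos J≤Kw multiple with ≤-1⊎0≤ (ht J Z (i ℕ.* 2))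
  ... | inj₂ 0≤y₀ = 0≤y₀
  -- `multiple` sharpens the negative height to y₀ ≤ -K. Then qₙ y₁ - qₙ₊₁ y₀ = J ≤ K qₙ₊₁ leaves qₙ
  -- y₁ ≤ 0, and two nonpositive heights contradict `pos`. The premise is trivial for K = 1; for K =
  -- k it holds when the height is a multiple of k.
  ... | inj₁ y₀≤-1 = ⊥-elim (¬pos {J} {Z} {n} (ℤᵖ.≤-trans y₀≤-1 -≤+)
    (*≤0⇒≤0 (1≤qℤ n) (from-gap
      (gap (subst (_≤ K ℤ.* w) (J≡even i J Z) J≤Kw) ⊕ 0≤+ (q (suc n)) ⊗ gap (multiple y₀≤-1))
      (eq K w (+ q n) (ht J Z n) (ht J Z (suc n))))) pos)
    where
    n = i ℕ.* 2
    w = + q (suc n)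
    eq : ∀ K w v y₀ y₁ → (K ℤ.* w - (v ℤ.* y₁ - w ℤ.* y₀)) + w ℤ.* (- K - y₀) ≡ 0ℤ - v ℤ.* y₁
    eq = solve-∀

  -- A nonnegative height at n would, by Cramer's rule and J ≥ 1, make the next one positive, and
  -- two nonnegative heights contradict the sign. `J` may be arbitrarily large, in contrast to
  -- `pos⇒0≤ht`.
  neg⇒ht≤-1 : ∀ i J Z → Pos p q (- J) (- Z) → 1ℤ ≤ J → ht J Z (i ℕ.* 2) ≤ -1ℤ
  neg⇒ht≤-1 i J Z neg 1≤J with ≤-1⊎0≤ (ht J Z (i ℕ.* 2))
  ... | inj₁ y₀≤-1 = y₀≤-1
  ... | inj₂ 0≤y₀ = ⊥-elim (¬neg {J} {Z} {i ℕ.* 2} 0≤y₀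
    (ℤᵖ.≤-trans (0≤+ 1) (coord≥1 (1≤qℤ (i ℕ.* 2)) (0≤+ (q (1 ℕ.+ i ℕ.* 2))) (J≡even i J Z) 1≤J 0≤y₀)) neg)

  -- A height ≤ 0 at n + 2 would require a positive one at n + 1, and Cramer's rule would then give
  -- J ≥ qₙ₊₂. The bound 1 at n + 2 is the room that a shift by qₙ₊₁ uses up, the determinant there
  -- being -1.
  pos⇒1≤ht : ∀ i J Z → Pos p q J Z → 1ℤ ≤ J → J + 1ℤ ≤ + q (2 ℕ.+ i ℕ.* 2) →
    1ℤ ≤ ht J Z (1 ℕ.+ i ℕ.* 2) × 1ℤ ≤ ht J Z (2 ℕ.+ i ℕ.* 2)
  pos⇒1≤ht i J Z pos 1≤J J<v with ≤0⊎1≤ (ht J Z (2 ℕ.+ i ℕ.* 2))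
  ... | inj₂ 1≤y = coord≥1 (1≤qℤ (2 ℕ.+ i ℕ.* 2)) (0≤+ (q (1 ℕ.+ i ℕ.* 2))) (J≡odd i J Z) 1≤J (ℤᵖ.≤-trans (0≤+ 1) 1≤y) , 1≤y
  ... | inj₁ y≤0 with ≤0⊎1≤ (ht J Z (1 ℕ.+ i ℕ.* 2))
  ...   | inj₁ x≤0 = ⊥-elim (¬pos {J} {Z} {1 ℕ.+ i ℕ.* 2} x≤0 y≤0 pos)
  ...   | inj₂ 1≤x = ⊥-elim (coord-large (0≤+ (q (2 ℕ.+ i ℕ.* 2))) (0≤+ (q (1 ℕ.+ i ℕ.* 2))) (J≡odd i J Z) J<v y≤0 1≤x)

  In Out : ℕ → ℤ → Set
  In  = Inside p q h h′
  Out = Outside p q h h′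

  -- The integers `z` and `z′` are not assumed equal. The bounds at the ends 0 and 1 give z ≤ z′,
  -- and the bounds at c give z′ < z.
  in-out-disjoint : ∀ {j z z′} → In j z → ¬ Out j z′
  in-out-disjoint {j} {z} {z′} (positive (n₁ , A) , positive (n₂ , D)) (positive (n₃ , C) , positive (n₄ , B)) =
    absurd-gap (gap (1≤*⇒1≤ (1≤qℤ n) z<z′+1) ⊗ (0≤+ k ⊗ 0≤+ (q n)) ⊕ gap (C n n₃≤n) ⊕ gap (D n n₂≤n) ⊕ 0≤+ 1)
      (eq₂ (+ j) z z′ (p n) (+ q n) (+ k) (+ h))
    where
    n = n₁ ℕ.+ (n₂ ℕ.+ (n₃ ℕ.+ n₄))
    n₁≤n : n₁ ℕ.≤ n
    n₁≤n = ℕᵖ.m≤m+n n₁ _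
    n₂≤n : n₂ ℕ.≤ n
    n₂≤n = ℕᵖ.≤-trans (ℕᵖ.m≤m+n n₂ _) (ℕᵖ.m≤n+m _ n₁)
    n₃≤n : n₃ ℕ.≤ n
    n₃≤n = ℕᵖ.≤-trans (ℕᵖ.m≤m+n n₃ n₄) (ℕᵖ.≤-trans (ℕᵖ.m≤n+m _ n₂) (ℕᵖ.m≤n+m _ n₁))
    n₄≤n : n₄ ℕ.≤ n
    n₄≤n = ℕᵖ.≤-trans (ℕᵖ.m≤n+m n₄ n₃) (ℕᵖ.≤-trans (ℕᵖ.m≤n+m _ n₂) (ℕᵖ.m≤n+m _ n₁))
    eq₁ : ∀ j z z′ x y → (j ℤ.* x - z ℤ.* y - 1ℤ) + (- j ℤ.* x - - (z′ + 1ℤ) ℤ.* y - 1ℤ) + 1ℤ ≡ y ℤ.* (z′ + 1ℤ - z) - 1ℤ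
    eq₁ = solve-∀
    z<z′+1 : 1ℤ ≤ + q n ℤ.* (z′ + 1ℤ - z)
    z<z′+1 = from-gap (gap (A n n₁≤n) ⊕ gap (B n n₄≤n) ⊕ 0≤+ 1) (eq₁ (+ j) z z′ (p n) (+ q n))
    eq₂ : ∀ j z z′ x y k h → (z′ + 1ℤ - z - 1ℤ) ℤ.* (k ℤ.* y) + (k ℤ.* j ℤ.* x - (k ℤ.* z′ + h) ℤ.* y - 1ℤ)
            + (- (k ℤ.* j) ℤ.* x - - (k ℤ.* z + h) ℤ.* y - 1ℤ) + 1ℤ ≡ -1ℤ
    eq₂ = solve-∀

  -h≤h′ : - + h ≤ + h′
  -h≤h′ = ℤᵖ.≤-trans (ℤᵖ.neg-mono-≤ (0≤+ h)) (0≤+ h′)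

  -- `g` has two values, so an inequality is an implication between memberships; `g-mono-out` is the
  -- contrapositive form. In either form a shift to the left keeps the upper end of an interval for
  -- free, and a shift to the right keeps the lower end.
  g-mono-in : ∀ {i j} → 1 ℕ.≤ i → 1 ℕ.≤ j → (∀ {z} → In i z → ∃[ z′ ] In j z′) → g i ≤ g j
  g-mono-in {i} {j} 1≤i 1≤j imp with place i 1≤i | place j 1≤j
  ... | inj₁ (_ , _ , gi)   | inj₁ (_ , _ , gj)    = ℤᵖ.≤-reflexive (trans gi (sym gj))
  ... | inj₁ (_ , in-i , _) | inj₂ (_ , out-j , _) = ⊥-elim (in-out-disjoint (proj₂ (imp in-i)) out-j)
  ... | inj₂ (_ , _ , gi)   | inj₂ (_ , _ , gj)    = ℤᵖ.≤-reflexive (trans gi (sym gj))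
  ... | inj₂ (_ , _ , gi)   | inj₁ (_ , _ , gj)    = subst₂ _≤_ (sym gi) (sym gj) -h≤h′

  g-mono-out : ∀ {i j} → 1 ℕ.≤ i → 1 ℕ.≤ j → (∀ {z} → Out i z → ∃[ z′ ] Out j z′) → g j ≤ g i
  g-mono-out {i} {j} 1≤i 1≤j imp with place i 1≤i | place j 1≤j
  ... | inj₁ (_ , _ , gi)    | inj₁ (_ , _ , gj)   = ℤᵖ.≤-reflexive (trans gj (sym gi))
  ... | inj₂ (_ , out-i , _) | inj₁ (_ , in-j , _) = ⊥-elim (in-out-disjoint in-j (proj₂ (imp out-i)))
  ... | inj₂ (_ , _ , gi)    | inj₂ (_ , _ , gj)   = ℤᵖ.≤-reflexive (trans gj (sym gi))
  ... | inj₁ (_ , _ , gi)    | inj₂ (_ , _ , gj)   = subst₂ _≤_ (sym gj) (sym gi) -h≤h′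

  S : ℕ → ℤ
  S zero    = 0ℤ
  S (suc n) = S n + g (suc n)

  S-segment : ∀ n A B → (∀ j → 1 ℕ.≤ j → j ℕ.≤ n → g (j ℕ.+ A) ≤ g (j ℕ.+ B)) →
              S (n ℕ.+ A) - S A ≤ S (n ℕ.+ B) - S B
  S-segment zero    A B le = ℤᵖ.≤-reflexive (trans (ℤᵖ.+-inverseʳ (S A)) (sym (ℤᵖ.+-inverseʳ (S B))))
  S-segment (suc n) A B le = from-gap
    (gap (S-segment n A B (λ j 1≤j j≤n → le j 1≤j (ℕᵖ.m≤n⇒m≤1+n j≤n))) ⊕ gap (le (suc n) (s≤s z≤n) ℕᵖ.≤-refl))
    (eq (S (n ℕ.+ A)) (S A) (g (suc n ℕ.+ A)) (S (n ℕ.+ B)) (S B) (g (suc n ℕ.+ B)))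
    where
    eq : ∀ x a u y b v → (y - b - (x - a)) + (v - u) ≡ y + v - b - (x + u - a)
    eq = solve-∀

  -- The shift by qₙ₊₁ goes left, so only the lower end 0 is at stake. Before time qₙ₊₂ the height
  -- at n + 2 is at least 1, and it drops by exactly 1.
  g-mono : ∀ i j → 1 ℕ.≤ j → j ℕ.< q (2 ℕ.+ i ℕ.* 2) → g j ≤ g (j ℕ.+ q (1 ℕ.+ i ℕ.* 2))
  g-mono i j 1≤j j<v = g-mono-in 1≤j (ℕᵖ.≤-trans 1≤j (ℕᵖ.m≤m+n j w)) λ {z} (pos , neg) →
    let 1≤x , 1≤y = pos⇒1≤ht i (+ j) z pos (+≤+ 1≤j) (+≤+ (subst (ℕ._≤ q (suc n)) (ℕᵖ.+-comm 1 j) j<v)) in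
    z + p n ,
    pos-cast (cong (λ t → + j + t) (ℤᵖ.*-identityˡ (+ w))) (cong (λ t → z + t) (ℤᵖ.*-identityˡ (p n)))
      (posˡ {+ j + 1ℤ ℤ.* + w} {z + 1ℤ ℤ.* p n} {n}
        (subst (1ℤ ≤_) (sym (ht-shift-same n (+ j) z 1ℤ)) 1≤x)
        (subst (0ℤ ≤_) (sym (trans (ht-shift-next n (+ j) z 1ℤ) (cong (λ t → ht (+ j) z (suc n) + 1ℤ ℤ.* t) (det-odd i)))) (gap 1≤y))) ,
    pos-cast (eq₁ (+ k) (+ j) (+ w)) (eq₂ (+ k) z (p n) (+ h)) (pos-+* k neg (neg-convergent i))
    where
    n = 1 ℕ.+ i ℕ.* 2
    w = q n
    eq₁ : ∀ k j w → - (k ℤ.* j) + k ℤ.* - w ≡ - (k ℤ.* (j + w))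
    eq₁ = solve-∀
    eq₂ : ∀ k z t h → - (k ℤ.* z + h) + k ℤ.* - t ≡ - (k ℤ.* (z + t) + h)
    eq₂ = solve-∀

  -- The shift keeps the height y₀ at n and adds 1 to y₁ at n + 1. Cramer's rule gives qₙ (y₁ + 1) =
  -- (j + qₙ) + qₙ₊₁ y₀ ≤ 0, because y₀ ≤ -1 and j + qₙ ≤ qₙ₊₁.
  neg-shift : ∀ i j z → 1 ℕ.≤ j → j ℕ.+ q (i ℕ.* 2) ℕ.≤ q (1 ℕ.+ i ℕ.* 2) →
    Pos p q (- + j) (- z) → Pos p q (- + (j ℕ.+ q (i ℕ.* 2))) (- (z + p (i ℕ.* 2)))
  neg-shift i j z 1≤j j+v≤w neg =
    pos-cast (cong (λ t → - (+ j + t)) (ℤᵖ.*-identityˡ (+ v))) (cong (λ t → - (z + t)) (ℤᵖ.*-identityˡ (p n)))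
      (negˡ {+ j + 1ℤ ℤ.* + v} {z + 1ℤ ℤ.* p n} {n}
        (subst (_≤ -1ℤ) (sym (ht-shift-same n (+ j) z 1ℤ)) y₀≤-1)
        (subst (_≤ 0ℤ) (sym (trans (ht-shift-next n (+ j) z 1ℤ) (cong (λ t → ht (+ j) z (suc n) + 1ℤ ℤ.* t) (det-even i)))) y₁+1≤0))
    where
    n = i ℕ.* 2
    v = q n
    y₀≤-1 : ht (+ j) z n ≤ -1ℤ
    y₀≤-1 = neg⇒ht≤-1 i (+ j) z neg (+≤+ 1≤j)
    eq : ∀ v w y₀ y₁ → (w - (v ℤ.* y₁ - w ℤ.* y₀ + v)) + w ℤ.* (-1ℤ - y₀) ≡ 0ℤ - v ℤ.* (y₁ + 1ℤ ℤ.* 1ℤ)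
    eq = solve-∀
    y₁+1≤0 : ht (+ j) z (suc n) + 1ℤ ℤ.* 1ℤ ≤ 0ℤ
    y₁+1≤0 = *≤0⇒≤0 (1≤qℤ n) (from-gap
      (gap (subst (λ t → t + + v ≤ + q (suc n)) (J≡even i (+ j) z) (+≤+ j+v≤w)) ⊕ 0≤+ (q (suc n)) ⊗ gap y₀≤-1)
      (eq (+ v) (+ q (suc n)) (ht (+ j) z n) (ht (+ j) z (suc n))))

  g-shift-even : ∀ i j → 1 ℕ.≤ j → j ℕ.+ q (i ℕ.* 2) ℕ.≤ q (1 ℕ.+ i ℕ.* 2) → g (j ℕ.+ q (i ℕ.* 2)) ≤ g j
  g-shift-even i j 1≤j j+v≤w = g-mono-out 1≤j (ℕᵖ.≤-trans 1≤j (ℕᵖ.m≤m+n j v)) λ {z} (pos , neg) →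
    z + p n ,
    pos-cast (eq₁ (+ k) (+ j) (+ v)) (eq₂ (+ k) z (p n) (+ h)) (pos-+* k pos (pos-convergent i)) ,
    pos-cast refl (eq₃ z (p n)) (neg-shift i j (z + 1ℤ) 1≤j j+v≤w neg)
    where
    n = i ℕ.* 2
    v = q n
    eq₁ : ∀ k j w → k ℤ.* j + k ℤ.* w ≡ k ℤ.* (j + w)
    eq₁ = solve-∀
    eq₂ : ∀ k z t h → k ℤ.* z + h + k ℤ.* t ≡ k ℤ.* (z + t) + h
    eq₂ = solve-∀
    eq₃ : ∀ z t → - (z + 1ℤ + t) ≡ - (z + t + 1ℤ)
    eq₃ = solve-∀

-- The value of S at an even denominator

module Counting {h h′ : ℕ} (R : Rotation h h′) where
  open Rotation R
  open Core R

  out⇒pos : ∀ {j z} → Out j z → Pos p q (+ j) z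
  out⇒pos {j} {z} (positive (n₀ , pos) , _) = positive (n₀ , λ n n₀≤n → 1≤*⇒1≤ (+≤+ 1≤k)
    (from-gap (gap (pos n n₀≤n) ⊕ 0≤+ h ⊗ 0≤+ (q n)) (eq (+ k) (+ j) z (+ h) (p n) (+ q n))))
    where
    eq : ∀ k j z h x y → (k ℤ.* j ℤ.* x - (k ℤ.* z + h) ℤ.* y - 1ℤ) + h ℤ.* y ≡ k ℤ.* (j ℤ.* x - z ℤ.* y) - 1ℤ
    eq = solve-∀

  in⇒neg : ∀ {j z} → In j z → Pos p q (- + j) (- (z + 1ℤ))
  in⇒neg {j} {z} (_ , positive (n₀ , pos)) = positive (n₀ , λ n n₀≤n → 1≤*⇒1≤ (+≤+ 1≤k)
    (from-gap (gap (pos n n₀≤n) ⊕ 0≤+ h′ ⊗ 0≤+ (q n)) (eq (+ j) z (+ h) (+ h′) (p n) (+ q n))))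
    where
    eq : ∀ j z h h′ x y → (- ((h + h′) ℤ.* j) ℤ.* x - - ((h + h′) ℤ.* z + h) ℤ.* y - 1ℤ) + h′ ℤ.* y
                          ≡ (h + h′) ℤ.* (- j ℤ.* x - - (z + 1ℤ) ℤ.* y) - 1ℤ
    eq = solve-∀

  side : ℕ → Bool × ℤ
  -- A default value: `count` starts at index 1.
  side zero    = false , 0ℤ
  side (suc j) with place (suc j) (s≤s z≤n)
  ... | inj₁ (z , _) = true , z
  ... | inj₂ (z , _) = false , z

  inside? : ℕ → Bool
  inside? j = proj₁ (side j)

  floor : ℕ → ℤ
  floor j = proj₂ (side j)

  inside-spec : ∀ j → 1 ℕ.≤ j → inside? j ≡ true → In j (floor j) × g j ≡ + h′
  inside-spec (suc j) _ eq with place (suc j) (s≤s z≤n)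
  ... | inj₁ (z , spec) = spec

  outside-spec : ∀ j → 1 ℕ.≤ j → inside? j ≡ false → Out j (floor j) × g j ≡ - + h
  outside-spec (suc j) _ eq with place (suc j) (s≤s z≤n)
  ... | inj₂ (z , spec) = spec

  floor-spec : ∀ j → 1 ℕ.≤ j → Pos p q (+ j) (floor j) × Pos p q (- + j) (- (floor j + 1ℤ))
  floor-spec j 1≤j with inside? j in eq
  ... | true  = let ins , _ = inside-spec j 1≤j eq in proj₁ ins , in⇒neg ins
  ... | false = let out , _ = outside-spec j 1≤j eq in out⇒pos out , proj₂ out

  ones zeros : ℕ → ℕ
  ones  = count inside?
  zeros = count (λ j → not (inside? j))

  S≡ones : ∀ n → S n ≡ + k ℤ.* + ones n - + h ℤ.* + n
  S≡ones zero = eq (+ k) (+ h)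
    where
    eq : ∀ k h → 0ℤ ≡ k ℤ.* 0ℤ - h ℤ.* 0ℤ
    eq = solve-∀
  S≡ones (suc n) with inside? (suc n) in on
  ... | true  = trans (cong₂ _+_ (S≡ones n) (proj₂ (inside-spec (suc n) (s≤s z≤n) on))) (eq (+ h) (+ h′) (+ ones n) (+ n))
    where
    eq : ∀ h h′ c n → (h + h′) ℤ.* c - h ℤ.* n + h′ ≡ (h + h′) ℤ.* (1ℤ + c) - h ℤ.* (1ℤ + n)
    eq = solve-∀
  ... | false = trans (cong₂ _+_ (S≡ones n) (proj₂ (outside-spec (suc n) (s≤s z≤n) on))) (eq (+ k) (+ h) (+ ones n) (+ n))
    where
    eq : ∀ k h c n → k ℤ.* c - h ℤ.* n + - h ≡ k ℤ.* c - h ℤ.* (1ℤ + n)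
    eq = solve-∀

  S≡zeros : ∀ n → S n ≡ + h′ ℤ.* + n - + k ℤ.* + zeros n
  S≡zeros n = trans (S≡ones n) (trans (cong (λ t → + k ℤ.* + ones n - + h ℤ.* t) n≡)
    (trans (eq (+ h) (+ h′) (+ ones n) (+ zeros n)) (cong (λ t → + h′ ℤ.* t - + k ℤ.* + zeros n) (sym n≡))))
    where
    n≡ : + n ≡ + ones n + + zeros n
    n≡ = cong +_ (sym (count-not inside? n))
    eq : ∀ h h′ c d → (h + h′) ℤ.* c - h ℤ.* (c + d) ≡ h′ ℤ.* (c + d) - (h + h′) ℤ.* d
    eq = solve-∀

  module _ (i : ℕ) where
    private
      n v : ℕ
      n = i ℕ.* 2
      v = q n

      -- The residue of j pₙ modulo qₙ: for 1 ≤ j ≤ qₙ, j pₙ / qₙ and jα have the same integer part,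
      -- so `ρ j` lies in [0, v).
      ρ : ℕ → ℤ
      ρ j = ht (+ j) (floor j) n

      0≤ρ : ∀ j → 1 ℕ.≤ j → j ℕ.≤ v → 0ℤ ≤ ρ j
      0≤ρ j 1≤j j≤v = pos⇒0≤ht i (+ j) (floor j) 1ℤ (proj₁ (floor-spec j 1≤j))
        (subst (+ j ≤_) (sym (ℤᵖ.*-identityˡ (+ q (suc n)))) (+≤+ (ℕᵖ.≤-trans j≤v (q-step n)))) (λ le → le)

      ρ<v : ∀ j → 1 ℕ.≤ j → ρ j + 1ℤ ≤ + v
      ρ<v j 1≤j = from-gap (gap (neg⇒ht≤-1 i (+ j) (floor j + 1ℤ) (proj₂ (floor-spec j 1≤j)) (+≤+ 1≤j)))
        (eq (+ j) (floor j) (p n) (+ v))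
        where
        eq : ∀ j z x y → -1ℤ - (j ℤ.* x - (z + 1ℤ) ℤ.* y) ≡ y - (j ℤ.* x - z ℤ.* y + 1ℤ)
        eq = solve-∀

      r : ℕ → ℕ
      r j = ℤ.∣ ρ j ∣

      r≡ρ : ∀ j → 1 ℕ.≤ j → j ℕ.≤ v → + r j ≡ ρ j
      r≡ρ j 1≤j j≤v = ℤᵖ.0≤i⇒+∣i∣≡i (0≤ρ j 1≤j j≤v)

      r<v : ∀ j → 1 ℕ.≤ j → j ℕ.≤ v → r j ℕ.< v
      r<v j 1≤j j≤v = subst (ℕ._≤ v) (ℕᵖ.+-comm (r j) 1)
        (ℤᵖ.drop‿+≤+ (subst (λ t → t + 1ℤ ≤ + v) (sym (r≡ρ j 1≤j j≤v)) (ρ<v j 1≤j)))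

      -- The difference of the two vectors has height 0 at n, so Cramer's rule leaves only qₙ times
      -- the other height. This takes the place of the invertibility of pₙ modulo qₙ.
      ρ≡⇒multiple : ∀ j j′ → ρ j ≡ ρ j′ → ∃[ y ] + j - + j′ ≡ + v ℤ.* y
      ρ≡⇒multiple j j′ same = ht J Z (1 ℕ.+ n) , trans (J≡even i J Z)
        (trans (cong (λ t → + v ℤ.* ht J Z (1 ℕ.+ n) - + q (1 ℕ.+ n) ℤ.* t) ht≡0) (eq (+ v ℤ.* ht J Z (1 ℕ.+ n)) (+ q (1 ℕ.+ n))))
        where
        J Z : ℤ
        J = + j - + j′
        Z = floor j - floor j′
        linear : ∀ a b c d x y → (a - b) ℤ.* x - (c - d) ℤ.* y ≡ (a ℤ.* x - c ℤ.* y) - (b ℤ.* x - d ℤ.* y)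
        linear = solve-∀
        ht≡0 : ht J Z n ≡ 0ℤ
        ht≡0 = trans (linear (+ j) (+ j′) (floor j) (floor j′) (p n) (+ v)) (ℤᵖ.i≡j⇒i-j≡0 same)
        eq : ∀ s t → s - t ℤ.* 0ℤ ≡ s
        eq = solve-∀

      multiple⇒≤ : ∀ j j′ y → j ℕ.≤ v → 1 ℕ.≤ j′ → + j - + j′ ≡ + v ℤ.* y → j ℕ.≤ j′
      multiple⇒≤ j j′ y j≤v 1≤j′ diff with ≤0⊎1≤ y
      ... | inj₁ y≤0 = ℤᵖ.drop‿+≤+ (from-gap (0≤+ v ⊗ gap y≤0)
              (trans (eq (+ v) y) (trans (cong -_ (sym diff)) (eq′ (+ j) (+ j′)))))
        where
        eq : ∀ v y → v ℤ.* (0ℤ - y) ≡ - (v ℤ.* y)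
        eq = solve-∀
        eq′ : ∀ x y → - (x - y) ≡ y - x
        eq′ = solve-∀
      ... | inj₂ 1≤y = absurd-gap (0≤+ v ⊗ gap 1≤y ⊕ gap (+≤+ j≤v) ⊕ gap (+≤+ 1≤j′))
              (trans (eq (+ v) y (+ j) (+ j′)) (trans (cong (λ t → t - (+ j - + j′) - 1ℤ) (sym diff)) (eq′ (+ j - + j′))))
        where
        eq : ∀ v y j j′ → v ℤ.* (y - 1ℤ) + (v - j) + (j′ - 1ℤ) ≡ v ℤ.* y - (j - j′) - 1ℤ
        eq = solve-∀
        eq′ : ∀ x → x - x - 1ℤ ≡ -1ℤ
        eq′ = solve-∀

      r-injective : ∀ j j′ → 1 ℕ.≤ j → j ℕ.≤ v → 1 ℕ.≤ j′ → j′ ℕ.≤ v → r j ≡ r j′ → j ≡ j′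
      r-injective j j′ 1≤j j≤v 1≤j′ j′≤v same =
        let ρ≡ = trans (sym (r≡ρ j 1≤j j≤v)) (trans (cong +_ same) (r≡ρ j′ 1≤j′ j′≤v))
            y  , diff  = ρ≡⇒multiple j j′ ρ≡
            y′ , diff′ = ρ≡⇒multiple j′ j (sym ρ≡)
        in ℕᵖ.≤-antisym (multiple⇒≤ j j′ y j≤v 1≤j′ diff) (multiple⇒≤ j′ j y′ j′≤v 1≤j diff′)

      ht-scaled : ∀ j → ht (+ k ℤ.* + j) (+ k ℤ.* floor j + + h) n ≡ + k ℤ.* ρ j - + h ℤ.* + v
      ht-scaled j = eq (+ k) (+ j) (floor j) (+ h) (p n) (+ v)
        where
        eq : ∀ k j z h x y → k ℤ.* j ℤ.* x - (k ℤ.* z + h) ℤ.* y ≡ k ℤ.* (j ℤ.* x - z ℤ.* y) - h ℤ.* y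
        eq = solve-∀

      1≤kj : ∀ {j} → 1 ℕ.≤ j → 1ℤ ≤ + k ℤ.* + j
      1≤kj {j} 1≤j = subst (1ℤ ≤_) (ℤᵖ.pos-* k j) (+≤+ (ℕᵖ.*-mono-≤ 1≤k 1≤j))

    -- Inside implies k ρ < h v for every v: the vector (k j, k z + h) has height k ρ - h v at n,
    -- and `neg⇒ht≤-1` applies however large k j is.
    ones-bound : ∀ C → (∀ x → k ℕ.* x ℕ.< h ℕ.* q n → x ℕ.< C) → ones (q n) ℕ.≤ C
    ones-bound C bound = count-pigeonhole inside? v C r r<C r-injective
      where
      r<C : ∀ j → 1 ℕ.≤ j → j ℕ.≤ v → inside? j ≡ true → r j ℕ.< C
      r<C j 1≤j j≤v on = bound (r j) (ℤᵖ.drop‿+≤+ (from-gap (gap kρ-hv≤-1) kr<hv))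
        where
        kρ-hv≤-1 : + k ℤ.* ρ j - + h ℤ.* + v ≤ -1ℤ
        kρ-hv≤-1 = subst (_≤ -1ℤ) (ht-scaled j)
          (neg⇒ht≤-1 i (+ k ℤ.* + j) (+ k ℤ.* floor j + + h) (proj₂ (proj₁ (inside-spec j 1≤j on))) (1≤kj 1≤j))
        eq : ∀ x y → -1ℤ - (x - y) ≡ y - (1ℤ + x)
        eq = solve-∀
        kr<hv : -1ℤ - (+ k ℤ.* ρ j - + h ℤ.* + v) ≡ + (h ℕ.* v) - + suc (k ℕ.* r j)
        kr<hv = trans (eq (+ k ℤ.* ρ j) (+ h ℤ.* + v))
          (cong₂ (λ s t → s - (1ℤ + t)) (sym (ℤᵖ.pos-* h v))
            (trans (cong (+ k ℤ.*_) (sym (r≡ρ j 1≤j j≤v))) (sym (ℤᵖ.pos-* k (r j)))))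

    -- Divisibility makes the height k ρ - h v a multiple of k, which is the premise of `pos⇒0≤ht`
    -- for k j ≤ k qₙ₊₁. The residues of outside points thus lie in [h c, v), and x ↦ v - 1 - x
    -- turns this into an initial segment of length h′ c.
    zeros-bound : ∀ c → q n ≡ c ℕ.* k → zeros (q n) ℕ.≤ h′ ℕ.* c
    zeros-bound c v≡ck = count-pigeonhole (λ j → not (inside? j)) v (h′ ℕ.* c) (λ j → v ℕ.∸ suc (r j)) small
      (λ j j′ 1≤j j≤v 1≤j′ j′≤v same → r-injective j j′ 1≤j j≤v 1≤j′ j′≤v
        (ℕᵖ.suc-injective (ℕᵖ.∸-cancelˡ-≡ (r<v j 1≤j j≤v) (r<v j′ 1≤j′ j′≤v) same)))
      where
      v≡ : + v ≡ + c ℤ.* + k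
      v≡ = trans (cong +_ v≡ck) (ℤᵖ.pos-* c k)
      factor : ∀ j → + k ℤ.* ρ j - + h ℤ.* + v ≡ + k ℤ.* (ρ j - + h ℤ.* + c)
      factor j = trans (cong (λ t → + k ℤ.* ρ j - + h ℤ.* t) v≡) (eq (+ k) (ρ j) (+ h) (+ c))
        where
        eq : ∀ k x h c → k ℤ.* x - h ℤ.* (c ℤ.* k) ≡ k ℤ.* (x - h ℤ.* c)
        eq = solve-∀
      hc≤ρ : ∀ j → 1 ℕ.≤ j → j ℕ.≤ v → inside? j ≡ false → 0ℤ ≤ ρ j - + h ℤ.* + c
      hc≤ρ j 1≤j j≤v off with ≤-1⊎0≤ (ρ j - + h ℤ.* + c)
      ... | inj₂ 0≤ = 0≤
      ... | inj₁ ≤-1 = absurd-gap (0≤+ k ⊗ gap ≤-1 ⊕ 0≤ht ⊕ gap (+≤+ 1≤k)) (eq (+ k) (ρ j - + h ℤ.* + c))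
        where
        y₀ : ℤ
        y₀ = ht (+ k ℤ.* + j) (+ k ℤ.* floor j + + h) n
        y₀≡ : y₀ ≡ + k ℤ.* (ρ j - + h ℤ.* + c)
        y₀≡ = trans (ht-scaled j) (factor j)
        eq : ∀ k x → k ℤ.* (-1ℤ - x) + k ℤ.* x + (k - 1ℤ) ≡ -1ℤ
        eq = solve-∀
        0≤ht : 0ℤ ≤ + k ℤ.* (ρ j - + h ℤ.* + c)
        0≤ht = subst (0ℤ ≤_) y₀≡ (pos⇒0≤ht i (+ k ℤ.* + j) (+ k ℤ.* floor j + + h) (+ k)
          (proj₁ (proj₁ (outside-spec j 1≤j off)))
          (ℤᵖ.*-monoˡ-≤-nonNeg (+ k) (+≤+ (ℕᵖ.≤-trans j≤v (q-step n))))
          (λ y₀≤-1 → subst (_≤ - + k) (sym y₀≡) (*≤-1⇒*≤- k 1≤k (subst (_≤ -1ℤ) y₀≡ y₀≤-1))))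
      small : ∀ j → 1 ℕ.≤ j → j ℕ.≤ v → not (inside? j) ≡ true → v ℕ.∸ suc (r j) ℕ.< h′ ℕ.* c
      small j 1≤j j≤v off with inside? j in on
      ... | false = subst (ℕ._≤ h′ ℕ.* c) (ℕᵖ.+-∸-assoc 1 (r<v j 1≤j j≤v))
              (subst (v ℕ.∸ r j ℕ.≤_) v∸hc (ℕᵖ.∸-monoʳ-≤ v hc≤r))
        where
        hc≤r : h ℕ.* c ℕ.≤ r j
        hc≤r = ℤᵖ.drop‿+≤+ (subst₂ _≤_ (sym (ℤᵖ.pos-* h c)) (sym (r≡ρ j 1≤j j≤v))
                 (ℤᵖ.0≤i-j⇒j≤i (hc≤ρ j 1≤j j≤v on)))
        v∸hc : v ℕ.∸ h ℕ.* c ≡ h′ ℕ.* c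
        v∸hc = trans (cong (ℕ._∸ h ℕ.* c) (trans v≡ck (trans (ℕᵖ.*-comm c k) (ℕᵖ.*-distribʳ-+ c h h′))))
                     (ℕᵖ.m+n∸m≡n (h ℕ.* c) (h′ ℕ.* c))

    -- At most (h v div k) + 1 residues x satisfy k x < h v; the extra one contributes the k.
    S-even≤k : S (q n) ≤ + k
    S-even≤k = from-gap (gap (+≤+ k*ones≤)) (trans (eq₁ (+ k) (+ (k ℕ.* ones v)) (+ (h ℕ.* v)))
        (trans (cong₂ (λ s t → + k - (s - t)) (ℤᵖ.pos-* k (ones v)) (ℤᵖ.pos-* h v))
          (cong (λ s → + k - s) (sym (S≡ones v)))))
      where
      instance
        k≢0 : ℕ.NonZero k
        k≢0 = ℕ.>-nonZero 1≤k
      C : ℕ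
      C = suc (h ℕ.* v ℕ./ k)
      eq₁ : ∀ k x y → k + y - x ≡ k - (x - y)
      eq₁ = solve-∀
      below : ∀ x → k ℕ.* x ℕ.< h ℕ.* v → x ℕ.< C
      below x kx<hv = s≤s (subst (ℕ._≤ h ℕ.* v ℕ./ k) (trans (cong (ℕ._/ k) (ℕᵖ.*-comm k x)) (ℕᵈ.m*n/n≡m x k))
        (ℕᵈ./-monoˡ-≤ k (ℕᵖ.<⇒≤ kx<hv)))
      k*ones≤ : k ℕ.* ones v ℕ.≤ k ℕ.+ h ℕ.* v
      k*ones≤ = ℕᵖ.≤-trans (ℕᵖ.*-monoʳ-≤ k (ones-bound C below))
        (subst (ℕ._≤ k ℕ.+ h ℕ.* v) (sym (ℕᵖ.*-suc k _))
          (ℕᵖ.+-monoʳ-≤ k (subst (ℕ._≤ h ℕ.* v) (ℕᵖ.*-comm (h ℕ.* v ℕ./ k) k) (ℕᵈ.m/n*n≤m (h ℕ.* v) k))))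

    -- With v = c k, at most h c ones give S ≤ 0, and at most h′ c zeros give S ≥ 0.
    S-even≡0 : k ∣ q n → S (q n) ≡ 0ℤ
    S-even≡0 (divides c v≡ck) = ℤᵖ.≤-antisym
      (subst (_≤ 0ℤ) (sym S≡k*) (from-gap (0≤+ k ⊗ gap (+≤+ ones≤)) (trans (cong (λ t → + k ℤ.* (t - + ones v)) (ℤᵖ.pos-* h c)) (eq₃ (+ k) (+ h ℤ.* + c) (+ ones v)))))
      (subst (0ℤ ≤_) (sym S≡k*′) (0≤+ k ⊗ subst (λ t → 0ℤ ≤ t - + zeros v) (ℤᵖ.pos-* h′ c) (gap (+≤+ (zeros-bound c v≡ck)))))
      where
      v≡ : + v ≡ + c ℤ.* + k
      v≡ = trans (cong +_ v≡ck) (ℤᵖ.pos-* c k)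
      eq₁ : ∀ k o h c → k ℤ.* o - h ℤ.* (c ℤ.* k) ≡ k ℤ.* (o - h ℤ.* c)
      eq₁ = solve-∀
      eq₂ : ∀ k o h c → h ℤ.* (c ℤ.* k) - k ℤ.* o ≡ k ℤ.* (h ℤ.* c - o)
      eq₂ = solve-∀
      eq₃ : ∀ k x o → k ℤ.* (x - o) ≡ 0ℤ - k ℤ.* (o - x)
      eq₃ = solve-∀
      S≡k* : S v ≡ + k ℤ.* (+ ones v - + h ℤ.* + c)
      S≡k* = trans (S≡ones v) (trans (cong (λ t → + k ℤ.* + ones v - + h ℤ.* t) v≡) (eq₁ (+ k) (+ ones v) (+ h) (+ c)))
      S≡k*′ : S v ≡ + k ℤ.* (+ h′ ℤ.* + c - + zeros v)
      S≡k*′ = trans (S≡zeros v) (trans (cong (λ t → + h′ ℤ.* t - + k ℤ.* + zeros v) v≡) (eq₂ (+ k) (+ zeros v) (+ h′) (+ c)))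
      ones≤ : ones v ℕ.≤ h ℕ.* c
      ones≤ = ones-bound (h ℕ.* c) λ x kx<hv → ℕᵖ.*-cancelˡ-< k x (h ℕ.* c)
        (subst (k ℕ.* x ℕ.<_) (trans (cong (h ℕ.*_) v≡ck) (trans (sym (ℕᵖ.*-assoc h c k)) (ℕᵖ.*-comm (h ℕ.* c) k))) kx<hv)

S-shift : ∀ {x x′ y y′ : ℤ} → x - x′ ≤ y - y′ → x ≤ y + (x′ - y′)
S-shift {x} {x′} {y} {y′} le = from-gap (gap le) (eq x x′ y y′)
  where
  eq : ∀ x x′ y y′ → y - y′ - (x - x′) ≡ y + (x′ - y′) - x
  eq = solve-∀

-- Boundedness from divisibility

module Bounded {h h′ : ℕ} (R : Rotation h h′) where
  open Rotation R
  open Core R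
  open Counting R

  S-segment₀ : ∀ n A → (∀ j → 1 ℕ.≤ j → j ℕ.≤ n → g (j ℕ.+ A) ≤ g j) → S (n ℕ.+ A) ≤ S n + S A
  S-segment₀ n A le = subst (λ m → S (n ℕ.+ A) ≤ S m + S A) (ℕᵖ.+-identityʳ n)
    (subst (λ t → S (n ℕ.+ A) ≤ S (n ℕ.+ 0) + t) (ℤᵖ.+-identityʳ (S A))
      (S-shift {S (n ℕ.+ A)} {S A} {S (n ℕ.+ 0)} {0ℤ} (S-segment n A 0 λ j 1≤j j≤n →
        subst (λ m → g (j ℕ.+ A) ≤ g m) (sym (ℕᵖ.+-identityʳ j)) (le j 1≤j j≤n))))

  S-segment₀′ : ∀ n A → (∀ j → 1 ℕ.≤ j → j ℕ.≤ n → g j ≤ g (j ℕ.+ A)) → S n + S A ≤ S (n ℕ.+ A)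
  S-segment₀′ n A le = subst (λ m → S m + S A ≤ S (n ℕ.+ A)) (ℕᵖ.+-identityʳ n)
    (from-gap (gap (S-segment n 0 A λ j 1≤j j≤n →
        subst (λ m → g m ≤ g (j ℕ.+ A)) (sym (ℕᵖ.+-identityʳ j)) (le j 1≤j j≤n)))
      (eq (S (n ℕ.+ 0)) (S (n ℕ.+ A)) (S A)))
    where
    eq : ∀ x y t → y - t - (x - 0ℤ) ≡ y - (x + t)
    eq = solve-∀

  module _ (i : ℕ) where
    private
      n v w c Q : ℕ
      n = i ℕ.* 2
      v = q n
      w = q (1 ℕ.+ n)
      c = a n
      Q = q (2 ℕ.+ n)

      Q≡ : Q ≡ c ℕ.* w ℕ.+ v
      Q≡ = q-rec n

    -- Only the starting point of each single shift must precede qₙ₊₂, so the endpoint may overshoot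
    -- it by less than qₙ₊₁.
    g-mono* : ∀ b j → 1 ℕ.≤ j → j ℕ.+ b ℕ.* q (1 ℕ.+ n) ℕ.< q (2 ℕ.+ n) ℕ.+ q (1 ℕ.+ n) →
              g j ≤ g (j ℕ.+ b ℕ.* q (1 ℕ.+ n))
    g-mono* zero    j 1≤j _  = ℤᵖ.≤-reflexive (cong g (sym (ℕᵖ.+-identityʳ j)))
    g-mono* (suc b) j 1≤j lt = ℤᵖ.≤-trans
      (g-mono* b j 1≤j (ℕᵖ.≤-<-trans (ℕᵖ.m≤m+n _ w) lt′))
      (subst (λ m → g (j ℕ.+ b ℕ.* w) ≤ g m) shuffle
        (g-mono i (j ℕ.+ b ℕ.* w) (ℕᵖ.≤-trans 1≤j (ℕᵖ.m≤m+n j _)) (ℕᵖ.+-cancelʳ-< w _ _ lt′)))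
      where
      shuffle : j ℕ.+ b ℕ.* w ℕ.+ w ≡ j ℕ.+ suc b ℕ.* w
      shuffle = trans (ℕᵖ.+-assoc j (b ℕ.* w) w) (cong (j ℕ.+_) (ℕᵖ.+-comm (b ℕ.* w) w))
      lt′ : j ℕ.+ b ℕ.* w ℕ.+ w ℕ.< Q ℕ.+ w
      lt′ = subst (ℕ._< Q ℕ.+ w) (sym shuffle) lt

    -- Cut [0, qₙ₊₂] into `a n` blocks of length qₙ₊₁ followed by one of length qₙ; each gains at
    -- least as much as the initial segment of its length.
    S-superadditive : + a n ℤ.* S (q (1 ℕ.+ n)) + S (q n) ≤ S (q (2 ℕ.+ n))
    S-superadditive = subst (λ m → + c ℤ.* S w + S v ≤ S m) (trans (ℕᵖ.+-comm v (c ℕ.* w)) (sym Q≡))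
      (from-gap (gap (S-segment₀′ v (c ℕ.* w) last-block) ⊕ gap (blocks c ℕᵖ.≤-refl))
        (eq (+ c ℤ.* S w) (S v) (S (c ℕ.* w)) (S (v ℕ.+ c ℕ.* w))))
      where
      eq : ∀ x s t u → u - (s + t) + (t - x) ≡ u - (x + s)
      eq = solve-∀
      w≤Q : ∀ b → b ℕ.< c → w ℕ.+ b ℕ.* w ℕ.≤ Q
      w≤Q b b<c = ℕᵖ.≤-trans (ℕᵖ.*-monoˡ-≤ w b<c) (subst (c ℕ.* w ℕ.≤_) (sym Q≡) (ℕᵖ.m≤m+n _ v))
      last-block : ∀ j → 1 ℕ.≤ j → j ℕ.≤ v → g j ≤ g (j ℕ.+ c ℕ.* w)
      last-block j 1≤j j≤v = g-mono* c j 1≤j (ℕᵖ.≤-<-trans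
        (ℕᵖ.≤-trans (ℕᵖ.+-monoˡ-≤ (c ℕ.* w) j≤v) (ℕᵖ.≤-reflexive (trans (ℕᵖ.+-comm v (c ℕ.* w)) (sym Q≡))))
        (ℕᵖ.m<m+n Q (1≤q (1 ℕ.+ n))))
      blocks : ∀ b → b ℕ.≤ c → + b ℤ.* S w ≤ S (b ℕ.* w)
      blocks zero    _   = ℤᵖ.≤-refl
      blocks (suc b) b<c = from-gap
        (gap (blocks b (ℕᵖ.<⇒≤ b<c)) ⊕ gap (S-segment₀′ w (b ℕ.* w) λ j 1≤j j≤w →
          g-mono* b j 1≤j (ℕᵖ.≤-<-trans (ℕᵖ.≤-trans (ℕᵖ.+-monoˡ-≤ (b ℕ.* w) j≤w) (w≤Q b b<c)) (ℕᵖ.m<m+n Q (1≤q (1 ℕ.+ n))))))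
        (eq₁ (+ b) (S w) (S (b ℕ.* w)) (S (suc b ℕ.* w)))
        where
        eq₁ : ∀ b s x y → x - b ℤ.* s + (y - (s + x)) ≡ y - (1ℤ + b) ℤ.* s
        eq₁ = solve-∀

    module _ (k∣v : k ∣ q n) (k∣Q : k ∣ q (2 ℕ.+ n)) where
      private
        Sv≡0 : S v ≡ 0ℤ
        Sv≡0 = S-even≡0 i k∣v

        SQ≡0 : S Q ≡ 0ℤ
        SQ≡0 = S-even≡0 (suc i) k∣Q

      -- A point that enters [0, c) at c before time Q is among the first v.
      g-late : ∀ b j → 1 ℕ.≤ j → j ℕ.+ v ℕ.≤ w → b ℕ.≤ c → g (j ℕ.+ v ℕ.+ b ℕ.* w) ≤ g (j ℕ.+ v)
      g-late b j 1≤j j+v≤w b≤c = g-mono-out (ℕᵖ.≤-trans 1≤j (ℕᵖ.m≤m+n j v)) (ℕᵖ.≤-trans 1≤j (ℕᵖ.≤-trans (ℕᵖ.m≤m+n j v) (ℕᵖ.m≤m+n (j ℕ.+ v) (b ℕ.* w)))) shift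
        where
        shift : ∀ {z} → Out (j ℕ.+ v) z → ∃[ z′ ] Out (j ℕ.+ v ℕ.+ b ℕ.* w) z′
        shift {z} (pos , neg) = z + + b ℤ.* t , pos-cast J≡ Z≡ pos′ ,
            pos-cast (trans (eq₁ (+ (j ℕ.+ v)) (+ b) (+ w)) (cong (λ s → - (+ (j ℕ.+ v) + s)) (sym (ℤᵖ.pos-* b w))))
              (eq₂ z (+ b) t) (pos-+* b neg (neg-convergent i))
          where
          t : ℤ
          t = p (1 ℕ.+ n)
          eq₁ : ∀ j b w → - j + b ℤ.* - w ≡ - (j + b ℤ.* w)
          eq₁ = solve-∀
          eq₂ : ∀ z b t → - (z + 1ℤ) + b ℤ.* - t ≡ - (z + b ℤ.* t + 1ℤ)
          eq₂ = solve-∀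
          J Z X y₀ y₁ : ℤ
          J = + k ℤ.* + (j ℕ.+ v)
          Z = + k ℤ.* z + + h
          X = + k ℤ.* + b
          y₀ = ht J Z n
          y₁ = ht J Z (1 ℕ.+ n)
          J≡ : J + X ℤ.* + w ≡ + k ℤ.* + (j ℕ.+ v ℕ.+ b ℕ.* w)
          J≡ = trans (eq (+ k) (+ (j ℕ.+ v)) (+ b) (+ w)) (cong (λ s → + k ℤ.* (+ (j ℕ.+ v) + s)) (sym (ℤᵖ.pos-* b w)))
            where
            eq : ∀ k j b w → k ℤ.* j + k ℤ.* b ℤ.* w ≡ k ℤ.* (j + b ℤ.* w)
            eq = solve-∀
          Z≡ : Z + X ℤ.* t ≡ + k ℤ.* (z + + b ℤ.* t) + + h
          Z≡ = eq (+ k) z (+ b) t (+ h)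
            where
            eq : ∀ k z b t h → k ℤ.* z + h + k ℤ.* b ℤ.* t ≡ k ℤ.* (z + b ℤ.* t) + h
            eq = solve-∀
          y₀≡ : ∃[ x ] y₀ ≡ + k ℤ.* x
          y₀≡ = let d = quotient k∣v in + (j ℕ.+ v) ℤ.* p n - z ℤ.* + v - + h ℤ.* + d ,
            trans (eq (+ k) (+ (j ℕ.+ v)) z (+ h) (p n) (+ v))
              (trans (cong (λ s → + k ℤ.* (+ (j ℕ.+ v) ℤ.* p n - z ℤ.* + v) - + h ℤ.* s) (trans (cong +_ (_∣_.equality k∣v)) (ℤᵖ.pos-* (quotient k∣v) k)))
                (eq′ (+ k) (+ (j ℕ.+ v) ℤ.* p n - z ℤ.* + v) (+ h) (+ quotient k∣v)))
            where
            eq : ∀ k j z h x y → k ℤ.* j ℤ.* x - (k ℤ.* z + h) ℤ.* y ≡ k ℤ.* (j ℤ.* x - z ℤ.* y) - h ℤ.* y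
            eq = solve-∀
            eq′ : ∀ k s h d → k ℤ.* s - h ℤ.* (d ℤ.* k) ≡ k ℤ.* (s - h ℤ.* d)
            eq′ = solve-∀
          0≤y₀ : 0ℤ ≤ y₀
          0≤y₀ = pos⇒0≤ht i J Z (+ k) pos (ℤᵖ.*-monoˡ-≤-nonNeg (+ k) (+≤+ j+v≤w))
            (let x , y₀≡kx = y₀≡ in λ y₀≤-1 →
              subst (_≤ - + k) (sym y₀≡kx) (*≤-1⇒*≤- k 1≤k (subst (_≤ -1ℤ) y₀≡kx y₀≤-1)))
          -- Here it matters that the index j + v exceeds v: subtracting k v from J shows that even
          -- y₁ - k is positive. Each of the b ≤ c shifts lowers the height c y₁ + y₀ at n + 2 by k,
          -- so it stays nonnegative.
          k<y₁ : 1ℤ ≤ y₁ - + k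
          k<y₁ = coord≥1 {+ k ℤ.* + j} {+ v} {+ w} {y₁ - + k} {y₀} (1≤qℤ n) (0≤+ w)
            (trans (eq (+ k) (+ j) (+ v)) (trans (cong (_- + k ℤ.* + v) (J≡even i J Z)) (eq′ (+ k) (+ v) (+ w) y₁ y₀)))
            (subst (1ℤ ≤_) (ℤᵖ.pos-* k j) (+≤+ (ℕᵖ.*-mono-≤ 1≤k 1≤j))) 0≤y₀
            where
            eq : ∀ k j v → k ℤ.* j ≡ k ℤ.* (j + v) - k ℤ.* v
            eq = solve-∀
            eq′ : ∀ k v w y₁ y₀ → v ℤ.* y₁ - w ℤ.* y₀ - k ℤ.* v ≡ v ℤ.* (y₁ - k) - w ℤ.* y₀
            eq′ = solve-∀
          pos′ : Pos p q (J + X ℤ.* + w) (Z + X ℤ.* t)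
          pos′ = posˡ {J + X ℤ.* + w} {Z + X ℤ.* t} {1 ℕ.+ n}
            (subst (1ℤ ≤_) (sym (ht-shift-same (1 ℕ.+ n) J Z X))
              (from-gap (gap k<y₁ ⊕ 0≤+ k) (eq (+ k) y₁)))
            (subst (0ℤ ≤_) (sym (trans (ht-shift-next (1 ℕ.+ n) J Z X)
                (cong₂ (λ s d → s + X ℤ.* d) (ht-rec J Z n) (det-odd i))))
              (subst (0ℤ ≤_) (eq′ (+ k) (+ c) (+ b) y₁ y₀)
                (0≤+ c ⊗ (gap k<y₁ ⊕ 0≤+ 1) ⊕ 0≤+ k ⊗ gap (+≤+ b≤c) ⊕ 0≤y₀)))
            where
            eq : ∀ k y → y - k - 1ℤ + k ≡ y - 1ℤ
            eq = solve-∀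
            eq′ : ∀ k c b y₁ y₀ → c ℤ.* (y₁ - k - 1ℤ + 1ℤ) + k ℤ.* (c - b) + y₀ ≡ c ℤ.* y₁ + y₀ + k ℤ.* b ℤ.* -1ℤ
            eq′ = solve-∀

      -- Both S v and S Q are 0. The points from c w + r to Q are those from r to v moved left, so
      -- this segment gains at least as much and must start no higher.
      S-row-end : ∀ r → r ℕ.≤ v → S (c ℕ.* w ℕ.+ r) ≤ S r
      S-row-end r r≤v = subst (S (c ℕ.* w ℕ.+ r) ≤_) (trans (cong₂ (λ s t → S r + (s - t)) S-end S-start) (ℤᵖ.+-identityʳ (S r)))
        (from-gap (gap (S-segment d r (c ℕ.* w ℕ.+ r) later)) (eq (S (d ℕ.+ r)) (S r) (S (d ℕ.+ (c ℕ.* w ℕ.+ r))) (S (c ℕ.* w ℕ.+ r))))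
        where
        d : ℕ
        d = v ℕ.∸ r
        d+r≡v : d ℕ.+ r ≡ v
        d+r≡v = ℕᵖ.m∸n+n≡m r≤v
        swap-+ : ∀ x → x ℕ.+ (c ℕ.* w ℕ.+ r) ≡ x ℕ.+ r ℕ.+ c ℕ.* w
        swap-+ x = trans (cong (x ℕ.+_) (ℕᵖ.+-comm (c ℕ.* w) r)) (sym (ℕᵖ.+-assoc x r (c ℕ.* w)))
        S-start : S (d ℕ.+ r) ≡ 0ℤ
        S-start = trans (cong S d+r≡v) Sv≡0
        S-end : S (d ℕ.+ (c ℕ.* w ℕ.+ r)) ≡ 0ℤ
        S-end = trans (cong S (trans (swap-+ d) (trans (cong (ℕ._+ c ℕ.* w) d+r≡v) (trans (ℕᵖ.+-comm v (c ℕ.* w)) (sym Q≡))))) SQ≡0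
        later : ∀ j → 1 ℕ.≤ j → j ℕ.≤ d → g (j ℕ.+ r) ≤ g (j ℕ.+ (c ℕ.* w ℕ.+ r))
        later j 1≤j j≤d = subst (λ m → g (j ℕ.+ r) ≤ g m) (sym (swap-+ j))
          (g-mono* c (j ℕ.+ r) (ℕᵖ.≤-trans 1≤j (ℕᵖ.m≤m+n j r)) (ℕᵖ.≤-<-trans
            (ℕᵖ.≤-trans (ℕᵖ.+-monoˡ-≤ (c ℕ.* w) (subst (j ℕ.+ r ℕ.≤_) d+r≡v (ℕᵖ.+-monoˡ-≤ r j≤d)))
              (ℕᵖ.≤-reflexive (trans (ℕᵖ.+-comm v (c ℕ.* w)) (sym Q≡))))
            (ℕᵖ.m<m+n Q (1≤q (1 ℕ.+ n)))))
        eq : ∀ x x′ y y′ → y - y′ - (x - x′) ≡ x′ + (y - x) - y′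
        eq = solve-∀

      S-row≤ : ∀ b r → r ℕ.≤ v → b ℕ.≤ c → S (b ℕ.* w ℕ.+ r) ≤ S r
      S-row≤ b r r≤v b≤c = convex-below-endpoints (λ b → S (b ℕ.* w ℕ.+ r)) c convex (S-row-end r r≤v) b b≤c
        where
        convex : ∀ b → 2 ℕ.+ b ℕ.≤ c → S (suc b ℕ.* w ℕ.+ r) - S (b ℕ.* w ℕ.+ r) ≤
                                         S ((2 ℕ.+ b) ℕ.* w ℕ.+ r) - S (suc b ℕ.* w ℕ.+ r)
        convex b 2+b≤c = subst₂ (λ s t → S s - S (b ℕ.* w ℕ.+ r) ≤ S t - S (suc b ℕ.* w ℕ.+ r))
          (sym (ℕᵖ.+-assoc w (b ℕ.* w) r)) (sym (ℕᵖ.+-assoc w (suc b ℕ.* w) r))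
          (S-segment w (b ℕ.* w ℕ.+ r) (suc b ℕ.* w ℕ.+ r) λ j 1≤j j≤w →
            subst (λ m → g (j ℕ.+ (b ℕ.* w ℕ.+ r)) ≤ g m) (shuffle j)
              (g-mono i (j ℕ.+ (b ℕ.* w ℕ.+ r)) (ℕᵖ.≤-trans 1≤j (ℕᵖ.m≤m+n j _)) (small j j≤w)))
          where
          shuffle : ∀ j → j ℕ.+ (b ℕ.* w ℕ.+ r) ℕ.+ w ≡ j ℕ.+ (suc b ℕ.* w ℕ.+ r)
          shuffle j = trans (ℕᵖ.+-assoc j (b ℕ.* w ℕ.+ r) w)
            (cong (j ℕ.+_) (trans (ℕᵖ.+-comm (b ℕ.* w ℕ.+ r) w) (sym (ℕᵖ.+-assoc w (b ℕ.* w) r))))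
          -- Since 2 + b ≤ c, a whole block w remains, which keeps the bound strict even for j = w
          -- and r = v.
          small : ∀ j → j ℕ.≤ w → j ℕ.+ (b ℕ.* w ℕ.+ r) ℕ.< Q
          small j j≤w = subst₂ ℕ._<_ (ℕᵖ.+-assoc j (b ℕ.* w) r) (sym Q≡)
            (ℕᵖ.+-mono-<-≤ (ℕᵖ.≤-<-trans (ℕᵖ.+-monoˡ-≤ (b ℕ.* w) j≤w)
              (ℕᵖ.<-≤-trans (ℕᵖ.m<n+m (suc b ℕ.* w) (1≤q (1 ℕ.+ n))) (ℕᵖ.*-monoˡ-≤ w 2+b≤c))) r≤v)

      -- `S-row≤` at r = v covers the steps up to v; beyond v no shifted point newly enters [0, c),
      -- by `g-late`.
      S-row> : ∀ b N → v ℕ.≤ N → N ℕ.≤ w → b ℕ.≤ c → S (b ℕ.* w ℕ.+ N) ≤ S N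
      S-row> b N v≤N N≤w b≤c = subst₂ (λ s t → S s ≤ S t)
          (trans (swap-+ d) (trans (ℕᵖ.+-comm _ (b ℕ.* w)) (cong (b ℕ.* w ℕ.+_) d+v≡N))) d+v≡N
          (from-gap (gap (S-segment d (b ℕ.* w ℕ.+ v) v late) ⊕ gap (S-row≤ b v ℕᵖ.≤-refl b≤c))
            (eq (S (d ℕ.+ (b ℕ.* w ℕ.+ v))) (S (b ℕ.* w ℕ.+ v)) (S (d ℕ.+ v)) (S v)))
        where
        d : ℕ
        d = N ℕ.∸ v
        d+v≡N : d ℕ.+ v ≡ N
        d+v≡N = ℕᵖ.m∸n+n≡m v≤N
        swap-+ : ∀ x → x ℕ.+ (b ℕ.* w ℕ.+ v) ≡ x ℕ.+ v ℕ.+ b ℕ.* w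
        swap-+ x = trans (cong (x ℕ.+_) (ℕᵖ.+-comm (b ℕ.* w) v)) (sym (ℕᵖ.+-assoc x v (b ℕ.* w)))
        late : ∀ j → 1 ℕ.≤ j → j ℕ.≤ d → g (j ℕ.+ (b ℕ.* w ℕ.+ v)) ≤ g (j ℕ.+ v)
        late j 1≤j j≤d = subst (λ m → g m ≤ g (j ℕ.+ v)) (sym (swap-+ j))
          (g-late b j 1≤j (ℕᵖ.≤-trans (subst (j ℕ.+ v ℕ.≤_) d+v≡N (ℕᵖ.+-monoˡ-≤ v j≤d)) N≤w) b≤c)
        eq : ∀ x y s t → s - t - (x - y) + (t - y) ≡ s - x
        eq = solve-∀

      -- Up to time w a shift by v never turns an outside point into an inside one, so S N ≤ S (N -
      -- v) + S v with S v = 0; repeat until N ≤ v. `f` bounds N for termination.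
      reduce-below-w : ∀ f N → N ℕ.≤ f → N ℕ.≤ w → ∃[ r ] (r ℕ.≤ v × S N ≤ S r)
      reduce-below-w f N N≤f N≤w with N ℕᵖ.≤? v
      ... | yes N≤v = N , N≤v , ℤᵖ.≤-refl
      reduce-below-w zero    N z≤n N≤w | no N≰v = ⊥-elim (N≰v z≤n)
      reduce-below-w (suc f) N N≤f N≤w | no N≰v =
        let v≤N = ℕᵖ.<⇒≤ (ℕᵖ.≰⇒> N≰v)
            d+v≡N = ℕᵖ.m∸n+n≡m v≤N
            d = N ℕ.∸ v
            d<N = ℕᵖ.∸-monoʳ-< (1≤q n) v≤N
            r , r≤v , Sd≤Sr = reduce-below-w f d (ℕᵖ.≤-pred (ℕᵖ.≤-trans d<N N≤f)) (ℕᵖ.≤-trans (ℕᵖ.<⇒≤ d<N) N≤w)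
            SN≤ = S-segment₀ d v λ j 1≤j j≤d → g-shift-even i j 1≤j
                    (ℕᵖ.≤-trans (subst (j ℕ.+ v ℕ.≤_) d+v≡N (ℕᵖ.+-monoˡ-≤ v j≤d)) N≤w)
        in r , r≤v , ℤᵖ.≤-trans
             (subst₂ _≤_ (cong S d+v≡N) (trans (cong (λ t → S d + t) Sv≡0) (ℤᵖ.+-identityʳ (S d))) SN≤) Sd≤Sr

      -- Division by w with remainder w allowed: the quotient then stays within `b` even when v = w.
      decompose : ∀ b N → N ℕ.≤ b ℕ.* w ℕ.+ v → ∃[ b′ ] ∃[ r ] (b′ ℕ.≤ b × r ℕ.≤ w × N ≡ b′ ℕ.* w ℕ.+ r)
      decompose zero    N N≤v = 0 , N , z≤n , ℕᵖ.≤-trans N≤v (q-step n) , refl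
      decompose (suc b) N N≤ with N ℕᵖ.≤? w
      ... | yes N≤w = 0 , N , z≤n , N≤w , refl
      ... | no N≰w =
        let w≤N = ℕᵖ.<⇒≤ (ℕᵖ.≰⇒> N≰w)
            b′ , r , b′≤b , r≤w , N∸w≡ = decompose b (N ℕ.∸ w)
              (ℕᵖ.m≤n+o⇒m∸n≤o N w (subst (N ℕ.≤_) (ℕᵖ.+-assoc w (b ℕ.* w) v) N≤))
        in suc b′ , r , s≤s b′≤b , r≤w ,
           trans (sym (ℕᵖ.m+[n∸m]≡n w≤N)) (trans (cong (w ℕ.+_) N∸w≡) (sym (ℕᵖ.+-assoc w (b′ ℕ.* w) r)))

      reduce-level : ∀ N → N ℕ.≤ q (2 ℕ.+ n) → ∃[ r ] (r ℕ.≤ q n × S N ≤ S r)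
      reduce-level N N≤Q with decompose c N (subst (N ℕ.≤_) Q≡ N≤Q)
      ... | b , r , b≤c , r≤w , refl with ℕᵖ.≤-total r v
      ...   | inj₁ r≤v = r , r≤v , S-row≤ b r r≤v b≤c
      ...   | inj₂ v≤r = let r′ , r′≤v , Sr≤ = reduce-below-w r r ℕᵖ.≤-refl r≤w
                         in r′ , r′≤v , ℤᵖ.≤-trans (S-row> b r v≤r r≤w b≤c) Sr≤

  i≤q-even : ∀ i → i ℕ.≤ q (i ℕ.* 2)
  i≤q-even zero    = z≤n
  i≤q-even (suc i) = subst (suc i ℕ.≤_) (sym (q-rec (i ℕ.* 2)))
    (ℕᵖ.+-mono-≤ (ℕᵖ.*-mono-≤ (1≤a (i ℕ.* 2)) (1≤q (1 ℕ.+ i ℕ.* 2))) (i≤q-even i))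

  S≤h′n : ∀ n → S n ≤ + (h′ ℕ.* n)
  S≤h′n n = from-gap (0≤+ k ⊗ 0≤+ (zeros n))
    (trans (eq (+ k ℤ.* + zeros n) (+ h′ ℤ.* + n)) (cong₂ _-_ (sym (ℤᵖ.pos-* h′ n)) (sym (S≡zeros n))))
    where
    eq : ∀ x y → x ≡ y - (y - x)
    eq = solve-∀

  divisible-even⇒bounded-above : ∀ m → (∀ i → m ℕ.≤ i → k ∣ q (i ℕ.* 2)) → ∃[ B ] (∀ N → S N ≤ + B)
  divisible-even⇒bounded-above m k∣q = B , λ N →
    level N N (ℕᵖ.≤-trans (ℕᵖ.m≤m+n N m) (i≤q-even (N ℕ.+ m)))
    where
    B : ℕ
    -- The trivial bound on [0, q₂ₘ], where the descent through the levels stops.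
    B = h′ ℕ.* q (m ℕ.* 2)
    level : ∀ d N → N ℕ.≤ q ((d ℕ.+ m) ℕ.* 2) → S N ≤ + B
    level zero    N N≤ = ℤᵖ.≤-trans (S≤h′n N) (+≤+ (ℕᵖ.*-monoʳ-≤ h′ N≤))
    level (suc d) N N≤ =
      let r , r≤ , SN≤Sr = reduce-level (d ℕ.+ m) (k∣q (d ℕ.+ m) (ℕᵖ.m≤n+m m d)) (k∣q (suc d ℕ.+ m) (ℕᵖ.m≤n+m m (suc d))) N N≤
      in ℤᵖ.≤-trans SN≤Sr (level d r r≤)

-- Unboundedness from non-divisibility

module Unbounded {h h′ : ℕ} (R : Rotation h h′)
  (S≡0⇒∣ : ∀ n → Core.S R n ≡ 0ℤ → h ℕ.+ h′ ∣ n) where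
  open Rotation R
  open Core R
  open Counting R
  open Bounded R

  0≤±det : ∀ X s → 0ℤ ≤ + ℤ.∣ X ∣ + X ℤ.* det s
  0≤±det X s with det≡±1 s
    where
    det≡±1 : ∀ s → det s ≡ 1ℤ ⊎ det s ≡ -1ℤ
    det≡±1 zero = inj₁ det₀
    det≡±1 (suc s) with det≡±1 s
    ... | inj₁ eq = inj₂ (trans (det-suc s) (cong -_ eq))
    ... | inj₂ eq = inj₁ (trans (det-suc s) (cong -_ eq))
  ... | inj₁ eq = subst (λ d → 0ℤ ≤ + ℤ.∣ X ∣ + X ℤ.* d) (sym eq)
                    (subst (λ t → 0ℤ ≤ + ℤ.∣ X ∣ + t) (sym (ℤᵖ.*-identityʳ X)) (0≤∣i∣+i X))
    where
    0≤∣i∣+i : ∀ i → 0ℤ ≤ + ℤ.∣ i ∣ + i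
    0≤∣i∣+i (+ n)    = 0≤+ (n ℕ.+ n)
    0≤∣i∣+i -[1+ n ] = ℤᵖ.≤-reflexive (sym (ℤᵖ.+-inverseʳ (+ suc n)))
  ... | inj₂ eq = subst (λ d → 0ℤ ≤ + ℤ.∣ X ∣ + X ℤ.* d) (sym eq)
                    (subst (λ t → 0ℤ ≤ + ℤ.∣ X ∣ + t) (trans (sym (ℤᵖ.-1*i≡-i X)) (ℤᵖ.*-comm -1ℤ X)) (0≤∣i∣-i X))
    where
    0≤∣i∣-i : ∀ i → 0ℤ ≤ + ℤ.∣ i ∣ - i
    0≤∣i∣-i (+ n)    = ℤᵖ.≤-reflexive (sym (ℤᵖ.+-inverseʳ (+ n)))
    0≤∣i∣-i -[1+ n ] = 0≤+ (suc n ℕ.+ suc n)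

  -- Because ‖qₛ α‖ → 0.
  pos-stable : ∀ {J Z} → Pos p q J Z → ∀ X → ∃[ s₀ ] (∀ s → s₀ ℕ.≤ s → Pos p q (J + X ℤ.* + q s) (Z + X ℤ.* p s))
  pos-stable {J} {Z} (positive ev) X =
    -- A height of at least |X| + 1 survives at s + 1, where the shift changes it by ±X; at s it
    -- does not change.
    let s₀ , big = unbounded-growth 1≤a (ht-rec J Z) ev (suc ℤ.∣ X ∣) in
    s₀ , λ s s₀≤s → posˡ {J + X ℤ.* + q s} {Z + X ℤ.* p s} {s}
      (subst (1ℤ ≤_) (sym (ht-shift-same s J Z X)) (ℤᵖ.≤-trans (+≤+ (s≤s z≤n)) (big s s₀≤s)))
      (subst (0ℤ ≤_) (sym (ht-shift-next s J Z X))
        (subst (0ℤ ≤_) (eq (ht J Z (1 ℕ.+ s)) (+ ℤ.∣ X ∣) (X ℤ.* det s))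
          (gap (big (1 ℕ.+ s) (ℕᵖ.m≤n⇒m≤1+n s₀≤s)) ⊕ 0≤+ 1 ⊕ 0≤±det X s)))
    where
    eq : ∀ y x d → y - (1ℤ + x) + 1ℤ + (x + d) ≡ y + d
    eq = solve-∀

  g≤h′ : ∀ j → 1 ℕ.≤ j → g j ≤ + h′
  g≤h′ j 1≤j with place j 1≤j
  ... | inj₁ (_ , _ , eq) = ℤᵖ.≤-reflexive eq
  ... | inj₂ (_ , _ , eq) = subst (_≤ + h′) (sym eq) -h≤h′

  -- An inside `j` already has the largest value of `g`. An outside `j` satisfies two strict
  -- inequalities, which survive a small shift in either direction, so `s` may have any parity.
  g-stable : ∀ j → 1 ℕ.≤ j → ∃[ s₀ ] (∀ s → s₀ ℕ.≤ s → g (j ℕ.+ q s) ≤ g j)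
  g-stable j 1≤j with place j 1≤j
  ... | inj₁ (_ , _ , eq) = 0 , λ s _ → subst (g (j ℕ.+ q s) ≤_) (sym eq) (g≤h′ _ (ℕᵖ.≤-trans 1≤j (ℕᵖ.m≤m+n j (q s))))
  ... | inj₂ (z , (pos , neg) , eq) =
    let s₀ , pos-s = pos-stable pos (+ k)
        s₁ , neg-s = pos-stable neg -1ℤ
    in s₀ ℕ.+ s₁ , λ s le → outside s
         ( pos-cast (eq₁ (+ k) (+ j) (+ q s)) (eq₂ (+ k) z (p s) (+ h)) (pos-s s (ℕᵖ.m+n≤o⇒m≤o s₀ le))
         , pos-cast (eq₃ (+ j) (+ q s)) (eq₄ z (p s)) (neg-s s (ℕᵖ.m+n≤o⇒n≤o s₀ le)))
    where
    eq₁ : ∀ k j w → k ℤ.* j + k ℤ.* w ≡ k ℤ.* (j + w)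
    eq₁ = solve-∀
    eq₂ : ∀ k z t h → k ℤ.* z + h + k ℤ.* t ≡ k ℤ.* (z + t) + h
    eq₂ = solve-∀
    eq₃ : ∀ j w → - j + -1ℤ ℤ.* w ≡ - (j + w)
    eq₃ = solve-∀
    eq₄ : ∀ z t → - (z + 1ℤ) + -1ℤ ℤ.* t ≡ - (z + t + 1ℤ)
    eq₄ = solve-∀
    outside : ∀ s → Out (j ℕ.+ q s) (z + p s) → g (j ℕ.+ q s) ≤ g j
    outside s out with place (j ℕ.+ q s) (ℕᵖ.≤-trans 1≤j (ℕᵖ.m≤m+n j (q s)))
    ... | inj₁ (_ , ins , _) = ⊥-elim (in-out-disjoint ins out)
    ... | inj₂ (_ , _ , eq′) = ℤᵖ.≤-reflexive (trans eq′ (sym eq))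

  g-stable-below : ∀ N → ∃[ s₀ ] (∀ s → s₀ ℕ.≤ s → ∀ j → 1 ℕ.≤ j → j ℕ.≤ N → g (j ℕ.+ q s) ≤ g j)
  g-stable-below zero = 0 , λ _ _ j 1≤j j≤0 → ⊥-elim (ℕᵖ.1+n≰n (ℕᵖ.≤-trans 1≤j j≤0))
  g-stable-below (suc N) =
    let s₀ , below = g-stable-below N
        s₁ , at    = g-stable (suc N) (s≤s z≤n)
    in s₀ ℕ.+ s₁ , λ s le j 1≤j j≤1+N → case (below s (ℕᵖ.m+n≤o⇒m≤o s₀ le)) (at s (ℕᵖ.m+n≤o⇒n≤o s₀ le)) j 1≤j (ℕᵖ.m≤n⇒m<n∨m≡n j≤1+N)
    where
    case : ∀ {s} → (∀ j → 1 ℕ.≤ j → j ℕ.≤ N → g (j ℕ.+ q s) ≤ g j) → g (suc N ℕ.+ q s) ≤ g (suc N) →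
           ∀ j → 1 ℕ.≤ j → j ℕ.< suc N ⊎ j ≡ suc N → g (j ℕ.+ q s) ≤ g j
    case below at j 1≤j (inj₁ j<1+N) = below j 1≤j (ℕᵖ.≤-pred j<1+N)
    case below at j 1≤j (inj₂ refl)  = at

  S-unbounded-below : (∀ s₀ → ∃[ s ] (s₀ ℕ.≤ s × S (q s) ≤ -1ℤ)) → ∀ b → ∃[ N ] S N ≤ - + b
  S-unbounded-below negative zero    = 0 , ℤᵖ.≤-refl
  S-unbounded-below negative (suc b) =
    let N , SN≤    = S-unbounded-below negative b
        s₀ , below = g-stable-below N
        s , s₀≤s , Sq≤-1 = negative s₀
    in N ℕ.+ q s , from-gap (gap SN≤ ⊕ gap Sq≤-1 ⊕ gap (S-segment₀ N (q s) (below s s₀≤s)))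
         (eq (+ b) (S N) (S (q s)) (S (N ℕ.+ q s)))
    where
    eq : ∀ b x y t → - b - x + (-1ℤ - y) + (x + y - t) ≡ - (1ℤ + b) - t
    eq = solve-∀

  module _ (em : ExcludedMiddle 0ℓ) where

    -- Otherwise S is nonnegative at all late denominators. Superadditivity then makes S q₂ᵢ
    -- nondecreasing, with a gain of at least 1 wherever k does not divide q₂ᵢ₊₁, until it exceeds
    -- the bound k.
    nondivisible-odd⇒negative : (∀ m → ∃[ i ] (m ℕ.≤ i × ¬ k ∣ q (1 ℕ.+ i ℕ.* 2))) →
                                ∀ s₀ → ∃[ s ] (s₀ ℕ.≤ s × S (q s) ≤ -1ℤ)
    nondivisible-odd⇒negative cofinal s₀ with em {∃[ s ] (s₀ ℕ.≤ s × S (q s) ≤ -1ℤ)}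
    ... | yes found = found
    ... | no  none  =
      let i , s₀≤i , big = grow (suc k)
      in absurd-gap (gap big ⊕ gap (S-even≤k i)) (eq (+ k) (S (q (i ℕ.* 2))))
      where
      eq : ∀ k x → x - (1ℤ + k) + (k - x) ≡ -1ℤ
      eq = solve-∀
      nonneg : ∀ s → s₀ ℕ.≤ s → 0ℤ ≤ S (q s)
      nonneg s s₀≤s with ≤-1⊎0≤ (S (q s))
      ... | inj₁ ≤-1 = ⊥-elim (none (s , s₀≤s , ≤-1))
      ... | inj₂ 0≤  = 0≤
      n≤n*2 : ∀ n → n ℕ.≤ n ℕ.* 2
      n≤n*2 n = ℕᵖ.m≤m*n n 2
      nonneg-odd : ∀ i → s₀ ℕ.≤ i → 0ℤ ≤ S (q (1 ℕ.+ i ℕ.* 2))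
      nonneg-odd i s₀≤i = nonneg (1 ℕ.+ i ℕ.* 2) (ℕᵖ.≤-trans s₀≤i (ℕᵖ.m≤n⇒m≤1+n (n≤n*2 i)))
      S-step : ∀ i → s₀ ℕ.≤ i → S (q (i ℕ.* 2)) ≤ S (q (2 ℕ.+ i ℕ.* 2))
      S-step i s₀≤i = from-gap (gap (S-superadditive i) ⊕ 0≤+ (a (i ℕ.* 2)) ⊗ nonneg-odd i s₀≤i)
        (eq₁ (+ a (i ℕ.* 2)) (S (q (1 ℕ.+ i ℕ.* 2))) (S (q (i ℕ.* 2))) (S (q (2 ℕ.+ i ℕ.* 2))))
        where
        eq₁ : ∀ c x y t → t - (c ℤ.* x + y) + c ℤ.* x ≡ t - y
        eq₁ = solve-∀
      S-mono : ∀ d i → s₀ ℕ.≤ i → S (q (i ℕ.* 2)) ≤ S (q ((d ℕ.+ i) ℕ.* 2))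
      S-mono zero    i s₀≤i = ℤᵖ.≤-refl
      S-mono (suc d) i s₀≤i = ℤᵖ.≤-trans (S-mono d i s₀≤i) (S-step (d ℕ.+ i) (ℕᵖ.≤-trans s₀≤i (ℕᵖ.m≤n+m i d)))
      1≤S : ∀ i → s₀ ℕ.≤ i → ¬ k ∣ q (1 ℕ.+ i ℕ.* 2) → 1ℤ ≤ S (q (1 ℕ.+ i ℕ.* 2))
      1≤S i s₀≤i k∤q with ≤0⊎1≤ (S (q (1 ℕ.+ i ℕ.* 2)))
      ... | inj₂ 1≤ = 1≤
      ... | inj₁ ≤0 = ⊥-elim (k∤q (S≡0⇒∣ _ (ℤᵖ.≤-antisym ≤0 (nonneg-odd i s₀≤i))))
      grow : ∀ b → ∃[ i ] (s₀ ℕ.≤ i × + b ≤ S (q (i ℕ.* 2)))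
      grow zero    = s₀ , ℕᵖ.≤-refl , nonneg (s₀ ℕ.* 2) (n≤n*2 s₀)
      grow (suc b) =
        let i , s₀≤i , big = grow b
            i′ , i≤i′ , k∤q = cofinal i
            s₀≤i′ = ℕᵖ.≤-trans s₀≤i i≤i′
            mono = subst (λ m → S (q (i ℕ.* 2)) ≤ S (q (m ℕ.* 2))) (ℕᵖ.m∸n+n≡m i≤i′) (S-mono (i′ ℕ.∸ i) i s₀≤i)
            c = a (i′ ℕ.* 2)
        in suc i′ , ℕᵖ.m≤n⇒m≤1+n s₀≤i′ ,
           from-gap (gap (S-superadditive i′) ⊕ gap mono ⊕ gap big ⊕ 0≤+ c ⊗ gap (1≤S i′ s₀≤i′ k∤q) ⊕ gap (+≤+ (1≤a (i′ ℕ.* 2))))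
             (eq₂ (+ b) (+ c) (S (q (1 ℕ.+ i′ ℕ.* 2))) (S (q (i′ ℕ.* 2))) (S (q (2 ℕ.+ i′ ℕ.* 2))) (S (q (i ℕ.* 2))))
        where
        eq₂ : ∀ b c x y t u → t - (c ℤ.* x + y) + (y - u) + (u - b) + c ℤ.* (x - 1ℤ) + (c - 1ℤ) ≡ t - (1ℤ + b)
        eq₂ = solve-∀

    bounded-below⇒divisible-odd : ∀ B → (∀ N → - + B ≤ S N) → ∃[ m ] (∀ i → m ℕ.≤ i → k ∣ q (1 ℕ.+ i ℕ.* 2))
    bounded-below⇒divisible-odd B bounded with em {∃[ m ] (∀ i → m ℕ.≤ i → k ∣ q (1 ℕ.+ i ℕ.* 2))}
    ... | yes found = found
    ... | no  none  =
      let N , SN≤ = S-unbounded-below (nondivisible-odd⇒negative cofinal) (suc B)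
      in absurd-gap (gap (bounded N) ⊕ gap SN≤) (eq (+ B) (S N))
      where
      eq : ∀ b x → x - - b + (- (1ℤ + b) - x) ≡ -1ℤ
      eq = solve-∀
      cofinal : ∀ m → ∃[ i ] (m ℕ.≤ i × ¬ k ∣ q (1 ℕ.+ i ℕ.* 2))
      cofinal m with em {∃[ i ] (m ℕ.≤ i × ¬ k ∣ q (1 ℕ.+ i ℕ.* 2))}
      ... | yes found = found
      ... | no  none′ = ⊥-elim (none (m , λ i m≤i → divides-at i m≤i))
        where
        divides-at : ∀ i → m ℕ.≤ i → k ∣ q (1 ℕ.+ i ℕ.* 2)
        divides-at i m≤i with k ∣? q (1 ℕ.+ i ℕ.* 2)
        ... | yes k∣q = k∣q
        ... | no  k∤q = ⊥-elim (none′ (i , m≤i , k∤q))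

-- The reflection from α to -α

module _ {h h′ : ℕ} (R : Rotation h h′) where
  private module R = Rotation R

  -- Indices move by one because the negated odd convergents are the ones below -α. Negation and the
  -- index shift each flip the determinant, so it starts with 1 again.
  reflect : Rotation h′ h
  reflect = record
    { a     = λ n → R.a (1 ℕ.+ n)
    ; p     = λ n → - R.p (1 ℕ.+ n)
    ; q     = λ n → R.q (1 ℕ.+ n)
    ; 1≤a   = λ n → R.1≤a (1 ℕ.+ n)
    ; p-rec = λ n → recurrent-neg R.1≤a {R.p} R.p-rec (1 ℕ.+ n)
    ; q-rec = λ n → R.q-rec (1 ℕ.+ n)
    ; 1≤q₀  = Core.1≤q R 1
    ; q₀≤q₁ = Core.q-step R 1
    ; det₀  = trans (eq (R.p 2) (+ R.q 1) (R.p 1) (+ R.q 2)) (cong -_ (Core.det-odd R 0))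
    ; 1≤h   = R.1≤h′
    ; 1≤h′  = R.1≤h
    ; g     = λ j → - R.g j
    ; place = λ j 1≤j → reflect-place j (R.place j 1≤j)
    }
    where
    eq : ∀ a b c d → - a ℤ.* b - - c ℤ.* d ≡ - (a ℤ.* b - c ℤ.* d)
    eq = solve-∀
    p′ : ℕ → ℤ
    p′ n = - R.p (1 ℕ.+ n)
    q′ : ℕ → ℕ
    q′ n = R.q (1 ℕ.+ n)
    reflect-pos : ∀ {J Z J′ Z′} → J′ ≡ - J → Z′ ≡ Z → Pos R.p R.q J Z → Pos p′ q′ J′ Z′
    reflect-pos {J} {Z} refl refl (positive (n₀ , pos)) = positive (n₀ , λ n n₀≤n →
      subst (1ℤ ≤_) (eq′ J Z (R.p (1 ℕ.+ n)) (+ R.q (1 ℕ.+ n))) (pos (1 ℕ.+ n) (ℕᵖ.m≤n⇒m≤1+n n₀≤n)))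
      where
      eq′ : ∀ J Z x y → J ℤ.* x - Z ℤ.* y ≡ - J ℤ.* - x - Z ℤ.* y
      eq′ = solve-∀
    reflect-place : ∀ j →
      (∃[ z ] (Inside R.p R.q h h′ j z × R.g j ≡ + h′)) ⊎ (∃[ z ] (Outside R.p R.q h h′ j z × R.g j ≡ - + h)) →
      (∃[ z ] (Inside p′ q′ h′ h j z × - R.g j ≡ + h)) ⊎ (∃[ z ] (Outside p′ q′ h′ h j z × - R.g j ≡ - + h′))
    -- -z - 1 is the integer part of -jα, and inside for c becomes outside for 1 - c.
    reflect-place j (inj₁ (z , (pos , neg) , eq₀)) = inj₂ (- z - 1ℤ ,
      ( reflect-pos (eq₁ (+ h) (+ h′) (+ j)) (eq₂ (+ h) (+ h′) z) neg
      , reflect-pos refl (eq₃ z) pos) , cong -_ eq₀)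
      where
      eq₁ : ∀ h h′ j → (h′ + h) ℤ.* j ≡ - (- ((h + h′) ℤ.* j))
      eq₁ = solve-∀
      eq₂ : ∀ h h′ z → (h′ + h) ℤ.* (- z - 1ℤ) + h′ ≡ - ((h + h′) ℤ.* z + h)
      eq₂ = solve-∀
      eq₃ : ∀ z → - (- z - 1ℤ + 1ℤ) ≡ z
      eq₃ = solve-∀
    reflect-place j (inj₂ (z , (pos , neg) , eq₀)) = inj₁ (- z - 1ℤ ,
      ( reflect-pos (sym (ℤᵖ.neg-involutive (+ j))) (eq₁ z) neg
      , reflect-pos (eq₂ (+ h) (+ h′) (+ j)) (eq₃ (+ h) (+ h′) z) pos) , trans (cong -_ eq₀) (ℤᵖ.neg-involutive (+ h)))
      where
      eq₁ : ∀ z → - z - 1ℤ ≡ - (z + 1ℤ)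
      eq₁ = solve-∀
      eq₂ : ∀ h h′ j → - ((h′ + h) ℤ.* j) ≡ - ((h + h′) ℤ.* j)
      eq₂ = solve-∀
      eq₃ : ∀ h h′ z → - ((h′ + h) ℤ.* (- z - 1ℤ) + h′) ≡ (h + h′) ℤ.* z + h
      eq₃ = solve-∀

  S-reflect : ∀ n → Core.S reflect n ≡ - Core.S R n
  S-reflect zero    = refl
  S-reflect (suc n) = trans (cong (_+ - R.g (suc n)) (S-reflect n)) (sym (ℤᵖ.neg-distrib-+ (Core.S R n) (R.g (suc n))))

  S≡0⇒∣-reflect : (∀ n → Core.S R n ≡ 0ℤ → h ℕ.+ h′ ∣ n) → ∀ n → Core.S reflect n ≡ 0ℤ → h′ ℕ.+ h ∣ n
  S≡0⇒∣-reflect S≡0⇒∣ n S′≡0 = subst (_∣ n) (ℕᵖ.+-comm h h′)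
    (S≡0⇒∣ n (trans (sym (ℤᵖ.neg-involutive (Core.S R n))) (cong -_ (trans (sym (S-reflect n)) S′≡0))))

open import Defs

-- Divisibility of the denominators

recurrence-shift : ∀ s t a n → recurrence t (a 0 ℕ.* t ℕ.+ s) (λ i → a (suc i)) n ≡ recurrence s t a (suc n)
recurrence-shift s t a zero          = refl
recurrence-shift s t a (suc zero)    = refl
recurrence-shift s t a (suc (suc n)) = cong₂ (λ x y → a (suc n) ℕ.* x ℕ.+ y)
  (recurrence-shift s t a (suc n)) (recurrence-shift s t a n)

foldl-recurrence : ∀ n s t a →
  foldl (λ (x , y) c → y , c ℕ.* y ℕ.+ x) (s , t) (applyUpTo a n) ≡ (recurrence s t a n , recurrence s t a (suc n))
foldl-recurrence zero    s t a = refl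
foldl-recurrence (suc n) s t a = trans (foldl-recurrence n t (a 0 ℕ.* t ℕ.+ s) (λ i → a (suc i)))
  (cong₂ _,_ (recurrence-shift s t a n) (recurrence-shift s t a (suc n)))

-- The integers m ≥ -1, indexed by the length of the tuple (a₀, …, aₘ).
last-index : ℕ → ℤ
last-index zero    = -1ℤ
last-index (suc t) = + t

last-index-view : ∀ {m} → -1ℤ ≤ m → ∃[ t ] m ≡ last-index t
last-index-view {+ n}        _              = suc n , refl
last-index-view { -[1+ zero ]} _            = zero , refl
last-index-view { -[1+ suc n ]} (ℤ.-≤- ())

-1≤last-index : ∀ t → -1ℤ ≤ last-index t
-1≤last-index zero    = ℤ.-≤- z≤n
-1≤last-index (suc t) = ℤ.-≤+

last-index-+ : ∀ t n → last-index t + + (2 ℕ.* suc n) ≡ + (n ℕ.* 2 ℕ.+ suc t)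
last-index-+ t n = trans (cong (λ x → last-index t + + x) (ℕᵖ.*-comm 2 (suc n))) (go t)
  where
  go : ∀ t → last-index t + + (suc n ℕ.* 2) ≡ + (n ℕ.* 2 ℕ.+ suc t)
  go zero    = cong +_ (ℕᵖ.+-comm 1 (n ℕ.* 2))
  go (suc t) = cong +_ (trans (ℕᵖ.+-comm t (2 ℕ.+ n ℕ.* 2)) (sym (trans (ℕᵖ.+-suc (n ℕ.* 2) (suc t)) (cong suc (ℕᵖ.+-suc (n ℕ.* 2) t)))))

parity-view : ∀ t → ∃[ i ] (t ≡ i ℕ.* 2 ⊎ t ≡ suc (i ℕ.* 2))
parity-view zero = zero , inj₁ refl
parity-view (suc t) with parity-view t
... | i , inj₁ refl = i , inj₂ refl
... | i , inj₂ refl = suc i , inj₁ refl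

2∤suc-even : ∀ i → ¬ 2 ∣ suc (i ℕ.* 2)
2∤suc-even i 2∣ = contradiction (∣1⇒≡1 (∣m+n∣m⇒∣n (subst (2 ∣_) (ℕᵖ.+-comm 1 (i ℕ.* 2)) 2∣) (n∣m*n i))) λ ()

last-index-odd : ∀ i → Odd (last-index (i ℕ.* 2))
last-index-odd zero    = 2∤suc-even 0
last-index-odd (suc i) = 2∤suc-even i

last-index-even : ∀ i → Even (last-index (suc (i ℕ.* 2)))
last-index-even i = n∣m*n i

module Denominators (a : ℕ → ℕ) where

  U : ℕ → ℕ
  U = recurrence 1 0 a

  q-last-index : ∀ t n → q a (last-index t + + (2 ℕ.* n)) ≡ U (n ℕ.* 2 ℕ.+ suc t)
  q-last-index zero    zero    = refl
  q-last-index (suc t) zero    = cong (λ x → U (2 ℕ.+ x)) (ℕᵖ.+-identityʳ t)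
  q-last-index t       (suc n) = cong (λ x → U ℤ.∣ + 2 + x ∣) (last-index-+ t n)

  consecutive-coprime : ∀ n → Coprime (U n) (U (suc n))
  consecutive-coprime zero    (d∣1 , _) = ∣1⇒≡1 d∣1
  consecutive-coprime (suc n) (d∣U₁ , d∣U₂) =
    consecutive-coprime n (∣m+n∣m⇒∣n d∣U₂ (∣n⇒∣m*n (a n) d∣U₁) , d∣U₁)

  module _ (k : ℕ) .{{_ : ℕ.NonZero k}} where

    κ-prefix : ∀ t → κ k (applyUpTo a t) ≡ (U t ℕ.% k , U (suc t) ℕ.% k)
    κ-prefix t = cong (λ (x , y) → x ℕ.% k , y ℕ.% k) (foldl-recurrence t 1 0 a)

    prefix-last-index : ∀ t → prefix a (last-index t) ≡ applyUpTo a t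
    prefix-last-index zero    = refl
    prefix-last-index (suc t) = refl

    -- A common divisor of k and Uᵢ₊₁ also divides Uᵢ, hence is 1; so k divides aᵢ because it
    -- divides aᵢ Uᵢ₊₁ = Uᵢ₊₂ - Uᵢ. The first residue is nonzero since k > 1 cannot divide two
    -- consecutive denominators.
    divisible⇒type : ∀ {t} → 1 ℕ.< k → (∀ n → k ∣ U (n ℕ.* 2 ℕ.+ suc t)) →
                     OfType k (applyUpTo a t) × (∀ n → k ∣ a (n ℕ.* 2 ℕ.+ suc t))
    divisible⇒type {t} 1<k k∣U =
      (U t ℕ.% k , ℕᵖ.n≢0⇒n>0 U%k≢0 , ℕᵈ.m%n<n (U t) k ,
        trans (κ-prefix t) (cong (U t ℕ.% k ,_) (n∣m⇒m%n≡0 (U (suc t)) k (k∣U 0)))) ,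
      λ n → let i = n ℕ.* 2 ℕ.+ suc t in
        coprime-divisor {k} {U (suc i)} {a i} (λ (d∣k , d∣U) → consecutive-coprime i (∣-trans d∣k (k∣U n) , d∣U))
          (subst (k ∣_) (ℕᵖ.*-comm (a i) (U (suc i)))
            (∣m+n∣m⇒∣n (subst (k ∣_) (ℕᵖ.+-comm (a i ℕ.* U (suc i)) (U i)) (k∣U (suc n))) (k∣U n)))
      where
      U%k≢0 : ¬ U t ℕ.% k ≡ 0
      U%k≢0 eq = ℕᵖ.<-irrefl (sym (consecutive-coprime t (m%n≡0⇒n∣m (U t) k eq , k∣U 0))) 1<k

    type⇒divisible : ∀ {t} → OfType k (applyUpTo a t) → (∀ n → k ∣ a (n ℕ.* 2 ℕ.+ suc t)) →
                     ∀ n → k ∣ U (n ℕ.* 2 ℕ.+ suc t)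
    type⇒divisible {t} (_ , _ , _ , κ≡) k∣a zero =
      m%n≡0⇒n∣m (U (suc t)) k (cong proj₂ (trans (sym (κ-prefix t)) κ≡))
    type⇒divisible {t} type k∣a (suc n) =
      ∣m∣n⇒∣m+n (∣m⇒∣m*n (U (suc (n ℕ.* 2 ℕ.+ suc t))) (k∣a n)) (type⇒divisible type k∣a n)

    divisible⇔type : (P : ℤ → Set) → 1 ℕ.< k →
      (∃[ m ] (-1ℤ ≤ m × P m × (∀ n → k ∣ q a (m + + (2 ℕ.* n))))) ⇔
      (∃[ m ] (-1ℤ ≤ m × P m × OfType k (prefix a m) × (∀ n → 1 ℕ.≤ n → k ∣ a ℤ.∣ m + + (2 ℕ.* n) ∣)))
    divisible⇔type P 1<k = mk⇔ to from
      where
      to : _ → _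
      to (m , -1≤m , Pm , k∣q) with last-index-view -1≤m
      ... | t , refl =
        let type , k∣a = divisible⇒type {t} 1<k λ n → subst (k ∣_) (q-last-index t n) (k∣q n)
        in m , -1≤m , Pm , subst (OfType k) (sym (prefix-last-index t)) type ,
           λ { (suc n) _ → subst (λ x → k ∣ a ℤ.∣ x ∣) (sym (last-index-+ t n)) (k∣a n) }
      from : _ → _
      from (m , -1≤m , Pm , type , k∣a) with last-index-view -1≤m
      ... | t , refl = m , -1≤m , Pm , λ n → subst (k ∣_) (sym (q-last-index t n))
        (type⇒divisible {t} (subst (OfType k) (prefix-last-index t) type)
          (λ n → subst (λ x → k ∣ a ℤ.∣ x ∣) (last-index-+ t n) (k∣a (suc n) (s≤s z≤n))) n)

  module _ (k : ℕ) where

    divisible-even⇔ : (∃[ m ] (-1ℤ ≤ m × Even m × (∀ n → k ∣ q a (m + + (2 ℕ.* n))))) ⇔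
                      (∃[ m ] (∀ i → m ℕ.≤ i → k ∣ U (2 ℕ.+ i ℕ.* 2)))
    divisible-even⇔ = mk⇔ to from
      where
      to : _ → _
      to (m , -1≤m , even , k∣q) with last-index-view -1≤m
      ... | t , refl with parity-view t
      ...   | i₀ , inj₁ refl = contradiction even (last-index-odd i₀)
      ...   | i₀ , inj₂ refl = i₀ , λ i i₀≤i → subst (k ∣_)
              (trans (q-last-index t (i ℕ.∸ i₀)) (cong U (shuffle i i₀≤i))) (k∣q (i ℕ.∸ i₀))
        where
        shuffle : ∀ i → i₀ ℕ.≤ i → (i ℕ.∸ i₀) ℕ.* 2 ℕ.+ (2 ℕ.+ i₀ ℕ.* 2) ≡ 2 ℕ.+ i ℕ.* 2
        shuffle i i₀≤i = trans (sym (ℕᵖ.*-distribʳ-+ 2 (i ℕ.∸ i₀) (suc i₀)))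
          (cong (ℕ._* 2) (trans (ℕᵖ.+-suc (i ℕ.∸ i₀) i₀) (cong suc (ℕᵖ.m∸n+n≡m i₀≤i))))
      from : _ → _
      from (m , k∣U) = last-index t , -1≤last-index t , last-index-even m , λ n →
        subst (k ∣_) (sym (trans (q-last-index t n) (cong U (shuffle n)))) (k∣U (n ℕ.+ m) (ℕᵖ.m≤n+m m n))
        where
        t : ℕ
        t = suc (m ℕ.* 2)
        shuffle : ∀ n → n ℕ.* 2 ℕ.+ (2 ℕ.+ m ℕ.* 2) ≡ 2 ℕ.+ (n ℕ.+ m) ℕ.* 2
        shuffle n = trans (sym (ℕᵖ.*-distribʳ-+ 2 n (suc m))) (cong (ℕ._* 2) (ℕᵖ.+-suc n m))

    divisible-odd⇔ : (∃[ m ] (-1ℤ ≤ m × Odd m × (∀ n → k ∣ q a (m + + (2 ℕ.* n))))) ⇔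
                     (∃[ m ] (∀ i → m ℕ.≤ i → k ∣ U (3 ℕ.+ i ℕ.* 2)))
    divisible-odd⇔ = mk⇔ to from
      where
      to : _ → _
      to (m , -1≤m , odd , k∣q) with last-index-view -1≤m
      ... | t , refl with parity-view t
      ...   | i₀ , inj₂ refl = contradiction (last-index-even i₀) odd
      -- Here m = 2 i₀ - 1, so the range may begin at q₋₁, one step before the first odd index of
      -- the rotation; hence `suc i`.
      ...   | i₀ , inj₁ refl = i₀ , λ i i₀≤i → subst (k ∣_)
              (trans (q-last-index t (suc i ℕ.∸ i₀)) (cong U (shuffle i i₀≤i))) (k∣q (suc i ℕ.∸ i₀))
        where
        shuffle : ∀ i → i₀ ℕ.≤ i → (suc i ℕ.∸ i₀) ℕ.* 2 ℕ.+ (1 ℕ.+ i₀ ℕ.* 2) ≡ 3 ℕ.+ i ℕ.* 2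
        shuffle i i₀≤i = trans (ℕᵖ.+-suc _ (i₀ ℕ.* 2)) (cong suc (trans (sym (ℕᵖ.*-distribʳ-+ 2 (suc i ℕ.∸ i₀) i₀))
          (cong (ℕ._* 2) (ℕᵖ.m∸n+n≡m (ℕᵖ.m≤n⇒m≤1+n i₀≤i)))))
      from : _ → _
      from (m , k∣U) = last-index t , -1≤last-index t , last-index-odd (suc m) , λ n →
        subst (k ∣_) (sym (trans (q-last-index t n) (cong U (shuffle n)))) (k∣U (n ℕ.+ m) (ℕᵖ.m≤n+m m n))
        where
        t : ℕ
        t = suc m ℕ.* 2
        shuffle : ∀ n → n ℕ.* 2 ℕ.+ (1 ℕ.+ suc m ℕ.* 2) ≡ 3 ℕ.+ (n ℕ.+ m) ℕ.* 2
        shuffle n = trans (ℕᵖ.+-suc _ (suc m ℕ.* 2)) (cong suc (trans (sym (ℕᵖ.*-distribʳ-+ 2 n (suc m)))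
          (cong (ℕ._* 2) (ℕᵖ.+-suc n m))))

-- From the real number to the rotation

fromℤ-mono-< : ∀ {i j} → i ℤ.< j → fromℤ i ℚ.< fromℤ j
fromℤ-mono-< {i} {j} i<j = ℚ.*<* (subst₂ ℤ._<_ (sym (ℤᵖ.*-identityʳ i)) (sym (ℤᵖ.*-identityʳ j)) i<j)

fromℤ-mono-≤ : ∀ {i j} → i ≤ j → fromℤ i ℚ.≤ fromℤ j
fromℤ-mono-≤ {i} {j} i≤j = ℚ.*≤* (subst₂ ℤ._≤_ (sym (ℤᵖ.*-identityʳ i)) (sym (ℤᵖ.*-identityʳ j)) i≤j)

fromℤ-cancel-< : ∀ {i j} → fromℤ i ℚ.< fromℤ j → i ℤ.< j
fromℤ-cancel-< {i} {j} (ℚ.*<* i<j) = subst₂ ℤ._<_ (ℤᵖ.*-identityʳ i) (ℤᵖ.*-identityʳ j) i<j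

fromℤ-cancel-≤ : ∀ {i j} → fromℤ i ℚ.≤ fromℤ j → i ≤ j
fromℤ-cancel-≤ {i} {j} (ℚ.*≤* i≤j) = subst₂ ℤ._≤_ (ℤᵖ.*-identityʳ i) (ℤᵖ.*-identityʳ j) i≤j

fromℤ-homo-* : ∀ i j → fromℤ (i ℤ.* j) ≡ fromℤ i ℚ.* fromℤ j
fromℤ-homo-* i j = ℚᵖ.toℚᵘ-injective (ℚᵘᵖ.≃-sym (ℚᵖ.toℚᵘ-homo-* (fromℤ i) (fromℤ j)))

fromℤ-homo-+ : ∀ i j → fromℤ (i + j) ≡ fromℤ i ℚ.+ fromℤ j
fromℤ-homo-+ i j = ℚᵖ.toℚᵘ-injective (ℚᵘᵖ.≃-sym (ℚᵘᵖ.≃-trans (ℚᵖ.toℚᵘ-homo-+ (fromℤ i) (fromℤ j)) (*≡* (eq i j))))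
  where
  eq : ∀ i j → (i ℤ.* 1ℤ + j ℤ.* 1ℤ) ℤ.* 1ℤ ≡ (i + j) ℤ.* 1ℤ
  eq = solve-∀

fromℤ-homo-neg : ∀ i → fromℤ (- i) ≡ ℚ.- fromℤ i
fromℤ-homo-neg (+ zero)  = refl
fromℤ-homo-neg (+ suc n) = refl
fromℤ-homo-neg -[1+ n ]  = refl

/-*-cancel : ∀ i n .{{_ : ℕ.NonZero n}} → (i ℚ./ n) ℚ.* fromℤ (+ n) ≡ fromℤ i
/-*-cancel i (suc n) = ℚᵖ.toℚᵘ-injective (ℚᵘᵖ.≃-trans (ℚᵖ.toℚᵘ-homo-* (i ℚ./ suc n) (fromℤ (+ suc n)))
  (ℚᵘᵖ.≃-trans (ℚᵘᵖ.*-congʳ (ℚᵖ.toℚᵘ-fromℚᵘ (mkℚᵘ i n))) (*≡* (eq i (+ suc n)))))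
  where
  eq : ∀ i m → i ℤ.* m ℤ.* 1ℤ ≡ i ℤ.* (m ℤ.* 1ℤ)
  eq = solve-∀

≤∣↥∣ : ∀ x → x ℚ.≤ fromℤ (+ ℤ.∣ ℚ.↥ x ∣)
≤∣↥∣ (ℚ.mkℚ (+ n) d _)    = ℚ.*≤* (ℤᵖ.*-monoˡ-≤-nonNeg (+ n) {1ℤ} {+ suc d} (+≤+ (s≤s z≤n)))
≤∣↥∣ (ℚ.mkℚ -[1+ n ] d _) = ℚ.*≤* -≤+

-∣↥∣≤ : ∀ x → fromℤ (- + ℤ.∣ ℚ.↥ x ∣) ℚ.≤ x
-∣↥∣≤ (ℚ.mkℚ (+ zero) d _)  = ℚ.*≤* (0≤+ 0)
-∣↥∣≤ (ℚ.mkℚ (+ suc n) d _) = ℚ.*≤* -≤+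
-∣↥∣≤ (ℚ.mkℚ -[1+ n ] d _)  = ℚ.*≤* (ℤᵖ.*-monoˡ-≤-nonPos -[1+ n ] {1ℤ} {+ suc d} (+≤+ (s≤s z≤n)))

module _ {r : ℚ} {J Z : ℤ} (rJ≡Z : r ℚ.* fromℤ J ≡ fromℤ Z) (s : ℚ) (P : ℤ) (n : ℕ) (1≤n : 1 ℕ.≤ n)
         (sn≡P : s ℚ.* fromℤ (+ n) ≡ fromℤ P) (1≤J : 1ℤ ≤ J) where
  private
    r-scaled : r ℚ.* fromℤ (J ℤ.* + n) ≡ fromℤ (Z ℤ.* + n)
    r-scaled = trans (cong (r ℚ.*_) (fromℤ-homo-* J (+ n)))
      (trans (sym (ℚᵖ.*-assoc r (fromℤ J) (fromℤ (+ n))))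
        (trans (cong (ℚ._* fromℤ (+ n)) rJ≡Z) (sym (fromℤ-homo-* Z (+ n)))))

    s-scaled : s ℚ.* fromℤ (J ℤ.* + n) ≡ fromℤ (J ℤ.* P)
    s-scaled = trans (cong (λ i → s ℚ.* fromℤ i) (ℤᵖ.*-comm J (+ n))) (trans (cong (s ℚ.*_) (fromℤ-homo-* (+ n) J))
      (trans (sym (ℚᵖ.*-assoc s (fromℤ (+ n)) (fromℤ J)))
        (trans (cong (ℚ._* fromℤ J) sn≡P) (trans (sym (fromℤ-homo-* P J)) (cong fromℤ (ℤᵖ.*-comm P J))))))

    nonNeg : ℚ.NonNegative (fromℤ (J ℤ.* + n))
    nonNeg = ℚ.nonNegative (fromℤ-mono-≤ (ℤᵖ.≤-trans (0≤+ 0) (ℤᵖ.≤-trans 0≤J ≤J*n)))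
      where
      0≤J : 0ℤ ≤ J
      0≤J = ℤᵖ.≤-trans (0≤+ 1) 1≤J
      ≤J*n : J ≤ J ℤ.* + n
      ≤J*n = from-gap (0≤J ⊗ gap (+≤+ 1≤n)) (eq J (+ n))
        where
        eq : ∀ J n → J ℤ.* (n - 1ℤ) ≡ J ℤ.* n - J
        eq = solve-∀

  fraction-<ˡ : 1ℤ ≤ J ℤ.* P - Z ℤ.* + n → r ℚ.< s
  fraction-<ˡ 1≤ = ℚᵖ.*-cancelʳ-<-nonNeg (fromℤ (J ℤ.* + n)) {{nonNeg}}
    (subst₂ ℚ._<_ (sym r-scaled) (sym s-scaled) (fromℤ-mono-< (ℤᵖ.suc[i]≤j⇒i<j (from-gap (gap 1≤) (eq (J ℤ.* P) (Z ℤ.* + n))))))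
    where
    eq : ∀ x y → x - y - 1ℤ ≡ x - (1ℤ + y)
    eq = solve-∀

  fraction-<ʳ : 1ℤ ≤ - J ℤ.* P - - Z ℤ.* + n → s ℚ.< r
  fraction-<ʳ 1≤ = ℚᵖ.*-cancelʳ-<-nonNeg (fromℤ (J ℤ.* + n)) {{nonNeg}}
    (subst₂ ℚ._<_ (sym s-scaled) (sym r-scaled) (fromℤ-mono-< (ℤᵖ.suc[i]≤j⇒i<j (from-gap (gap 1≤) (eq J P Z (+ n))))))
    where
    eq : ∀ J P Z n → - J ℤ.* P - - Z ℤ.* n - 1ℤ ≡ Z ℤ.* n - (1ℤ + J ℤ.* P)
    eq = solve-∀

module _ (α : ℝ) (irrational : Irrational α) where

  -- Irrationality enters here: by locatedness, a rational that is neither above nor below α would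
  -- have the same cuts as α.
  ¬upper∧¬lower : ∀ {r} → ¬ Upper α r → ¬ ¬ Lower α r
  ¬upper∧¬lower {r} r≤α α≤r = irrational (r , λ s →
      mk⇔ (λ s<α → ℚᵖ.≰⇒> (λ r≤s → α≤r (lower-closed α r≤s s<α)))
          (λ s<r → [ s<r ]→lower)
    , mk⇔ (λ α<s → ℚᵖ.≰⇒> (λ s≤r → r≤α (upper-closed α s≤r α<s)))
          (λ r<s → [ r<s ]→upper))
    where
    [_]→lower : ∀ {s} → s ℚ.< r → Lower α s
    [ s<r ]→lower with located α s<r
    ... | inj₁ s<α = s<α
    ... | inj₂ α<r = ⊥-elim (r≤α α<r)
    [_]→upper : ∀ {s} → r ℚ.< s → Upper α s
    [ r<s ]→upper with located α r<s
    ... | inj₁ r<α = ⊥-elim (α≤r r<α)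
    ... | inj₂ α<s = α<s

module _ {α : ℝ} {s : ℕ → ℚ} (limit : s ⟶ α) where
  private
    p<q⇒0<q-p : ∀ {x y} → x ℚ.< y → 0ℚ ℚ.< y ℚ.- x
    p<q⇒0<q-p {x} {y} x<y = subst (ℚ._< y ℚ.- x) (ℚᵖ.+-inverseʳ x) (ℚᵖ.+-monoˡ-< (ℚ.- x) x<y)

    x+[y-x] : ∀ x y → x ℚ.+ (y ℚ.- x) ≡ y
    x+[y-x] x y = trans (cong (x ℚ.+_) (ℚᵖ.+-comm y (ℚ.- x)))
      (trans (sym (ℚᵖ.+-assoc x (ℚ.- x) y)) (trans (cong (ℚ._+ y) (ℚᵖ.+-inverseʳ x)) (ℚᵖ.+-identityˡ y)))

    x-[x-y] : ∀ x y → x ℚ.- (x ℚ.- y) ≡ y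
    x-[x-y] x y = trans (cong (x ℚ.+_) (trans (ℚᵖ.neg-distrib-+ x (ℚ.- y)) (trans (cong (ℚ.- x ℚ.+_) (neg-neg y)) (ℚᵖ.+-comm (ℚ.- x) y)))) (x+[y-x] x y)
      where
      neg-neg : ∀ y → ℚ.- (ℚ.- y) ≡ y
      neg-neg (ℚ.mkℚ (+ zero) _ _)  = refl
      neg-neg (ℚ.mkℚ (+ suc _) _ _) = refl
      neg-neg (ℚ.mkℚ -[1+ _ ] _ _)  = refl

  -- Strict inequalities become weak in the limit, so the conclusion is a negated cut;
  -- `¬upper∧¬lower` later restores strictness. If α < r, openness gives t with α < t < r, and ε = r
  -- - t puts t below α as well.
  eventually>⇒¬upper : ∀ {r} → ∃[ n₀ ] (∀ n → n₀ ℕ.≤ n → r ℚ.< s n) → ¬ Upper α r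
  eventually>⇒¬upper {r} (n₀ , r<s) α<r =
    let t , t<r , α<t = upper-open α α<r
        n₁ , close = limit (r ℚ.- t) (p<q⇒0<q-p t<r)
        n = n₀ ℕ.+ n₁
        below , _ = close n (ℕᵖ.m≤n+m n₁ n₀)
    in disjoint α (lower-closed α (subst (ℚ._≤ s n ℚ.- (r ℚ.- t)) (x-[x-y] r t)
         (ℚᵖ.+-monoˡ-≤ (ℚ.- (r ℚ.- t)) (ℚᵖ.<⇒≤ (r<s n (ℕᵖ.m≤m+n n₀ n₁))))) below) α<t

  eventually<⇒¬lower : ∀ {r} → ∃[ n₀ ] (∀ n → n₀ ℕ.≤ n → s n ℚ.< r) → ¬ Lower α r
  eventually<⇒¬lower {r} (n₀ , s<r) r<α =
    let t , r<t , t<α = lower-open α r<α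
        n₁ , close = limit (t ℚ.- r) (p<q⇒0<q-p r<t)
        n = n₀ ℕ.+ n₁
        _ , above = close n (ℕᵖ.m≤n+m n₁ n₀)
    in disjoint α t<α (upper-closed α (subst (s n ℚ.+ (t ℚ.- r) ℚ.≤_) (x+[y-x] r t)
         (ℚᵖ.+-monoˡ-≤ (t ℚ.- r) (ℚᵖ.<⇒≤ (s<r n (ℕᵖ.m≤m+n n₀ n₁))))) above)

indicator-cases : (em : ExcludedMiddle 0ℓ) (X : Set) →
  (X × indicator em X ≡ 1) ⊎ (¬ X × indicator em X ≡ 0)
indicator-cases em X with em {X}
... | yes x = inj₁ (x , refl)
... | no ¬x = inj₂ (¬x , refl)

module FromReal (em : ExcludedMiddle 0ℓ) (α : ℝ) (irrational : Irrational α)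
  (h h′ : ℕ) .{{_ : ℕ.NonZero (h ℕ.+ h′)}} (1≤h : 1 ℕ.≤ h) (1≤h′ : 1 ℕ.≤ h′)
  (a : ℕ → ℕ) (cf : IsContinuedFraction α a) where
  open IsContinuedFraction cf

  k : ℕ
  k = h ℕ.+ h′

  c : ℚ
  c = + h ℚ./ k

  num : ℕ → ℤ
  num n = + recurrence 0 1 a (2 ℕ.+ n)

  den : ℕ → ℕ
  den n = recurrence 1 0 a (2 ℕ.+ n)

  c*k≡h : c ℚ.* fromℤ (+ k) ≡ fromℤ (+ h)
  c*k≡h = /-*-cancel (+ h) k

  convergent-cancel : ∀ n → convergent a positiveTail n ℚ.* fromℤ (+ den n) ≡ fromℤ (num n)
  convergent-cancel n = /-*-cancel (num n) (den n) {{ℕ.>-nonZero (1≤q positiveTail n)}}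

  pos⇒¬upper : ∀ {r J Z} → 1ℤ ≤ J → r ℚ.* fromℤ J ≡ fromℤ Z → Pos num den J Z → ¬ Upper α r
  pos⇒¬upper {r} {J} {Z} 1≤J rJ≡Z (positive (n₀ , pos)) = eventually>⇒¬upper {α} {convergent a positiveTail} limit {r} (n₀ , λ n n₀≤n →
    fraction-<ˡ {r} {J} {Z} rJ≡Z (convergent a positiveTail n) (num n) (den n) (1≤q positiveTail n) (convergent-cancel n) 1≤J (pos n n₀≤n))

  neg⇒¬lower : ∀ {r J Z} → 1ℤ ≤ J → r ℚ.* fromℤ J ≡ fromℤ Z → Pos num den (- J) (- Z) → ¬ Lower α r
  neg⇒¬lower {r} {J} {Z} 1≤J rJ≡Z (positive (n₀ , pos)) = eventually<⇒¬lower {α} {convergent a positiveTail} limit {r} (n₀ , λ n n₀≤n →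
    fraction-<ʳ {r} {J} {Z} rJ≡Z (convergent a positiveTail n) (num n) (den n) (1≤q positiveTail n) (convergent-cancel n) 1≤J (pos n n₀≤n))

  1≤tail : ∀ n → 1 ℕ.≤ a (2 ℕ.+ n)
  1≤tail n = positiveTail (2 ℕ.+ n) (s≤s z≤n)

  num-rec : Recurrent (λ n → a (2 ℕ.+ n)) num
  num-rec n = cong (_+ num n) (ℤᵖ.pos-* (a (2 ℕ.+ n)) (recurrence 0 1 a (3 ℕ.+ n)))

  den-recℤ : Recurrent (λ n → a (2 ℕ.+ n)) (λ n → + den n)
  den-recℤ n = cong (_+ + den n) (ℤᵖ.pos-* (a (2 ℕ.+ n)) (den (1 ℕ.+ n)))

  det₀ : num 1 ℤ.* + den 0 - num 0 ℤ.* + den 1 ≡ 1ℤ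
  det₀ = trans (cong₂ (λ s t → s - t)
      (cong₂ ℤ._*_ (trans (cong (_+ 1ℤ) (trans (ℤᵖ.pos-* (a 1) (a 0 ℕ.* 1 ℕ.+ 0)) (cong (+ a 1 ℤ.*_) num₀))) refl) den₀)
      (cong₂ ℤ._*_ num₀ (trans (cong (_+ 0ℤ) (ℤᵖ.pos-* (a 1) (a 0 ℕ.* 0 ℕ.+ 1))) (cong (λ t → + a 1 ℤ.* t + 0ℤ) den₀))))
    (eq (+ a 0) (+ a 1))
    where
    num₀ : num 0 ≡ + a 0
    num₀ = cong +_ (trans (ℕᵖ.+-identityʳ _) (ℕᵖ.*-identityʳ (a 0)))
    den₀ : + den 0 ≡ 1ℤ
    den₀ = cong (λ t → + (t ℕ.+ 1)) (ℕᵖ.*-zeroʳ (a 0))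
    eq : ∀ x y → (y ℤ.* x + 1ℤ) ℤ.* 1ℤ - x ℤ.* (y ℤ.* 1ℤ + 0ℤ) ≡ 1ℤ
    eq = solve-∀

  -- Two vanishing initial heights are impossible, since with determinant 1 they would give J = 0.
  pos⊎neg : ∀ J Z → 1ℤ ≤ J → Pos num den J Z ⊎ Pos num den (- J) (- Z)
  pos⊎neg J Z 1≤J with eventual-sign 1≤tail {height num den J Z} (height-recurrent {λ n → a (2 ℕ.+ n)} {num} {den} num-rec den-recℤ J Z)
  ... | inj₁ pos = inj₁ (positive pos)
  ... | inj₂ (inj₁ (n₀ , neg)) = inj₂ (positive (n₀ , λ n n₀≤n →
          subst (1ℤ ≤_) (eq J Z (num n) (+ den n)) (neg n n₀≤n)))
    where
    eq : ∀ J Z x y → - (J ℤ.* x - Z ℤ.* y) ≡ - J ℤ.* x - - Z ℤ.* y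
    eq = solve-∀
  ... | inj₂ (inj₂ (y₀≡0 , y₁≡0)) = absurd-gap (gap 1≤J) (cong (_- 1ℤ) J≡0)
    where
    eq₀ : ∀ x y → x ℤ.* 0ℤ - y ℤ.* 0ℤ ≡ 0ℤ
    eq₀ = solve-∀
    J≡0 : J ≡ 0ℤ
    J≡0 = trans (sym (ℤᵖ.*-identityʳ J)) (trans (cong (J ℤ.*_) (sym det₀))
      (trans (height-determinant num den J Z 0)
        (trans (cong₂ (λ s t → + den 0 ℤ.* s - + den 1 ℤ.* t) y₁≡0 y₀≡0) (eq₀ (+ den 0) (+ den 1)))))

  upper⇒neg : ∀ {r J Z} → 1ℤ ≤ J → r ℚ.* fromℤ J ≡ fromℤ Z → Upper α r → Pos num den (- J) (- Z)
  upper⇒neg {r} {J} {Z} 1≤J rJ≡Z α<r with pos⊎neg J Z 1≤J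
  ... | inj₁ pos = ⊥-elim (pos⇒¬upper {r} {J} {Z} 1≤J rJ≡Z pos α<r)
  ... | inj₂ neg = neg

  ¬upper⇒pos : ∀ {r J Z} → 1ℤ ≤ J → r ℚ.* fromℤ J ≡ fromℤ Z → ¬ Upper α r → Pos num den J Z
  ¬upper⇒pos {r} {J} {Z} 1≤J rJ≡Z r≤α with pos⊎neg J Z 1≤J
  ... | inj₁ pos = pos
  ... | inj₂ neg = ⊥-elim (¬upper∧¬lower α irrational {r} r≤α (neg⇒¬lower {r} {J} {Z} 1≤J rJ≡Z neg))

  Visit : ℕ → Set
  Visit j = ¬ Upper y 0ℚ × Upper y c
    where y = fractionalPart em (fromℤ (+ suc j) · α)

  g : ℕ → ℤ
  g zero    = 0ℤ
  g (suc j) = + k ℤ.* + indicator em (Visit j) - + h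

  module _ (j : ℕ) where
    private
      jℚ : ℚ
      jℚ = fromℤ (+ suc j)

      y : ℝ
      y = fractionalPart em (jℚ · α)

      z : ℤ
      z = ⌊_⌋ em (jℚ · α)

      cancel : ∀ x → x ℚ.* 1/ jℚ ℚ.* jℚ ≡ x
      cancel x = trans (ℚᵖ.*-assoc x (1/ jℚ) jℚ) (trans (cong (x ℚ.*_) (ℚᵖ.*-inverseˡ jℚ)) (ℚᵖ.*-identityʳ x))

      1≤j : 1ℤ ≤ + suc j
      1≤j = +≤+ (s≤s z≤n)

      1≤kj : 1ℤ ≤ + k ℤ.* + suc j
      1≤kj = subst (1ℤ ≤_) (ℤᵖ.pos-* k (suc j)) (+≤+ (ℕᵖ.*-mono-≤ (ℕᵖ.≤-trans 1≤h (ℕᵖ.m≤m+n h h′)) (s≤s {0} {j} z≤n)))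

      c+z : (c ℚ.+ fromℤ z) ℚ.* 1/ jℚ ℚ.* fromℤ (+ k ℤ.* + suc j) ≡ fromℤ (+ k ℤ.* z + + h)
      c+z = begin
        x ℚ.* fromℤ (+ k ℤ.* + suc j)          ≡⟨ cong (λ t → x ℚ.* fromℤ t) (ℤᵖ.*-comm (+ k) (+ suc j)) ⟩
        x ℚ.* fromℤ (+ suc j ℤ.* + k)          ≡⟨ cong (x ℚ.*_) (fromℤ-homo-* (+ suc j) (+ k)) ⟩
        x ℚ.* (jℚ ℚ.* fromℤ (+ k))           ≡⟨ ℚᵖ.*-assoc x jℚ (fromℤ (+ k)) ⟨
        x ℚ.* jℚ ℚ.* fromℤ (+ k)             ≡⟨ cong (ℚ._* fromℤ (+ k)) (cancel (c ℚ.+ fromℤ z)) ⟩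
        (c ℚ.+ fromℤ z) ℚ.* fromℤ (+ k)      ≡⟨ ℚᵖ.*-distribʳ-+ (fromℤ (+ k)) c (fromℤ z) ⟩
        c ℚ.* fromℤ (+ k) ℚ.+ fromℤ z ℚ.* fromℤ (+ k)
          ≡⟨ cong₂ ℚ._+_ c*k≡h (sym (fromℤ-homo-* z (+ k))) ⟩
        fromℤ (+ h) ℚ.+ fromℤ (z ℤ.* + k)      ≡⟨ fromℤ-homo-+ (+ h) (z ℤ.* + k) ⟨
        fromℤ (+ h + z ℤ.* + k)                ≡⟨ cong fromℤ (eq (+ h) z (+ k)) ⟩
        fromℤ (+ k ℤ.* z + + h)                ∎
        where
        open ≡-Reasoning
        x : ℚ
        x = (c ℚ.+ fromℤ z) ℚ.* 1/ jℚ
        eq : ∀ h z k → h + z ℤ.* k ≡ k ℤ.* z + h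
        eq = solve-∀

    0≤y : ¬ Upper α (fromℤ z ℚ.* 1/ jℚ)
    0≤y = proj₁ (proj₂ (integerPart em (jℚ · α)))

    y<1 : Upper α (fromℤ (z + 1ℤ) ℚ.* 1/ jℚ)
    y<1 = proj₂ (proj₂ (integerPart em (jℚ · α)))

    visit⇒inside : Upper y c → Inside num den h h′ (suc j) z
    visit⇒inside y<c =
      ¬upper⇒pos {fromℤ z ℚ.* 1/ jℚ} {+ suc j} {z} 1≤j (cancel (fromℤ z)) 0≤y ,
      upper⇒neg {(c ℚ.+ fromℤ z) ℚ.* 1/ jℚ} {+ k ℤ.* + suc j} {+ k ℤ.* z + + h} 1≤kj c+z y<c

    ¬visit⇒outside : ¬ Upper y c → Outside num den h h′ (suc j) z
    ¬visit⇒outside c≤y =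
      ¬upper⇒pos {(c ℚ.+ fromℤ z) ℚ.* 1/ jℚ} {+ k ℤ.* + suc j} {+ k ℤ.* z + + h} 1≤kj c+z c≤y ,
      upper⇒neg {fromℤ (z + 1ℤ) ℚ.* 1/ jℚ} {+ suc j} {z + 1ℤ} 1≤j (cancel (fromℤ (z + 1ℤ))) y<1

    0≤y′ : ¬ Upper y 0ℚ
    0≤y′ α<z = 0≤y (subst (λ r → Upper α (r ℚ.* 1/ jℚ)) (ℚᵖ.+-identityˡ (fromℤ z)) α<z)

    floor-exists : ∃[ z ] (Upper y c → Inside num den h h′ (suc j) z) × (¬ Upper y c → Outside num den h h′ (suc j) z)
    floor-exists = z , visit⇒inside , ¬visit⇒outside

  place′ : ∀ j → (Visit j × indicator em (Visit j) ≡ 1) ⊎ (¬ Visit j × indicator em (Visit j) ≡ 0) →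
    (∃[ z ] (Inside num den h h′ (suc j) z × g (suc j) ≡ + h′)) ⊎ (∃[ z ] (Outside num den h h′ (suc j) z × g (suc j) ≡ - + h))
  place′ j (inj₁ ((_ , y<c) , visit)) =
    let z , inside , _ = floor-exists j in
    inj₁ (z , inside y<c , trans (cong (λ t → + k ℤ.* + t - + h) visit) (eq (+ h) (+ h′)))
    where
    eq : ∀ h h′ → (h + h′) ℤ.* 1ℤ - h ≡ h′
    eq = solve-∀
  place′ j (inj₂ (¬visit , visit)) =
    let z , _ , outside = floor-exists j in
    inj₂ (z , outside (λ y<c → ¬visit (0≤y′ j , y<c)) , trans (cong (λ t → + k ℤ.* + t - + h) visit) (eq (+ k) (+ h)))
    where
    eq : ∀ k h → k ℤ.* 0ℤ - h ≡ - h
    eq = solve-∀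

  place : ∀ j → 1 ℕ.≤ j →
    (∃[ z ] (Inside num den h h′ j z × g j ≡ + h′)) ⊎ (∃[ z ] (Outside num den h h′ j z × g j ≡ - + h))
  place (suc j) _ = place′ j (indicator-cases em (Visit j))

  rotation : Rotation h h′
  rotation = record
    { a     = λ n → a (2 ℕ.+ n)
    ; p     = num
    ; q     = den
    ; 1≤a   = 1≤tail
    ; p-rec = num-rec
    ; q-rec = λ n → refl
    ; 1≤q₀  = 1≤q positiveTail 0
    ; q₀≤q₁ = subst₂ ℕ._≤_ (sym den₀) (sym den₁) (positiveTail 1 ℕᵖ.≤-refl)
    ; det₀  = det₀
    ; 1≤h   = 1≤h
    ; 1≤h′  = 1≤h′
    ; g     = g
    ; place = place
    }
    where
    den₀ : den 0 ≡ 1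
    den₀ = cong (ℕ._+ 1) (ℕᵖ.*-zeroʳ (a 0))
    den₁ : den 1 ≡ a 1
    den₁ = trans (ℕᵖ.+-identityʳ (a 1 ℕ.* den 0)) (trans (cong (a 1 ℕ.*_) den₀) (ℕᵖ.*-identityʳ (a 1)))

  S : ℕ → ℤ
  S = Core.S rotation

  S≡visits : ∀ n → S n ≡ + k ℤ.* + visits em α c n - + h ℤ.* + n
  S≡visits zero = eq (+ k) (+ h)
    where
    eq : ∀ k h → 0ℤ ≡ k ℤ.* 0ℤ - h ℤ.* 0ℤ
    eq = solve-∀
  S≡visits (suc n) = trans (cong (_+ g (suc n)) (S≡visits n))
    (eq (+ k) (+ h) (+ visits em α c n) (+ indicator em (Visit n)) (+ n))
    where
    eq : ∀ k h v i n → k ℤ.* v - h ℤ.* n + (k ℤ.* i - h) ≡ k ℤ.* (v + i) - h ℤ.* (1ℤ + n)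
    eq = solve-∀

  D*k≡S : ∀ n → D em α c n ℚ.* fromℤ (+ k) ≡ fromℤ (S n)
  D*k≡S n = begin
    (v ℚ.- c ℚ.* fromℤ (+ n)) ℚ.* K                ≡⟨ ℚᵖ.*-distribʳ-+ K v (ℚ.- (c ℚ.* fromℤ (+ n))) ⟩
    v ℚ.* K ℚ.+ ℚ.- (c ℚ.* fromℤ (+ n)) ℚ.* K      ≡⟨ cong (v ℚ.* K ℚ.+_) (sym (ℚᵖ.neg-distribˡ-* (c ℚ.* fromℤ (+ n)) K)) ⟩
    v ℚ.* K ℚ.- c ℚ.* fromℤ (+ n) ℚ.* K            ≡⟨ cong₂ ℚ._-_ (trans (ℚᵖ.*-comm v K) (sym (fromℤ-homo-* (+ k) (+ visits em α c n)))) cnK ⟩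
    fromℤ (+ k ℤ.* + visits em α c n) ℚ.- fromℤ (+ h ℤ.* + n) ≡⟨ cong (fromℤ (+ k ℤ.* + visits em α c n) ℚ.+_) (fromℤ-homo-neg (+ h ℤ.* + n)) ⟨
    fromℤ (+ k ℤ.* + visits em α c n) ℚ.+ fromℤ (- (+ h ℤ.* + n)) ≡⟨ fromℤ-homo-+ (+ k ℤ.* + visits em α c n) (- (+ h ℤ.* + n)) ⟨
    fromℤ (+ k ℤ.* + visits em α c n - + h ℤ.* + n)    ≡⟨ cong fromℤ (S≡visits n) ⟨
    fromℤ (S n)                                    ∎
    where
    open ≡-Reasoning
    v K : ℚ
    v = fromℤ (+ visits em α c n)
    K = fromℤ (+ k)
    cnK : c ℚ.* fromℤ (+ n) ℚ.* K ≡ fromℤ (+ h ℤ.* + n)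
    cnK = trans (ℚᵖ.*-assoc c (fromℤ (+ n)) K) (trans (cong (c ℚ.*_) (ℚᵖ.*-comm (fromℤ (+ n)) K))
      (trans (sym (ℚᵖ.*-assoc c K (fromℤ (+ n)))) (trans (cong (ℚ._* fromℤ (+ n)) c*k≡h) (sym (fromℤ-homo-* (+ h) (+ n))))))

  private
    k-positive : ℚ.Positive (fromℤ (+ k))
    k-positive = ℚ.positive (fromℤ-mono-< (ℤ.+<+ (ℕᵖ.≤-trans 1≤h (ℕᵖ.m≤m+n h h′))))

    k-nonNegative : ℚ.NonNegative (fromℤ (+ k))
    k-nonNegative = ℚ.nonNegative (fromℤ-mono-≤ (0≤+ k))

  D-bounded-above⇔ : BoundedAbove (D em α c) ⇔ (∃[ B ] (∀ n → S n ≤ + B))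
  D-bounded-above⇔ = mk⇔
    (λ (B , D≤B) → ℤ.∣ ℚ.↥ (B ℚ.* fromℤ (+ k)) ∣ , λ n → fromℤ-cancel-≤
      (ℚᵖ.≤-trans (subst (ℚ._≤ B ℚ.* fromℤ (+ k)) (D*k≡S n) (ℚᵖ.*-monoʳ-≤-nonNeg (fromℤ (+ k)) {{k-nonNegative}} (D≤B n)))
        (≤∣↥∣ (B ℚ.* fromℤ (+ k)))))
    (λ (B , S≤B) → + B ℚ./ k , λ n → ℚᵖ.*-cancelʳ-≤-pos (fromℤ (+ k)) {{k-positive}}
      (subst₂ ℚ._≤_ (sym (D*k≡S n)) (sym (/-*-cancel (+ B) k)) (fromℤ-mono-≤ (S≤B n))))

  D-bounded-below⇔ : BoundedBelow (D em α c) ⇔ (∃[ B ] (∀ n → - + B ≤ S n))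
  D-bounded-below⇔ = mk⇔
    (λ (B , B≤D) → ℤ.∣ ℚ.↥ (B ℚ.* fromℤ (+ k)) ∣ , λ n → fromℤ-cancel-≤
      (ℚᵖ.≤-trans (-∣↥∣≤ (B ℚ.* fromℤ (+ k)))
        (subst (B ℚ.* fromℤ (+ k) ℚ.≤_) (D*k≡S n) (ℚᵖ.*-monoʳ-≤-nonNeg (fromℤ (+ k)) {{k-nonNegative}} (B≤D n)))))
    (λ (B , B≤S) → - + B ℚ./ k , λ n → ℚᵖ.*-cancelʳ-≤-pos (fromℤ (+ k)) {{k-positive}}
      (subst₂ ℚ._≤_ (sym (/-*-cancel (- + B) k)) (sym (D*k≡S n)) (fromℤ-mono-≤ (B≤S n))))

  module _ (coprime : Coprime h k) where
    open Denominators a using (U; divisible-even⇔; divisible-odd⇔; divisible⇔type)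
    private
      -- S n = 0 says that h n is k times the number of visits, and coprimality of h and k passes
      -- the divisor k to n.
      S≡0⇒∣ : ∀ n → S n ≡ 0ℤ → k ∣ n
      S≡0⇒∣ n S≡0 = coprime-divisor {k} {h} {n} (Coprimality.sym coprime)
        (divides (visits em α c n) (ℤᵖ.+-injective (trans (ℤᵖ.pos-* h n)
          (trans (sym (ℤᵖ.i-j≡0⇒i≡j (+ k ℤ.* + visits em α c n) (+ h ℤ.* + n) (trans (sym (S≡visits n)) S≡0)))
            (trans (ℤᵖ.*-comm (+ k) _) (sym (ℤᵖ.pos-* (visits em α c n) k)))))))

      S′ : ℕ → ℤ
      S′ = Core.S (reflect rotation)

      cast : ∀ {n} → k ∣ n → h′ ℕ.+ h ∣ n
      cast {n} = subst (_∣ n) (ℕᵖ.+-comm h h′)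

      uncast : ∀ {n} → h′ ℕ.+ h ∣ n → k ∣ n
      uncast {n} = subst (_∣ n) (ℕᵖ.+-comm h′ h)

    bounded-above⇔ : BoundedAbove (D em α c) ⇔ (∃[ m ] (-1ℤ ≤ m × Even m × (∀ n → k ∣ q a (m + + (2 ℕ.* n)))))
    bounded-above⇔ = mk⇔
      (λ bounded →
        let B , S≤B = Equivalence.to D-bounded-above⇔ bounded
            m , k∣q = Unbounded.bounded-below⇒divisible-odd (reflect rotation) (S≡0⇒∣-reflect rotation S≡0⇒∣) em B
                        (λ n → subst (- + B ≤_) (sym (S-reflect rotation n)) (ℤᵖ.neg-mono-≤ (S≤B n)))
        -- Index 1 + 2i of the reflection is index 2 (i + 1) of α, hence `suc m`.
        in Equivalence.from (divisible-even⇔ k) (suc m , λ { (suc i) (s≤s m≤i) → uncast (k∣q i m≤i) }))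
      (λ divisible →
        let m , k∣q = Equivalence.to (divisible-even⇔ k) divisible
        in Equivalence.from D-bounded-above⇔ (Bounded.divisible-even⇒bounded-above rotation m k∣q))

    bounded-below⇔ : BoundedBelow (D em α c) ⇔ (∃[ m ] (-1ℤ ≤ m × Odd m × (∀ n → k ∣ q a (m + + (2 ℕ.* n)))))
    bounded-below⇔ = mk⇔
      (λ bounded →
        let B , B≤S = Equivalence.to D-bounded-below⇔ bounded
        in Equivalence.from (divisible-odd⇔ k) (Unbounded.bounded-below⇒divisible-odd rotation S≡0⇒∣ em B B≤S))
      (λ divisible →
        let m , k∣q = Equivalence.to (divisible-odd⇔ k) divisible
            B , S′≤B = Bounded.divisible-even⇒bounded-above (reflect rotation) m (λ i m≤i → cast (k∣q i m≤i))
        in Equivalence.from D-bounded-below⇔ (B , λ n → subst (- + B ≤_)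
             (trans (cong -_ (S-reflect rotation n)) (ℤᵖ.neg-involutive (S n))) (ℤᵖ.neg-mono-≤ (S′≤B n))))

-- The equivalences for c = h / k

c<1⇒h<k : ∀ h k .{{_ : NonZero k}} → + h / k < 1ℚ → h ℕ.< k
c<1⇒h<k h k@(suc _) c<1 = ℤᵖ.drop‿+<+ (fromℤ-cancel-< (subst₂ _<_ (/-*-cancel (+ h) k) (ℚᵖ.*-identityˡ (fromℤ (+ k)))
  (ℚᵖ.*-monoˡ-<-pos (fromℤ (+ k)) c<1)))

theorem1p2 : (em : ExcludedMiddle 0ℓ)
    (α : ℝ) → IsPositive α → Irrational α →
    (h k : ℕ) .{{_ : NonZero h}} .{{_ : NonZero k}} → Coprime h k →
    let c = + h / k in
    0ℚ < c → c < 1ℚ →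
    (a : ℕ → ℕ) → IsContinuedFraction α a →
    let
      [1]  = BoundedAbove (D em α c)
      [2]  = ∃[ m ] (-1ℤ ≤ m × Even m × (∀ n → k ∣ (q a (m +ᶻ + (2 * n)))))
      [3]  = ∃[ m ] (-1ℤ ≤ m × Even m × OfType k (prefix a m) × (∀ n → 1 ≤ᴺ n → k ∣ (a ∣ m +ᶻ + (2 * n) ∣)))
      [1'] = BoundedBelow (D em α c)
      [2'] = ∃[ m ] (-1ℤ ≤ m × Odd m × (∀ n → k ∣ (q a (m +ᶻ + (2 * n)))))
      [3'] = ∃[ m ] (-1ℤ ≤ m × Odd m × OfType k (prefix a m) × (∀ n → 1 ≤ᴺ n → k ∣ (a ∣ m +ᶻ + (2 * n) ∣)))
    in
    (([1] ⇔ [2]) × ([2] ⇔ [3])) × (([1'] ⇔ [2']) × ([2'] ⇔ [3']))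
theorem1p2 em α _ irrational h k coprime _ c<1 a cf
  with ℕᵖ.m≤n⇒∃[o]m+o≡n (c<1⇒h<k h k c<1)
-- c < 1 means k = h + (1 + h′), so 1 - c has the positive numerator 1 + h′.
... | h′ , eq with trans (ℕᵖ.+-suc h h′) eq
...   | refl =
  (bounded-above⇔ coprime , divisible⇔type k Even 1<k) ,
  (bounded-below⇔ coprime , divisible⇔type k Odd 1<k)
  where
  1≤h : 1 ℕ.≤ h
  1≤h = ℕ.>-nonZero⁻¹ h
  1<k : 1 ℕ.< k
  1<k = ℕᵖ.≤-<-trans 1≤h (ℕᵖ.m<m+n h (s≤s z≤n))
  open FromReal em α irrational h (suc h′) 1≤h (s≤s z≤n) a cf using (bounded-above⇔; bounded-below⇔)
  open Denominators a using (divisible⇔type)
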